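{- A language $L\subseteq T^*$ over a finite alphabet $T$ is multiple context-free (i.e. $L=L(G)$ for some multiple context-free grammar $G$ with terminal alphabet $T$) if and only if $L=L(G')$ for some linear logic grammar $G'$ whose lexicon is $\otimes$-free (no formula occurring in a sequent of the lexicon contains the connective $\otimes$).
   Context: Multiple context-free grammars (MCFG). An MCFG is a tuple $G=(N,T,S,P)$ where $N$ is a finite alphabet of predicate symbols (nonterminals) of nonzero arities, $T$ a finite alphabet of terminals, $S\in N$ unary, and $P$ a finite set of productions $B_1(x^1_1,\dots,x^1_{k_1}),\dots,B_n(x^n_1,\dots,x^n_{k_n})\vdash A(s_1,\dots,s_k)$ with $n\ge 0$, $A,B_j\in N$ of arities $k,k_j$, the $x^j_i$ pairwise distinct variables not in $T$, $s_1,\dots,s_k$ words over $T$ and the variables, and every variable $x^j_i$ occurring exactly once in exactly one of $s_1,\dots,s_k$. Derivable formulas: if the production above is in $P$ and $B_j(s'^j_1,\dots,s'^j_{k_j})$ are derivable (for $j=1,\dots,n$; vacuous if $n=0$), then $A(t_1,\dots,t_k)$ is derivable, where $t_m$ is obtained from $s_m$ by substituting $s'^j_i$ for $x^j_i$. $L(G)=\{w\in T^*: S(w)\text{ derivable}\}$. Cowordisms. A boundary $X$ is a natural number $|X|$ with a subset $X_l\subseteq\{1,\dots,|X|\}$ of left endpoints; $X_r$ is its complement (right endpoints). $X\otimes Y$: $|X\otimes Y|=|X|+|Y|$, $(X\otimes Y)_l=X_l\cup\{|X|+i:i\in Y_l\}$; $\mathbf 1$ is the boundary of cardinality $0$; $X^\perp$: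 $|X^\perp|=|X|$, $(X^\perp)_l=\{|X|+1-i: i\in X_r\}$. A regular multiword with boundary $X$ over $T$ is a set of edges $(i,w,j)$, $w\in T^*$, forming a perfect matching of $\{1,\dots,|X|\}$ with each edge going from a left endpoint $i$ to a right endpoint $j$. A multiword is a pair $(M_0,M_c)$ of a regular multiword and a finite multiset of cyclic words (words modulo cyclic permutation); it is regular if $M_c=\emptyset$. A cowordism $\sigma:X\to Y$ is a multiword with boundary $Y\otimes X^\perp$, vertex $|Y|+|X|+1-i$ representing vertex $i$ of $X$. Composition $\tau\circ\sigma$ of $\sigma:X\to Y,\tau:Y\to Z$: identify vertex $i$ of $\sigma$ with vertex $|Z|+|Y|+1-i$ of $\tau$ ($1\le i\le |Y|$); maximal paths between non-identified vertices become edges labelled by the concatenation of labels along the path (vertex $j\le|Z|$ of $\tau$ keeps number $j$, vertex $|Y|+j$ of $\sigma$ becomes $|Z|+j$), closed cycles contribute their cyclic words, and singular parts are added. $\mathrm{id}_X$ has edges $(i,\epsilon,2|X|+1-i)$, $i\in X_l$, and $(2|X|+1-i,\epsilon,i)$, $i\in X_r$. For $\sigma:X\to Y$, $\tau:Z\to W$, $\sigma\otimes\tau:X\otimes Z\to Y\otimes W$ has boundary $Y\otimes W\otimes Z^\perp\otimes X^\perp$: the edges of $\sigma$ with vertex $i$ renumbered $i$ if $i\le|Y|$ and $i+|W|+|Z|$ otherwise, the edges of $\tau$ shifted by $|Y|$, singular parts added. Linear logic and its interpretation. Given a set $N$ of positive literals, LL formulas are built from literals $P,P^\perp$ ($P\in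 N$) by $\otimes$ and $\wp$; negation is defined by $(P^\perp)^\perp=P$, $(A\otimes B)^\perp=A^\perp\wp B^\perp$, $(A\wp B)^\perp=A^\perp\otimes B^\perp$. Rules: $\vdash A^\perp,A$ (Id); from $\vdash\Gamma,A$ and $\vdash A^\perp,\Delta$ infer $\vdash\Gamma,\Delta$ (Cut); from $\vdash\Gamma,A,B,\Delta$ infer $\vdash\Gamma,B,A,\Delta$ (Ex); from $\vdash\Gamma,A,B$ infer $\vdash\Gamma,A\wp B$; from $\vdash\Gamma,A$ and $\vdash B,\Delta$ infer $\vdash\Gamma,A\otimes B,\Delta$. Given a boundary $[P]$ for each $P\in N$, set $[A\otimes B]=[A]\otimes[B]$, $[A^\perp]=[A]^\perp$ (so $[A\wp B]=[B]\otimes[A]$), and $[A_1,\dots,A_n]=[A_n]\otimes\dots\otimes[A_1]$. A derivation of $\vdash\Gamma$ is interpreted as a multiword with boundary $[\Gamma]$: Id as $\mathrm{id}_{[A]}$; Ex by permuting the vertex blocks of $[A]$ and $[B]$; $\wp$ does nothing; $\otimes$ as the union of the two multiwords with vertex blocks arranged as $[\Delta]\otimes[A]\otimes[B]\otimes[\Gamma]$ and singular parts added; Cut by gluing vertex $i$ of the $[A]$ block of the first premise to vertex $|[A]|+1-i$ of the $[A]^\perp$ block of the second, concatenating labels along paths and collecting closed cycles as cyclic words, as in composition. Linear logic grammars. A cowordism typing judgement $\sigma/\vdash\Gamma$ is an LL sequent $\Gamma$ with a multiword $\sigma$ over $T$ with boundary $[\Gamma]$. A linear logic grammar (LLG) is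 $G=(N,T,Lex,S)$: $N$ a finite set of positive literals each assigned a boundary, $T$ a finite alphabet, $Lex$ a finite set of cowordism typing judgements (lexicon), $S\in N$ with $[S]$ having exactly one left and one right endpoint. A judgement $\sigma/\vdash\Gamma$ is derivable in $G$ if some LL derivation of $\vdash\Gamma$ using lexicon sequents as additional initial sequents (each interpreted by its cowordism) has interpretation $\sigma$. $L(G)$ is the set of words $w$ labelling the unique edge of some regular $\sigma$ with $\sigma/\vdash S$ derivable. -}

module Defs where

open import Data.Nat using (ℕ; zero; suc; _+_; _∸_; _<_; _≤ᵇ_; _≡ᵇ_)
open import Data.Bool using (Bool; true; false; not; if_then_else_; _∧_; _∨_)
open import Data.Fin using (Fin; toℕ)
open import Data.List using (List; []; _∷_; _++_; length; map; reverse; concat; concatMap)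
open import Data.List.Membership.Propositional using (_∈_)
open import Data.List.Relation.Unary.All using (All)
open import Data.List.Relation.Unary.Linked using (Linked)
open import Data.List.Relation.Binary.Pointwise using (Pointwise)
open import Data.List.Relation.Binary.Permutation.Propositional using (_↭_)
open import Data.Vec using (Vec; toList; lookup)
import Data.Vec as Vec
open import Data.Maybe using (Maybe; just; nothing)
open import Data.Product using (Σ; _×_; _,_)
open import Data.Sum using (_⊎_)
open import Data.Unit using (⊤)
open import Data.Empty using (⊥)
open import Relation.Nullary using (¬_)
open import Relation.Binary.PropositionalEquality using (_≡_)

Word : ℕ → Set
Word t = List (Fin t)

-- symbols on the right-hand side of a production whose body is the list
-- of nonterminals B₁ … Bₙ : a terminal, or the variable x^j_i
data Sym (t : ℕ) {n : ℕ} (ar : Fin n → ℕ) (body : List (Fin n)) : Set where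
  term : Fin t → Sym t ar body
  var  : (j : Fin (length body)) → Fin (ar (Data.List.lookup body j)) → Sym t ar body

countVar : ∀ {t n} {ar : Fin n → ℕ} {body : List (Fin n)} →
           (j : Fin (length body)) → Fin (ar (Data.List.lookup body j)) →
           List (Sym t ar body) → ℕ
countVar j i [] = 0
countVar j i (term a ∷ s) = countVar j i s
countVar j i (var j′ i′ ∷ s) =
  (if (toℕ j ≡ᵇ toℕ j′) ∧ (toℕ i ≡ᵇ toℕ i′) then 1 else 0) + countVar j i s

-- a production  B₁(x¹…),…,Bₙ(xⁿ…) ⊢ A(s₁,…,s_k)
record Production (t n : ℕ) (ar : Fin n → ℕ) : Set where
  field
    head   : Fin n
    body   : List (Fin n)
    rhs    : Vec (List (Sym t ar body)) (ar head)
    linear : ∀ j i → countVar j i (concat (toList rhs)) ≡ 1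

record MCFG (t : ℕ) : Set where
  field
    n         : ℕ                      -- nonterminals N = Fin n
    arity     : Fin n → ℕ
    arity-pos : ∀ A → 0 < arity A
    S         : Fin n
    S-unary   : arity S ≡ 1
    prods     : List (Production t n arity)

module _ {t : ℕ} (G : MCFG t) where
  open MCFG G
  open Production

  substSym : (p : Production t n arity) →
             ((j : Fin (length (body p))) → Vec (Word t) (arity (Data.List.lookup (body p) j))) →
             List (Sym t arity (body p)) → Word t
  substSym p args [] = []
  substSym p args (term a ∷ s) = a ∷ substSym p args s
  substSym p args (var j i ∷ s) = lookup (args j) i ++ substSym p args s

  data MDerivable : (A : Fin n) → Vec (Word t) (arity A) → Set where
    rule : (p : Production t n arity) → p ∈ prods →
           (args : (j : Fin (length (body p))) → Vec (Word t) (arity (Data.List.lookup (body p) j))) →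
           ((j : Fin (length (body p))) → MDerivable (Data.List.lookup (body p) j) (args j)) →
           MDerivable (head p) (Vec.map (substSym p args) (rhs p))

  MCFG-L : Word t → Set
  MCFG-L w = Σ (Vec (Word t) (arity S)) λ v → MDerivable S v × toList v ≡ w ∷ []

-- Boundaries: a list of Booleans, position i (1-based) is a left
-- endpoint iff the i-th entry is true.

Boundary : Set
Boundary = List Bool

-- X ⊗ Y is X ++ Y, 𝟏 is [].  X^⊥ :
_ᵇ⊥ : Boundary → Boundary
X ᵇ⊥ = map not (reverse X)

-- entry at (1-based) position i
at : Boundary → ℕ → Maybe Bool
at [] _ = nothing
at (b ∷ X) zero = nothing
at (b ∷ X) (suc zero) = just b
at (b ∷ X) (suc (suc i)) = at X (suc i)

-- Multiwords (vertices numbered 1,…,|X| as in the paper)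

record Edge (t : ℕ) : Set where
  constructor edge
  field
    src : ℕ
    lbl : Word t
    tgt : ℕ
open Edge public

record MW (t : ℕ) : Set where
  constructor mw
  field
    reg : List (Edge t)
    cyc : List (Word t)      -- multiset of cyclic words (representatives)
open MW public

endpoints : ∀ {t} → List (Edge t) → List ℕ
endpoints [] = []
endpoints (e ∷ es) = src e ∷ tgt e ∷ endpoints es

vertices : ℕ → List ℕ
vertices zero = []
vertices (suc k) = vertices k ++ suc k ∷ []

-- σ is a multiword with boundary X: its regular part is a perfect
-- matching of {1,…,|X|} by edges from left to right endpoints
IsMultiword : ∀ {t} → Boundary → MW t → Set
IsMultiword X σ =
  (endpoints (reg σ) ↭ vertices (length X)) ×
  All (λ e → at X (src e) ≡ just true × at X (tgt e) ≡ just false) (reg σ)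

idEdges : ∀ {t} → ℕ → ℕ → Boundary → List (Edge t)
idEdges k i [] = []
idEdges k i (true ∷ X)  = edge i [] (2 * k + 1 ∸ i) ∷ idEdges k (suc i) X
  where open Data.Nat using (_*_)
idEdges k i (false ∷ X) = edge (2 * k + 1 ∸ i) [] i ∷ idEdges k (suc i) X
  where open Data.Nat using (_*_)

idMW : ∀ {t} → Boundary → MW t
idMW X = mw (idEdges (length X) 1 X) []

renum : ∀ {t} → (ℕ → ℕ) → List (Edge t) → List (Edge t)
renum f = map (λ e → edge (f (src e)) (lbl e) (f (tgt e)))

-- Gluing (used for Cut).  A combined multiword whose vertices are
-- either external (with their new number) or internal (identified
-- with a partner vertex).

data Role : Set where
  ext : ℕ → Role
  int : ℕ → Role

module Glueing {t : ℕ} (role : ℕ → Role) (E : List (Edge t)) where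

  -- maximal path from vertex u to the (new) external vertex v, with word w
  data Path : ℕ → Word t → ℕ → Set where
    stop : ∀ {u w x v} → edge u w x ∈ E → role x ≡ ext v → Path u w v
    step : ∀ {u w x y w′ v} → edge u w x ∈ E → role x ≡ int y →
           Path y w′ v → Path u (w ++ w′) v

  Next : Edge t → Edge t → Set
  Next e e′ = role (tgt e) ≡ int (src e′)

  data Reach : Edge t → Edge t → Set where
    one  : ∀ {e e′} → Next e e′ → e′ ∈ E → Reach e e′
    more : ∀ {e e′ e″} → Next e e″ → e″ ∈ E → Reach e″ e′ → Reach e e′

  lastE : Edge t → List (Edge t) → Edge t
  lastE e [] = e
  lastE e (x ∷ xs) = lastE x xs

  ClosedCycle : List (Edge t) → Set
  ClosedCycle [] = ⊥
  ClosedCycle (e ∷ es) = Linked Next (e ∷ es) × Next (lastE e es) e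

  isExt : Role → Bool
  isExt (ext _) = true
  isExt (int _) = false

  extSrcs : List (Edge t) → List ℕ
  extSrcs [] = []
  extSrcs (e ∷ es) = if isExt (role (src e)) then src e ∷ extSrcs es else extSrcs es

  record Glue (C : List (Word t)) (ρ : MW t) : Set where
    field
      regular : Pointwise (λ u e → role u ≡ ext (src e) × Path u (lbl e) (tgt e))
                          (extSrcs E) (reg ρ)
      cycles  : List (List (Edge t))
      closed  : All ClosedCycle cycles
      E₁ E₂   : List (Edge t)
      split   : E ↭ E₁ ++ E₂
      cycE    : concat cycles ↭ E₁
      nocyc   : All (λ e → ¬ Reach e e) E₂
      cycword : cyc ρ ≡ C ++ map (concatMap lbl) cycles

data Formula (n : ℕ) : Set where
  pos  : Fin n → Formula n
  neg  : Fin n → Formula n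
  _⊗_  : Formula n → Formula n → Formula n
  _⅋_  : Formula n → Formula n → Formula n

_^⊥ : ∀ {n} → Formula n → Formula n
pos P ^⊥ = neg P
neg P ^⊥ = pos P
(A ⊗ B) ^⊥ = (A ^⊥) ⅋ (B ^⊥)
(A ⅋ B) ^⊥ = (A ^⊥) ⊗ (B ^⊥)

⊗-free : ∀ {n} → Formula n → Set
⊗-free (pos _) = ⊤
⊗-free (neg _) = ⊤
⊗-free (A ⊗ B) = ⊥
⊗-free (A ⅋ B) = ⊗-free A × ⊗-free B

module Interp {n : ℕ} (bnd : Fin n → Boundary) where
  ⟦_⟧ : Formula n → Boundary
  ⟦ pos P ⟧ = bnd P
  ⟦ neg P ⟧ = bnd P ᵇ⊥
  ⟦ A ⊗ B ⟧ = ⟦ A ⟧ ++ ⟦ B ⟧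
  ⟦ A ⅋ B ⟧ = ⟦ B ⟧ ++ ⟦ A ⟧

  ⟦_⟧ˢ : List (Formula n) → Boundary
  ⟦ [] ⟧ˢ = []
  ⟦ A ∷ Γ ⟧ˢ = ⟦ Γ ⟧ˢ ++ ⟦ A ⟧

  sz : Formula n → ℕ
  sz A = length ⟦ A ⟧

  szs : List (Formula n) → ℕ
  szs Γ = length ⟦ Γ ⟧ˢ

  record Judgement (t : ℕ) : Set where
    field
      seq  : List (Formula n)
      word : MW t
      isMW : IsMultiword ⟦ seq ⟧ˢ word

record LLG (t : ℕ) : Set where
  field
    n   : ℕ                           -- literals N = Fin n
    bnd : Fin n → Boundary
    Lex : List (Interp.Judgement bnd t)
    S   : Fin n
    S-ok : bnd S ≡ true ∷ false ∷ [] ⊎ bnd S ≡ false ∷ true ∷ []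

⊗-freeLex : ∀ {t} → LLG t → Set
⊗-freeLex G = All (λ j → All ⊗-free (Interp.Judgement.seq j)) (LLG.Lex G)

module _ {t : ℕ} (G : LLG t) where
  open LLG G
  open Interp bnd

  -- Ex: blocks [Δ]⊗[B]⊗[A]⊗[Γ] ↦ [Δ]⊗[A]⊗[B]⊗[Γ]
  exRenum : ℕ → ℕ → ℕ → ℕ → ℕ
  exRenum d b a v =
    if v ≤ᵇ d then v else
    if v ≤ᵇ d + b then v + a else
    if v ≤ᵇ d + b + a then v ∸ b else v

  -- ⊗: σ with [A]⊗[Γ], τ with [Δ]⊗[B], result [Δ]⊗[A]⊗[B]⊗[Γ]
  tensMW : ℕ → ℕ → ℕ → MW t → MW t → MW t
  tensMW d a b σ τ =
    mw (renum (λ v → if v ≤ᵇ a then d + v else d + b + v) (reg σ)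
        ++ renum (λ v → if v ≤ᵇ d then v else a + v) (reg τ))
       (cyc σ ++ cyc τ)

  -- Cut: σ with [A]⊗[Γ] (sizes a, g) keeps its numbers, τ with
  -- [Δ]⊗[A]^⊥ (sizes d, a) is shifted by m = a + g.  Vertex i of the
  -- [A] block of σ is identified with vertex d+a+1-i of τ.
  cutRole : ℕ → ℕ → ℕ → ℕ → Role
  cutRole a g d v =
    if (v ≤ᵇ a) ∨ (a + g + d + 1 ≤ᵇ v) then int (a + g + d + a + 1 ∸ v) else
    if v ≤ᵇ a + g then ext (v ∸ a + d) else ext (v ∸ (a + g))

  cutE : ℕ → ℕ → MW t → MW t → List (Edge t)
  cutE a g σ τ = reg σ ++ renum (λ v → a + g + v) (reg τ)

  data _⊩_ : MW t → List (Formula n) → Set where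
    idR  : ∀ A → idMW ⟦ A ⟧ ⊩ (A ^⊥ ∷ A ∷ [])
    lexR : ∀ {j} → j ∈ Lex → Judgement.word j ⊩ Judgement.seq j
    exR  : ∀ Γ A B Δ {σ} → σ ⊩ (Γ ++ A ∷ B ∷ Δ) →
           mw (renum (exRenum (szs Δ) (sz B) (sz A)) (reg σ)) (cyc σ) ⊩ (Γ ++ B ∷ A ∷ Δ)
    parR : ∀ Γ A B {σ} → σ ⊩ (Γ ++ A ∷ B ∷ []) → σ ⊩ (Γ ++ (A ⅋ B) ∷ [])
    tenR : ∀ Γ A B Δ {σ τ} → σ ⊩ (Γ ++ A ∷ []) → τ ⊩ (B ∷ Δ) →
           tensMW (szs Δ) (sz A) (sz B) σ τ ⊩ (Γ ++ (A ⊗ B) ∷ Δ)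
    cutR : ∀ Γ A Δ {σ τ ρ} → σ ⊩ (Γ ++ A ∷ []) → τ ⊩ ((A ^⊥) ∷ Δ) →
           Glueing.Glue (cutRole (sz A) (szs Γ) (szs Δ)) (cutE (sz A) (szs Γ) σ τ)
                        (cyc σ ++ cyc τ) ρ →
           ρ ⊩ (Γ ++ Δ)

  LLG-L : Word t → Set
  LLG-L w = Σ (MW t) λ σ → (σ ⊩ (pos S ∷ [])) × cyc σ ≡ [] ×
            Σ ℕ λ i → Σ ℕ λ j → reg σ ≡ edge i w j ∷ []

{-# OPTIONS --safe #-}

-- Both directions work with "soups": multisets of labelled edges on named vertices, in which glueing is union
-- followed by the elimination of the internal vertices one at a time.  Elimination is confluent, and it computes the
-- cycle-free glueings; hence a derivation of linear logic can be read as an iterated elimination.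
--
-- An LLG with a ⊗-free lexicon only derives what an MCFG derives, by a double glueing argument: a formula A is
-- interpreted by a set of values and a set of covalues (the values of A^⊥), pairs of values for A ⊗ B, and soups sending
-- covalues of A to values of B and covalues of B to values of A for A ⅋ B.  All rules are sound for any choice of
-- values at literals.  For a ⊗-free lexicon soundness reduces to a closure condition on sequents of literals, which
-- is closure of the values under the productions of an MCFG.
--
-- From an MCFG, every production B₁, …, Bₙ ⊢ A becomes a lexicon entry ⊢ A, B₁^⊥, …, Bₙ^⊥.  From an LLG, the
-- nonterminals are pairs of a literal and a matching of its boundary, and the productions are the acyclic ways of
-- glueing such matchings to all literals but one of a lexicon entry.
module Submission where

open import Defs
import Algebra.Solver.CommutativeMonoid
open import Data.Nat using (ℕ; zero; suc; _+_; _*_; _∸_; _≤_; _<_; _≤ᵇ_; _≡ᵇ_; _≟_; z≤n; s≤s)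
import Data.Nat.Properties as ℕ
open import Data.Bool using (Bool; true; false; not; if_then_else_; _∧_)
import Data.Bool.Properties as Bool
open import Data.Fin using (Fin; toℕ; zero; suc)
open import Data.Fin.Properties using (toℕ-injective)
open import Data.List using (List; []; _∷_; _++_; map; concatMap; concat; length; [_]; iterate; reverse; lookup; upTo; allFin; cartesianProduct)
import Data.List.Properties as List
open import Data.List.Membership.Propositional using (_∈_; _∉_; lose)
open import Data.List.Membership.Propositional.Properties using (∈-∃++; ∈-++⁺ˡ; ∈-++⁺ʳ; ∈-++⁻; ∈-map⁺; ∈-map⁻; ∈-concatMap⁺; ∈-upTo⁺; ∈-allFin; ∈-lookup; ∈-cartesianProduct⁺)
open import Data.List.Relation.Unary.All as All using (All; []; _∷_)
import Data.List.Relation.Unary.All.Properties as All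
import Data.List.Relation.Unary.Any as Any
import Data.List.Relation.Unary.Any.Properties as Any
open import Data.List.Relation.Unary.Any using (here; there)
open import Data.List.Relation.Unary.AllPairs using ([]; _∷_)
open import Data.List.Relation.Unary.Unique.Propositional using (Unique)
import Data.List.Relation.Unary.Unique.Propositional.Properties as Uniq
open import Data.List.Relation.Binary.Pointwise using (Pointwise; []; _∷_)
open import Data.List.Relation.Binary.Permutation.Propositional hiding (trans)
open import Data.List.Relation.Binary.Permutation.Propositional.Properties
import Data.List.Relation.Binary.Permutation.Setoid.Properties as PermS
open import Data.Maybe using (just)
open import Data.Vec using (Vec; []; _∷_; toList)
import Data.Vec as Vec
import Data.Vec.Properties as Vec
open import Data.Product using (Σ; ∃; ∃₂; _×_; _,_; proj₁; proj₂)
open import Data.Sum using (_⊎_; inj₁; inj₂)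
open import Data.Empty using (⊥; ⊥-elim)
open import Function using (_∘_; module Equivalence)
open import Function.Bundles using (_⇔_; mk⇔)
open import Relation.Nullary using (¬_; Dec; yes; no; _×-dec_)
open import Relation.Nullary.Decidable using (map′)
open import Relation.Binary.PropositionalEquality using (_≡_; _≢_; refl; sym; trans; cong; cong₂; subst; subst₂; setoid; module ≡-Reasoning)

-- Three obstacles shape the proof. Cyclic words: they are never discarded by a rule, so a
-- derivation of a regular multiword has regular multiwords at every node. It is then enough that
-- `Elim` has no way to close a loop; cycles need not be tracked. Vertex numbers: every rule
-- renumbers. With names, Ex becomes a permutation of formulas, the tensor rule a union of soups,
-- and Cut an identification of equal names, once the block of the cut formula has received fresh
-- ones. Compound formulas: lexicon and goal contain no tensor, but a derivation may pass through
-- any formula by axioms and cuts, so no induction over sequents of literals is available; the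
-- induction over formulas inside the values replaces cut elimination. The ⊗-free lexicon enters
-- because ⅋ is reversible: such a lexicon sequent is as good as the sequent of its literals.
-- Finiteness of the resulting MCFG rests on one observation: whether an elimination succeeds
-- depends on vertices only, never on labels. It can therefore be run with variables as labels, and
-- its result is the right-hand side of a production.

module _ {A : Set} where
  open Algebra.Solver.CommutativeMonoid (++-commutativeMonoid {A = A}) public using (solve; _⊕_; _⊜_)

  Unique-resp-↭ : {xs ys : List A} → xs ↭ ys → Unique xs → Unique ys
  Unique-resp-↭ p = PermS.Unique-resp-↭ (setoid A) (↭⇒↭ₛ p)

  ∈⇒↭ : {x : A} {xs : List A} → x ∈ xs → ∃ λ ys → xs ↭ x ∷ ys
  ∈⇒↭ x∈xs with as , bs , refl ← ∈-∃++ x∈xs = as ++ bs , shift _ as bs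

  ∷-↭-inv : {x y : A} {xs ys : List A} → x ∷ xs ↭ y ∷ ys →
            (x ≡ y × xs ↭ ys) ⊎ (∃ λ zs → xs ↭ y ∷ zs × ys ↭ x ∷ zs)
  ∷-↭-inv {x} {y} p with ∈-resp-↭ p (here refl)
  ... | here refl = inj₁ (refl , drop-∷ p)
  ... | there x∈ys with zs , q ← ∈⇒↭ x∈ys =
    inj₂ (zs , drop-∷ (↭-trans p (↭-trans (prep y q) (swap y x refl))) , q)

  ++-↭-inv : ∀ xs {ys : List A} {z zs} → xs ++ ys ↭ z ∷ zs →
             (∃ λ xs′ → xs ↭ z ∷ xs′ × zs ↭ xs′ ++ ys) ⊎ (∃ λ ys′ → ys ↭ z ∷ ys′ × zs ↭ xs ++ ys′)
  ++-↭-inv xs {ys} {z} p with ∈-++⁻ xs (∈-resp-↭ (↭-sym p) (here refl))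
  ... | inj₁ z∈xs with xs′ , q ← ∈⇒↭ z∈xs =
    inj₁ (xs′ , q , drop-∷ (↭-trans (↭-sym p) (++⁺ʳ ys q)))
  ... | inj₂ z∈ys with ys′ , q ← ∈⇒↭ z∈ys =
    inj₂ (ys′ , q , drop-∷ (↭-trans (↭-sym p) (↭-trans (++⁺ˡ xs q) (shift z xs ys′))))

  drop-++ : ∀ xs {ys zs : List A} → xs ++ ys ↭ xs ++ zs → ys ↭ zs
  drop-++ []       p = p
  drop-++ (x ∷ xs) p = drop-++ xs (drop-∷ p)

  Unique⇒∉ : {x : A} {xs : List A} → Unique (x ∷ xs) → x ∉ xs
  Unique⇒∉ (p ∷ _) x∈ = All.lookup p x∈ refl

  Unique-++ʳ : ∀ xs {ys : List A} → Unique (xs ++ ys) → Unique ys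
  Unique-++ʳ []       u       = u
  Unique-++ʳ (x ∷ xs) (_ ∷ u) = Unique-++ʳ xs u

  Unique-++ˡ : ∀ xs {ys : List A} → Unique (xs ++ ys) → Unique xs
  Unique-++ˡ xs {ys} u = Unique-++ʳ ys (Unique-resp-↭ (++-comm xs ys) u)

  Unique-disjoint : ∀ xs {ys : List A} {x} → Unique (xs ++ ys) → x ∈ xs → x ∉ ys
  Unique-disjoint (x ∷ xs) u (here refl) x∈ys = Unique⇒∉ u (∈-++⁺ʳ xs x∈ys)
  Unique-disjoint (x ∷ xs) (_ ∷ u) (there p) x∈ys = Unique-disjoint xs u p x∈ys

  unique-set⇒↭ : {xs ys : List A} → Unique xs → Unique ys →
                 (∀ {x} → x ∈ xs → x ∈ ys) → (∀ {x} → x ∈ ys → x ∈ xs) → xs ↭ ys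
  unique-set⇒↭ {[]} {[]} _ _ _ _ = ↭-refl
  unique-set⇒↭ {[]} {y ∷ ys} _ _ _ g with () ← g (here refl)
  unique-set⇒↭ {x ∷ xs} {ys} u@(_ ∷ uxs) uys f g with ys′ , q ← ∈⇒↭ (f (here refl)) =
    ↭-trans (prep x (unique-set⇒↭ uxs (Unique-++ʳ [ x ] u′) f′ g′)) (↭-sym q)
    where
    u′ = Unique-resp-↭ q uys
    f′ : ∀ {z} → z ∈ xs → z ∈ ys′
    f′ z∈xs with ∈-resp-↭ q (f (there z∈xs))
    ... | here refl = ⊥-elim (Unique⇒∉ u z∈xs)
    ... | there z∈  = z∈
    g′ : ∀ {z} → z ∈ ys′ → z ∈ xs
    g′ z∈ with g (∈-resp-↭ (↭-sym q) (there z∈))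
    ... | here refl = ⊥-elim (Unique⇒∉ u′ z∈)
    ... | there z∈xs = z∈xs

module _ {A B : Set} where
  concatMap-↭ : (f : A → List B) {xs ys : List A} → xs ↭ ys → concatMap f xs ↭ concatMap f ys
  concatMap-↭ f refl         = refl
  concatMap-↭ f (prep x p)   = ++⁺ˡ (f x) (concatMap-↭ f p)
  concatMap-↭ f (swap x y p) = ↭-trans (shifts (f x) (f y)) (++⁺ˡ (f y) (++⁺ˡ (f x) (concatMap-↭ f p)))
  concatMap-↭ f (_↭_.trans p q) = ↭-trans (concatMap-↭ f p) (concatMap-↭ f q)

  Unique-map⇒injective : {f : A → B} {xs : List A} → Unique (map f xs) →
                         ∀ {x y} → x ∈ xs → y ∈ xs → f x ≡ f y → x ≡ y
  Unique-map⇒injective u (here refl) (here refl) eq = refl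
  Unique-map⇒injective {f} {_ ∷ xs} u (here refl) (there q) eq =
    ⊥-elim (Unique⇒∉ u (subst (_∈ map f xs) (sym eq) (∈-map⁺ f q)))
  Unique-map⇒injective {f} {_ ∷ xs} u (there p) (here refl) eq =
    ⊥-elim (Unique⇒∉ u (subst (_∈ map f xs) eq (∈-map⁺ f p)))
  Unique-map⇒injective (_ ∷ u) (there p) (there q) eq = Unique-map⇒injective u p q eq

  Unique-map⁻ : {f : A → B} (xs : List A) → Unique (map f xs) → Unique xs
  Unique-map⁻ [] u = []
  Unique-map⁻ {f = f} (x ∷ xs) u@(_ ∷ u′) =
    All.tabulate (λ { y∈ refl → Unique⇒∉ u (∈-map⁺ f y∈) }) ∷ Unique-map⁻ xs u′

-- Soups and elimination of vertices

-- The alphabet is a parameter because eliminations are later run over the symbols of a production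
-- instead of terminals.
data Ed (C : Set) : Set where
  ed : ℕ → List C → ℕ → Ed C

Soup : Set → Set
Soup C = List (Ed C)

esrc etgt : {C : Set} → Ed C → ℕ
esrc (ed u _ _) = u
etgt (ed _ _ v) = v

elbl : {C : Set} → Ed C → List C
elbl (ed _ w _) = w

srcs tgts : {C : Set} → Soup C → List ℕ
srcs = map esrc
tgts = map etgt

ends : {C : Set} → Soup C → List ℕ
ends E = srcs E ++ tgts E

module _ where
  private variable
    C C′ : Set
    E E′ F G G′ H : Soup C
    xs ys : List ℕ

  -- The two merged edges are different entries of the list, so a loop at `x` alone can never be
  -- merged: a closed cycle makes the relation fail instead of producing a cyclic word.
  data Elim {C : Set} : Soup C → List ℕ → Soup C → Set where
    done  : E ↭ G → Elim E [] G
    merge : ∀ {u w x w′ v R} → E ↭ ed u w x ∷ ed x w′ v ∷ R →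
            Elim (ed u (w ++ w′) v ∷ R) xs G → Elim E (x ∷ xs) G

  Elim-respˡ : E′ ↭ E → Elim E xs G → Elim E′ xs G
  Elim-respˡ p (done q)    = done (↭-trans p q)
  Elim-respˡ p (merge q k) = merge (↭-trans p q) k

  Elim-respʳ : G ↭ G′ → Elim E xs G → Elim E xs G′
  Elim-respʳ p (done q)    = done (↭-trans q p)
  Elim-respʳ p (merge q k) = merge q (Elim-respʳ p k)

  Elim-++ : Elim E xs H → Elim (H ++ F) ys G → Elim (E ++ F) (xs ++ ys) G
  Elim-++ {F = F} (done p)    l = Elim-respˡ (++⁺ʳ F p) l
  Elim-++ {F = F} (merge p k) l = merge (++⁺ʳ F p) (Elim-++ k l)

  Elim-frame : ∀ F → Elim E xs H → Elim (E ++ F) xs (H ++ F)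
  Elim-frame {xs = xs} F k = subst (λ zs → Elim _ zs _) (List.++-identityʳ xs) (Elim-++ k (done refl))

  Elim-par : Elim E xs G → Elim E′ ys G′ → Elim (E ++ E′) (xs ++ ys) (G ++ G′)
  Elim-par {G = G} {E′ = E′} {G′ = G′} k l =
    Elim-++ k (Elim-respˡ (++-comm G E′) (Elim-respʳ (++-comm G′ G) (Elim-frame G l)))

  Elim-swap : ∀ {x y} → Elim E (x ∷ y ∷ xs) G → Elim E (y ∷ x ∷ xs) G
  Elim-swap {E = E} {xs} {G} {x} {y} (merge {u = u} {w} {.x} {w′} {v} {R} p
      (merge {u = s} {z} {.y} {z′} {q} {R₂} r k)) with ∷-↭-inv r
  -- The edge made by the first merge is the left edge of the second, its right edge, or neither. In
  -- the first two cases three edges in a row are contracted, and the orders differ by associativity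
  -- of `++` on labels.
  ... | inj₁ (refl , R↭) = merge {u = x} {w′} {y} {z′} {q} {ed u w x ∷ R₂}
        (↭-trans p (↭-trans (prep _ (prep _ R↭)) (solve 4
            (λ a b c d → a ⊕ b ⊕ c ⊕ d ⊜ b ⊕ c ⊕ a ⊕ d) ↭-refl [ _ ] [ _ ] [ _ ] R₂)))
        (merge (swap _ _ refl) (subst (λ l → Elim (ed u l q ∷ R₂) xs G) (List.++-assoc w w′ z′) k))
  ... | inj₂ (zs , R↭ , r′) with ∷-↭-inv r′
  ...   | inj₁ (refl , R₂↭) = merge {u = s} {z} {y} {w} {x} {ed x w′ v ∷ zs}
        (↭-trans p (↭-trans (prep _ (prep _ R↭)) (solve 4
            (λ a b c d → a ⊕ b ⊕ c ⊕ d ⊜ c ⊕ a ⊕ b ⊕ d) ↭-refl [ _ ] [ _ ] [ _ ] zs)))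
        (merge refl (subst (λ l → Elim (ed s l v ∷ zs) xs G) (sym (List.++-assoc z w w′)) (Elim-respˡ (prep _
            (↭-sym R₂↭)) k)))
  ...   | inj₂ (zs′ , R₂↭ , zs↭) = merge {u = s} {z} {y} {z′} {q} {ed u w x ∷ ed x w′ v ∷ zs′}
        (↭-trans p (↭-trans (prep _ (prep _ (↭-trans R↭ (prep _ zs↭))))
          (solve 5 (λ a b c d e → a ⊕ b ⊕ c ⊕ d ⊕ e ⊜ c ⊕ d ⊕ a ⊕ b ⊕ e) ↭-refl [ _ ] [ _ ] [ _ ] [ _ ] zs′)))
        (merge (solve 4 (λ a b c d → a ⊕ b ⊕ c ⊕ d ⊜ b ⊕ c ⊕ a ⊕ d) ↭-refl [ _ ] [ _ ] [ _ ] zs′)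
          (Elim-respˡ (↭-trans (swap _ _ refl) (prep _ (↭-sym R₂↭))) k))

  Elim-perm : xs ↭ ys → Elim E xs G → Elim E ys G
  Elim-perm refl         k           = k
  Elim-perm (prep x p)   (merge q k) = merge q (Elim-perm p k)
  Elim-perm (swap x y p) k with Elim-swap k
  ... | merge q (merge r l) = merge q (merge r (Elim-perm p l))
  Elim-perm (_↭_.trans p q)  k           = Elim-perm q (Elim-perm p k)

  -- Since no vertex of `xs` occurs in `F`, both edges merged at such a vertex come from `E`. This
  -- converse of `Elim-++` allows a part of a large glueing to be evaluated first.
  Elim-split : ∀ E xs {F : Soup C} {ys G} → All (_∉ ends F) xs → Elim (E ++ F) (xs ++ ys) G →
               ∃ λ H → Elim E xs H × Elim (H ++ F) ys G
  Elim-split E [] _ k = E , done refl , k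
  Elim-split E (x ∷ xs) {F} (x∉ ∷ xs∉) (merge {R = R} p k) with ++-↭-inv E p
  ... | inj₂ (F′ , q , _) = ⊥-elim (x∉ (∈-++⁺ʳ (srcs F) (∈-resp-↭ (↭-sym (map⁺ etgt q)) (here refl))))
  ... | inj₁ (E′ , q , r) with ++-↭-inv E′ (↭-sym r)
  ...   | inj₂ (F′ , s , _) = ⊥-elim (x∉ (∈-++⁺ˡ (∈-resp-↭ (↭-sym (map⁺ esrc s)) (here refl))))
  ...   | inj₁ (E″ , s , t) with Elim-split (_ ∷ E″) xs xs∉ (Elim-respˡ (prep _ (↭-sym t)) k)
  ...     | H , l , l′ = H , merge (↭-trans q (prep _ s)) l , l′

  Elim-srcs : Elim E xs G → srcs E ↭ xs ++ srcs G
  Elim-srcs (done p)    = map⁺ esrc p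
  Elim-srcs {xs = x ∷ xs} {G} (merge {u = u} p k) =
    ↭-trans (map⁺ esrc p) (↭-trans (swap _ _ refl) (prep x (Elim-srcs k)))

  Elim-tgts : Elim E xs G → tgts E ↭ xs ++ tgts G
  Elim-tgts (done p)    = map⁺ etgt p
  Elim-tgts (merge p k) = ↭-trans (map⁺ etgt p) (prep _ (Elim-tgts k))

  ends-↭ : E ↭ F → ends E ↭ ends F
  ends-↭ p = ++⁺ (map⁺ esrc p) (map⁺ etgt p)

  ends-++ : ∀ (E F : Soup C) → ends (E ++ F) ↭ ends E ++ ends F
  ends-++ E F rewrite List.map-++ esrc E F | List.map-++ etgt E F =
    solve 4 (λ a b c d → (a ⊕ b) ⊕ (c ⊕ d) ⊜ (a ⊕ c) ⊕ (b ⊕ d)) ↭-refl (srcs E) (srcs F) (tgts E) (tgts F)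

  Elim-ends : Elim E xs G → ends E ↭ xs ++ xs ++ ends G
  Elim-ends {xs = xs} {G} k = ↭-trans (++⁺ (Elim-srcs k) (Elim-tgts k))
    (solve 3 (λ a b c → (a ⊕ b) ⊕ (a ⊕ c) ⊜ a ⊕ a ⊕ b ⊕ c) ↭-refl xs (srcs G) (tgts G))

  mapV : (ℕ → ℕ) → Soup C → Soup C
  mapV f = map λ { (ed u w v) → ed (f u) w (f v) }

  Elim-mapV : ∀ f → Elim E xs G → Elim (mapV f E) (map f xs) (mapV f G)
  Elim-mapV f (done p)    = done (map⁺ _ p)
  Elim-mapV f (merge p k) = merge (map⁺ _ p) (Elim-mapV f k)

  mapLᵉ : (C → List C′) → Ed C → Ed C′
  mapLᵉ φ (ed u w v) = ed u (concatMap φ w) v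

  mapL : (C → List C′) → Soup C → Soup C′
  mapL φ = map (mapLᵉ φ)

  Elim-mapL : ∀ (φ : C → List C′) → Elim E xs G → Elim (mapL φ E) xs (mapL φ G)
  Elim-mapL φ (done p) = done (map⁺ _ p)
  Elim-mapL φ (merge {u = u} {w} {_} {w′} {v} {R} p k) = merge (map⁺ _ p)
    (subst (λ l → Elim (ed u l v ∷ mapL φ R) _ _) (List.concatMap-++ φ w w′) (Elim-mapL φ k))

  -- Merging inspects vertices only, so an elimination with words substituted for variables already
  -- happens before the substitution. This is what turns a glueing of words into an instance of a
  -- production.
  Elim-mapL⁻ : ∀ (φ : C → List C′) → Elim (mapL φ E) xs G → ∃ λ G₀ → Elim E xs G₀ × mapL φ G₀ ↭ G
  Elim-mapL⁻ {E = E} φ (done p) = E , done refl , p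
  Elim-mapL⁻ φ (merge {w = _} p k) with ↭-map-inv (mapLᵉ φ) p
  ... | ed u w x ∷ ed .x w′ v ∷ R , refl , q
    with G₀ , l , r ← Elim-mapL⁻ {E = ed u (w ++ w′) v ∷ R} φ
           (subst (λ l → Elim (ed u l v ∷ mapL φ R) _ _) (sym (List.concatMap-++ φ w w′)) k)
    = G₀ , merge q l , r

  -- Merging concatenates labels and loses none; the linearity of the extracted productions comes
  -- from here.
  Elim-labels : Elim E xs G → concatMap elbl E ↭ concatMap elbl G
  Elim-labels (done p) = concatMap-↭ elbl p
  Elim-labels (merge {w = w} {w′ = w′} p k) = ↭-trans (Elim-labels (done p))
    (↭-trans (↭-reflexive (sym (List.++-assoc w w′ _))) (Elim-labels k))

  -- When every vertex has at most one incoming and one outgoing edge, the eliminated vertex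
  -- dictates which two edges are merged.
  Elim-deterministic : Unique (srcs E) → Unique (tgts E) → Elim E xs G → Elim E xs G′ → G ↭ G′
  Elim-deterministic us ut (done p) (done q) = ↭-trans (↭-sym p) q
  Elim-deterministic {E = E} us ut (merge {R = R} p k) (merge q l)
    with refl ← Unique-map⇒injective ut (∈-resp-↭ (↭-sym p) (here refl)) (∈-resp-↭ (↭-sym q) (here refl)) refl
       | refl ← Unique-map⇒injective us (∈-resp-↭ (↭-sym p) (there (here refl))) (∈-resp-↭ (↭-sym q) (there
           (here refl))) refl =
    Elim-deterministic
      (Unique-++ʳ [ _ ] (Unique-resp-↭ (↭-trans (map⁺ esrc p) (swap _ _ refl)) us))
      (Unique-++ʳ [ _ ] (Unique-resp-↭ (map⁺ etgt p) ut))
      k (Elim-respˡ (prep _ (drop-∷ (drop-∷ (↭-trans (↭-sym p) q)))) l)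

-- Walks, acyclicity and the existence of eliminations.

module _ where
  private variable
    C : Set
    E F G : Soup C
    u v x : ℕ
    w w′ : List C
    xs : List ℕ

  data Walk {C : Set} (E : Soup C) : ℕ → List C → ℕ → Set where
    one  : ∀ {u w v} → ed u w v ∈ E → Walk E u w v
    more : ∀ {u w x w′ v} → ed u w x ∈ E → Walk E x w′ v → Walk E u (w ++ w′) v

  Acyclic : Soup C → Set
  Acyclic E = ∀ {a w} → ¬ Walk E a w a

  Walk-++ : Walk E u w x → Walk E x w′ v → Walk E u (w ++ w′) v
  Walk-++ (one e) q = more e q
  Walk-++ {E = E} {u = u} {w′ = w″} {v = v} (more {w = w} {w′ = w′} e p) q =
    subst (λ l → Walk E u l v) (sym (List.++-assoc w w′ w″)) (more e (Walk-++ p q))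

  Walk-src : Walk E u w v → u ∈ srcs E
  Walk-src (one e)    = ∈-map⁺ esrc e
  Walk-src (more e _) = ∈-map⁺ esrc e

  Walk-tgt : Walk E u w v → v ∈ tgts E
  Walk-tgt (one e)    = ∈-map⁺ etgt e
  Walk-tgt (more _ p) = Walk-tgt p

  Walk-bind : (∀ {u w v} → ed u w v ∈ F → Walk E u w v) → Walk F u w v → Walk E u w v
  Walk-bind f (one e)    = f e
  Walk-bind f (more e p) = Walk-++ (f e) (Walk-bind f p)

  Walk-expand : Elim E xs G → Walk G u w v → Walk E u w v
  Walk-expand (done p) = Walk-bind (λ e → one (∈-resp-↭ (↭-sym p) e))
  Walk-expand {E = E} (merge {u = a} {w} {x} {w′} {b} {R} p k) q = Walk-bind f (Walk-expand k q)
    where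
    f : ∀ {u l v} → ed u l v ∈ ed a (w ++ w′) b ∷ R → Walk E u l v
    f (here refl) = more (∈-resp-↭ (↭-sym p) (here refl)) (one (∈-resp-↭ (↭-sym p) (there (here refl))))
    f (there e)   = one (∈-resp-↭ (↭-sym p) (there (there e)))

  -- Each vertex of `xs` has an incoming and an outgoing edge; they can be merged unless they are
  -- the same edge, a loop. Acyclicity survives a merge because a walk afterwards expands to a walk
  -- before.
  Elim-exists : ∀ (E : Soup C) xs {S T} → Acyclic E → srcs E ↭ xs ++ S → tgts E ↭ xs ++ T → ∃ (Elim E xs)
  Elim-exists E [] ac ps pt = E , done refl
  Elim-exists E (x ∷ xs) ac ps pt
    with ed u w _ , e₁∈ , refl ← ∈-map⁻ etgt (∈-resp-↭ (↭-sym pt) (here refl))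
       | ed _ w′ v , e₂∈ , refl ← ∈-map⁻ esrc (∈-resp-↭ (↭-sym ps) (here refl))
    with E₁ , p ← ∈⇒↭ e₁∈
    with ∈-resp-↭ p e₂∈
  ... | here refl = ⊥-elim (ac (one e₁∈))
  ... | there e₂∈E₁ with R , q ← ∈⇒↭ e₂∈E₁ =
    let r = ↭-trans p (prep _ q)
        step = merge r (done refl)
        G , k = Elim-exists (ed u (w ++ w′) v ∷ R) xs (λ c → ac (Walk-expand step c))
                  (drop-∷ (↭-trans (↭-sym (Elim-srcs step)) ps)) (drop-∷ (↭-trans (↭-sym (Elim-tgts step)) pt))
    in G , merge r k

  -- A cycle of `E` survives the merge at `x`: if it passes through `x` it uses both merged edges,
  -- these being the only ones at `x`, and can be contracted there.
  Elim-acyclic : Unique (srcs E) → Unique (tgts E) → Elim E xs G → Acyclic G → Acyclic E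
  Elim-acyclic us ut (done p) ac q = ac (Walk-bind (λ e → one (∈-resp-↭ p e)) q)
  Elim-acyclic {E = E} us ut (merge {u = u} {w} {x} {w′} {v} {R} p k) ac = acE
    where
    us′ = Unique-resp-↭ (↭-trans (map⁺ esrc p) (swap _ _ refl)) us
    ut′ = Unique-resp-↭ (map⁺ etgt p) ut
    M = ed u (w ++ w′) v ∷ R
    acM : Acyclic M
    acM = Elim-acyclic (Unique-++ʳ [ _ ] us′) (Unique-++ʳ [ _ ] ut′) k ac
    u≢x : u ≢ x
    u≢x eq = Unique⇒∉ us′ (here (sym eq))
    v≢x : v ≢ x
    v≢x eq = Unique⇒∉ ut′ (here (sym eq))
    from-x : ∀ {l c} → ed x l c ∈ E → ed x l c ≡ ed x w′ v
    from-x e with ∈-resp-↭ p e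
    ... | here refl = ⊥-elim (u≢x refl)
    ... | there (here eq) = eq
    ... | there (there e′) = ⊥-elim (Unique⇒∉ us′ (there (∈-map⁺ esrc e′)))
    to-x : ∀ {l c} → ed c l x ∈ E → ed c l x ≡ ed u w x
    to-x e with ∈-resp-↭ p e
    ... | here eq = eq
    ... | there (here refl) = ⊥-elim (v≢x refl)
    ... | there (there e′) = ⊥-elim (Unique⇒∉ ut′ (there (∈-map⁺ etgt e′)))
    stay : ∀ {c l d} → c ≢ x → d ≢ x → ed c l d ∈ E → ed c l d ∈ M
    stay c≢ d≢ e with ∈-resp-↭ p e
    ... | here refl = ⊥-elim (d≢ refl)
    ... | there (here refl) = ⊥-elim (c≢ refl)
    ... | there (there e′) = there e′
    contract : ∀ {c l d} → c ≢ x → d ≢ x → Walk E c l d → Walk M c l d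
    contract c≢ d≢ (one e) = one (stay c≢ d≢ e)
    contract {d = d} c≢ d≢ (more {x = y} e q) with y ≟ x
    ... | no y≢ = more (stay c≢ y≢ e) (contract y≢ d≢ q)
    ... | yes refl with refl ← to-x e = through q
      where
      through : ∀ {l} → Walk E x l d → Walk M u (w ++ l) d
      through (one e′) with refl ← from-x e′ = one (here refl)
      through (more {w′ = l′} e′ r) with refl ← from-x e′ =
        subst (λ l → Walk M u l d) (List.++-assoc w w′ l′) (more (here refl) (contract v≢x d≢ r))
    acE : Acyclic E
    -- A cycle that starts at the vanishing vertex `x` is first rotated so that it starts at the
    -- successor `v`.
    acE {a} q with a ≟ x
    acE q | no a≢ = acM (contract a≢ a≢ q)
    acE (one e) | yes refl with refl ← from-x e = v≢x refl
    acE (more e q) | yes refl with refl ← from-x e = acM (contract v≢x v≢x (Walk-++ q (one e)))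

-- Glueing along maximal paths agrees with elimination.

named : ∀ {t} → (ℕ → ℕ) → Edge t → Ed (Fin t)
named f (edge u w v) = ed (f u) w (f v)

-- n names the vertices of the unglued multiword so that identified vertices get the same name; m names the
-- external vertices after glueing; ξ lists the names of the internal vertices.
module GlueElim {t : ℕ} (role : ℕ → Role) (E : List (Edge t)) (n m : ℕ → ℕ) (ξ S T : List ℕ)
  (roleOK : ∀ {v} → v ∈ map src E ++ map tgt E →
     (∃ λ y → role v ≡ int y × n y ≡ n v × n v ∈ ξ) ⊎ (∃ λ y → role v ≡ ext y × m y ≡ n v × n v ∉ ξ))
  (link : ∀ {e e′} → e ∈ E → e′ ∈ E → n (tgt e) ≡ n (src e′) → role (tgt e) ≡ int (src e′)) where

  open Glueing role E

  Ê = map (named n) E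

  Traced : ℕ → Edge t → Set
  Traced u e = role u ≡ ext (src e) × Path u (lbl e) (tgt e)

  module _ (ps : srcs Ê ↭ ξ ++ S) (pt : tgts Ê ↭ ξ ++ T) (uniq : Unique (ξ ++ S ++ T)) where

    us : Unique (srcs Ê)
    us = Unique-resp-↭ (↭-sym ps)
           (Unique-++ˡ (ξ ++ S) (subst Unique (sym (List.++-assoc ξ S T)) uniq))

    ut : Unique (tgts Ê)
    ut = Unique-resp-↭ (↭-sym pt)
           (Unique-++ˡ (ξ ++ T) (Unique-resp-↭ (solve 3 (λ a b c → a ⊕ b ⊕ c ⊜ (a ⊕ c) ⊕ b) ↭-refl ξ S T) uniq))

    src-inj : ∀ {e e′} → e ∈ E → e′ ∈ E → n (src e) ≡ n (src e′) → e ≡ e′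
    src-inj {e} {e′} p q eq = Unique-map⇒injective {f = λ e → esrc (named n e)}
      (subst Unique (sym (List.map-∘ E)) us) p q eq

    src∈ : ∀ {e} → e ∈ E → src e ∈ map src E ++ map tgt E
    src∈ e∈ = ∈-++⁺ˡ (∈-map⁺ src e∈)

    tgt∈ : ∀ {e} → e ∈ E → tgt e ∈ map src E ++ map tgt E
    tgt∈ e∈ = ∈-++⁺ʳ (map src E) (∈-map⁺ tgt e∈)

    -- `link` turns the equality of names at each inner vertex into an identification of vertices,
    -- so the walk follows the steps of a `Path` and stops at an external vertex.
    walk⇒path : ∀ {a w b} → Walk Ê a w b → b ∉ ξ →
                ∃₂ λ e v → e ∈ E × n (src e) ≡ a × m v ≡ b × Path (src e) w v
    walk⇒path (one ê∈) b∉ with e@(edge _ _ _) , e∈ , refl ← ∈-map⁻ (named n) ê∈ with roleOK (tgt∈ e∈)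
    ... | inj₁ (_ , _ , _ , b∈) = ⊥-elim (b∉ b∈)
    ... | inj₂ (y , r , eq , _) = e , y , e∈ , refl , eq , stop e∈ r
    walk⇒path (more ê∈ q) b∉ with e@(edge _ _ _) , e∈ , refl ← ∈-map⁻ (named n) ê∈
      with e′ , v , e′∈ , eq , mv , path ← walk⇒path q b∉ =
      e , v , e∈ , refl , mv , step e∈ (link e∈ e′∈ (sym eq)) path

    Reach-snoc : ∀ {e e′ e″} → Reach e e′ → Next e′ e″ → e″ ∈ E → Reach e e″
    Reach-snoc (one nx e∈)    nx′ e″∈ = more nx e∈ (one nx′ e″∈)
    Reach-snoc (more nx e∈ r) nx′ e″∈ = more nx e∈ (Reach-snoc r nx′ e″∈)

    walk⇒reach : ∀ {a w b} → Walk Ê a w b →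
                 ∃₂ λ e e′ → e ∈ E × e′ ∈ E × n (src e) ≡ a × n (tgt e′) ≡ b × (e ≡ e′ ⊎ Reach e e′)
    walk⇒reach (one ê∈) with e@(edge _ _ _) , e∈ , refl ← ∈-map⁻ (named n) ê∈ =
      e , e , e∈ , e∈ , refl , refl , inj₁ refl
    walk⇒reach (more ê∈ q) with e@(edge _ _ _) , e∈ , refl ← ∈-map⁻ (named n) ê∈
      with e₁ , e′ , e₁∈ , e′∈ , eq , eq′ , r ← walk⇒reach q
      with link e∈ e₁∈ (sym eq) | r
    ... | nx | inj₁ refl = e , e′ , e∈ , e′∈ , refl , eq′ , inj₂ (one nx e′∈)
    ... | nx | inj₂ r′   = e , e′ , e∈ , e′∈ , refl , eq′ , inj₂ (more nx e₁∈ r′)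

    next-name : ∀ {e e′} → e ∈ E → Next e e′ → n (tgt e) ≡ n (src e′)
    next-name e∈ nx with roleOK (tgt∈ e∈)
    ... | inj₁ (y , r , eq , _) with refl ← trans (sym nx) r = sym eq
    ... | inj₂ (_ , r , _) with () ← trans (sym nx) r

    reach⇒walk : ∀ {e e′} → e ∈ E → Reach e e′ → ∃ λ w → Walk Ê (n (src e)) w (n (src e′))
    reach⇒walk {e} e∈ (one {e′ = e′} nx _) =
      _ , subst (λ z → Walk Ê (n (src e)) (lbl e) z) (next-name {e′ = e′} e∈ nx) (one (∈-map⁺ (named n) e∈))
    reach⇒walk {e} e∈ (more {e″ = e″} nx e′∈ r) with w , q ← reach⇒walk e′∈ r =
      _ , more (subst (λ z → ed (n (src e)) (lbl e) z ∈ Ê) (next-name {e′ = e″} e∈ nx) (∈-map⁺ (named n) e∈)) q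

    Path-det : ∀ {u w w′ v v′} → Path u w v → Path u w′ v′ → w ≡ w′ × v ≡ v′
    Path-det (stop e∈ r) (stop e∈′ r′) with refl ← src-inj e∈ e∈′ refl
      with refl ← trans (sym r) r′ = refl , refl
    Path-det (stop e∈ r) (step e∈′ r′ _) with refl ← src-inj e∈ e∈′ refl with () ← trans (sym r) r′
    Path-det (step e∈ r _) (stop e∈′ r′) with refl ← src-inj e∈ e∈′ refl with () ← trans (sym r) r′
    Path-det (step e∈ r p) (step e∈′ r′ p′) with refl ← src-inj e∈ e∈′ refl with refl ← trans (sym r) r′
      with refl , refl ← Path-det p p′ = refl , refl

    extSrcs⁺ : ∀ {e y} (E′ : List (Edge t)) → e ∈ E′ → role (src e) ≡ ext y → src e ∈ extSrcs E′
    extSrcs⁺ (e ∷ E′) (here refl) r rewrite r = here refl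
    extSrcs⁺ (e ∷ E′) (there e∈) r with isExt (role (src e))
    ... | true  = there (extSrcs⁺ E′ e∈ r)
    ... | false = extSrcs⁺ E′ e∈ r

    extSrcs⁻ : ∀ {u} (E′ : List (Edge t)) → u ∈ extSrcs E′ → ∃₂ λ e y → e ∈ E′ × u ≡ src e × role u ≡ ext y
    extSrcs⁻ (e ∷ E′) u∈ with role (src e) in eq
    extSrcs⁻ (e ∷ E′) (here refl) | ext y = e , y , here refl , refl , eq
    extSrcs⁻ (e ∷ E′) (there u∈) | ext y with e′ , y′ , e∈ , r ← extSrcs⁻ E′ u∈ = e′ , y′ , there e∈ , r
    extSrcs⁻ (e ∷ E′) u∈ | int y with e′ , y′ , e∈ , r ← extSrcs⁻ E′ u∈ = e′ , y′ , there e∈ , r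

    extSrcs-unique : ∀ (E′ : List (Edge t)) → Unique (map (λ e → n (src e)) E′) → Unique (map n (extSrcs E′))
    extSrcs-unique [] _ = []
    extSrcs-unique (e ∷ E′) u@(_ ∷ u′) with isExt (role (src e))
    ... | false = extSrcs-unique E′ u′
    ... | true  = All.tabulate new ∷ extSrcs-unique E′ u′
      where
      new : ∀ {z} → z ∈ map n (extSrcs E′) → n (src e) ≢ z
      new z∈ eq with y , y∈ , refl ← ∈-map⁻ n z∈ with e′ , _ , e′∈ , refl , _ ← extSrcs⁻ E′ y∈ =
        Unique⇒∉ u (subst (_∈ map (λ e → n (src e)) E′) (sym eq) (∈-map⁺ _ e′∈))

    ext-name : ∀ {e y} → e ∈ E → role (src e) ≡ ext y → m y ≡ n (src e) × n (src e) ∉ ξ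
    ext-name e∈ r with roleOK (src∈ e∈)
    ... | inj₁ (_ , r′ , _) with () ← trans (sym r) r′
    ... | inj₂ (_ , r′ , eq , ∉ξ) with refl ← trans (sym r) r′ = eq , ∉ξ

    module _ {G : Soup _} (k : Elim Ê ξ G) where

      tgtG∉ξ : ∀ {v} → v ∈ tgts G → v ∉ ξ
      tgtG∉ξ v∈ v∈ξ = Unique-disjoint ξ (Unique-resp-↭ (Elim-tgts k) ut) v∈ξ v∈

      srcG∉ξ : ∀ {v} → v ∈ srcs G → v ∉ ξ
      srcG∉ξ v∈ v∈ξ = Unique-disjoint ξ (Unique-resp-↭ (Elim-srcs k) us) v∈ξ v∈

      edge⇒path : ∀ {g} → g ∈ G → ∃ λ e → e ∈ E × n (src e) ≡ esrc g ×
                  ∃₂ λ y v → role (src e) ≡ ext y × m y ≡ esrc g × m v ≡ etgt g × Path (src e) (elbl g) v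
      edge⇒path {ed _ _ _} g∈ with walk⇒path (Walk-expand k (one g∈)) (tgtG∉ξ (∈-map⁺ etgt g∈))
      ... | e , v , e∈ , eq , mv , path with roleOK (src∈ e∈)
      ...   | inj₁ (_ , _ , _ , ∈ξ) = ⊥-elim (srcG∉ξ (∈-map⁺ esrc g∈) (subst (_∈ ξ) eq ∈ξ))
      ...   | inj₂ (y , r , my , _) = e , e∈ , eq , y , v , r , trans my eq , mv , path

      src⇒path : ∀ {u} → u ∈ extSrcs E → ∃ λ g → g ∈ G × n u ≡ esrc g ×
                 ∃₂ λ y v → role u ≡ ext y × m y ≡ esrc g × m v ≡ etgt g × Path u (elbl g) v
      src⇒path u∈ with e , _ , e∈ , refl , r ← extSrcs⁻ E u∈
        with ∈-++⁻ ξ (∈-resp-↭ (Elim-srcs k) (subst (_ ∈_) (List.map-∘ E) (∈-map⁺ (λ e → n (src e)) e∈)))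
      ... | inj₁ ∈ξ = ⊥-elim (proj₂ (ext-name e∈ r) ∈ξ)
      ... | inj₂ ∈G with g , g∈ , eq ← ∈-map⁻ esrc ∈G with edge⇒path g∈
      ...   | e′ , e′∈ , eq′ , y , v , rest with refl ← src-inj e∈ e′∈ (trans eq (sym eq′)) =
        g , g∈ , eq , y , v , rest

      -- On both sides the sources are pairwise distinct, so mutual membership suffices; there
      -- `Path-det` forces label and target to agree.
      glue-unique : {R : List (Edge t)} →
                    Pointwise Traced (extSrcs E) R →
                    map (named m) R ↭ G
      glue-unique {R} pw = unique-set⇒↭ (Unique-map⁻ {f = esrc} _ uR) (Unique-map⁻ {f = esrc} G uG) to from
        where
        uG : Unique (srcs G)
        uG = Unique-++ʳ ξ (Unique-resp-↭ (Elim-srcs k) us)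
        names : ∀ us R → (∀ {u} → u ∈ us → u ∈ extSrcs E) →
                Pointwise Traced us R →
                map n us ≡ srcs (map (named m) R)
        names [] [] f [] = refl
        names (u ∷ us) (edge _ _ _ ∷ R) f ((r , _) ∷ pw) with e , _ , e∈ , refl , _ ← extSrcs⁻ E (f (here refl)) =
          cong₂ _∷_ (sym (proj₁ (ext-name e∈ r))) (names us R (λ q → f (there q)) pw)
        uR : Unique (srcs (map (named m) R))
        uR = subst Unique (names _ R (λ q → q) pw) (extSrcs-unique E (subst Unique (sym (List.map-∘ E)) us))
        backward : ∀ {us R e} → Pointwise Traced us R →
              e ∈ R → ∃ λ u → u ∈ us × role u ≡ ext (src e) × Path u (lbl e) (tgt e)
        backward (p ∷ pw) (here refl) = _ , here refl , p
        backward (_ ∷ pw) (there e∈) with u , u∈ , p ← backward pw e∈ = u , there u∈ , p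
        forward : ∀ {us R u} → Pointwise Traced us R →
              u ∈ us → ∃ λ e → e ∈ R × role u ≡ ext (src e) × Path u (lbl e) (tgt e)
        forward (p ∷ pw) (here refl) = _ , here refl , p
        forward (_ ∷ pw) (there u∈) with e , e∈ , p ← forward pw u∈ = e , there e∈ , p
        same : ∀ {g e u y v} → role u ≡ ext y → m y ≡ esrc g → m v ≡ etgt g → Path u (elbl g) v →
               role u ≡ ext (src e) → Path u (lbl e) (tgt e) → named m e ≡ g
        same {ed _ _ _} {edge _ _ _} r refl refl p r′ p′ with refl , refl ← Path-det p p′ | refl ← trans
            (sym r) r′ = refl
        to : ∀ {g} → g ∈ map (named m) R → g ∈ G
        to g∈ with e , e∈ , refl ← ∈-map⁻ (named m) g∈
          with u , u∈ , r , p ← backward pw e∈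
          with g , g∈G , _ , y , v , r′ , my , mv , p′ ← src⇒path u∈ =
            subst (_∈ G) (sym (same r′ my mv p′ r p)) g∈G
        from : ∀ {g} → g ∈ G → g ∈ map (named m) R
        from g∈ with e , e∈ , _ , y , v , r , my , mv , p ← edge⇒path g∈
          with e′ , e′∈ , r′ , p′ ← forward pw (extSrcs⁺ E e∈ r) =
            subst (_∈ map (named m) R) (same r my mv p r′ p′) (∈-map⁺ (named m) e′∈)

    glue⇒elim : ∀ {W ρ} → Glue W ρ → cyc ρ ≡ [] → Elim Ê ξ (map (named m) (reg ρ))
    glue⇒elim {W} {ρ} gl noc =
      let G , k = Elim-exists Ê ξ acyclic ps pt in Elim-respʳ (↭-sym (glue-unique k regular)) k
      where
      open Glue gl
      -- Every cycle of the glueing contributes a cyclic word, so without cyclic words `E₁` is empty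
      -- and all edges fall under `nocyc`.
      noReach : ∀ {e} → e ∈ E → ¬ Reach e e
      noReach e∈ with cycles | List.++-conicalʳ W (map (concatMap lbl) cycles) (trans (sym cycword) noc) | cycE
      ... | [] | _ | q with refl ← ↭-empty-inv (↭-sym q) = All.lookup nocyc (∈-resp-↭ split e∈)
      acyclic : Acyclic Ê
      acyclic c with e , e′ , e∈ , e′∈ , eq , eq′ , r ← walk⇒reach c with link e′∈ e∈ (trans eq′ (sym eq)) | r
      ... | nx | inj₁ refl = noReach e∈ (one nx e∈)
      ... | nx | inj₂ r′   = noReach e∈ (Reach-snoc r′ nx e∈)

    elim⇒glue : ∀ {W G} → Elim Ê ξ G → ∃ λ ρ → Glue W ρ × cyc ρ ≡ W × map (named m) (reg ρ) ↭ G
    elim⇒glue {W} {G} k = mw (proj₁ R) W , record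
      { regular = proj₂ R ; cycles = [] ; closed = [] ; E₁ = [] ; E₂ = E ; split = refl ; cycE = refl
      ; nocyc = All.tabulate λ e∈ r → acyclic (proj₂ (reach⇒walk e∈ r))
      ; cycword = sym (List.++-identityʳ W) } , refl , glue-unique k (proj₂ R)
      where
      build : ∀ us → (∀ {u} → u ∈ us → u ∈ extSrcs E) →
              ∃ λ R → Pointwise Traced us R
      build [] f = [] , []
      build (u ∷ us) f with R , pw ← build us (λ q → f (there q))
        with g , _ , _ , y , v , r , _ , _ , p ← src⇒path k (f (here refl)) =
        edge y (elbl g) v ∷ R , (r , p) ∷ pw
      R = build (extSrcs E) (λ q → q)
      -- After the elimination all sources lie in `S` and all targets in `T`, which are disjoint: no
      -- walk of `G` returns to its start, and `Elim-acyclic` carries this back.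
      acyclic : Acyclic Ê
      acyclic = Elim-acyclic us ut k λ c →
        Unique-disjoint S (Unique-++ʳ ξ uniq)
          (∈-resp-↭ (drop-++ ξ (↭-trans (↭-sym (Elim-srcs k)) ps)) (Walk-src c))
          (∈-resp-↭ (drop-++ ξ (↭-trans (↭-sym (Elim-tgts k)) pt)) (Walk-tgt c))

-- Positions, fresh names and boundaries.

-- Positions in multiwords count from 1; nth is 0 outside the list.
nth : List ℕ → ℕ → ℕ
nth []       _             = 0
nth (x ∷ xs) zero          = 0
nth (x ∷ xs) (suc zero)    = x
nth (x ∷ xs) (suc (suc i)) = nth xs (suc i)

nth-zero : ∀ xs → nth xs 0 ≡ 0
nth-zero []      = refl
nth-zero (_ ∷ _) = refl

nth-++ˡ : ∀ xs {ys v} → v ≤ length xs → nth (xs ++ ys) v ≡ nth xs v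
nth-++ˡ xs {ys} {zero} _ = trans (nth-zero (xs ++ ys)) (sym (nth-zero xs))
nth-++ˡ (x ∷ xs) {v = suc zero} _ = refl
nth-++ˡ (x ∷ xs) {v = suc (suc v)} (s≤s p) = nth-++ˡ xs p

nth-++ʳ : ∀ xs {ys v} → 1 ≤ v → nth (xs ++ ys) (length xs + v) ≡ nth ys v
nth-++ʳ [] _ = refl
nth-++ʳ (x ∷ []) {v = suc v} _ = refl
nth-++ʳ (x ∷ y ∷ xs) {v = v} p = nth-++ʳ (y ∷ xs) p

nth-∈ : ∀ xs {v} → 1 ≤ v → v ≤ length xs → nth xs v ∈ xs
nth-∈ (x ∷ xs) {suc zero} _ _ = here refl
nth-∈ (x ∷ xs) {suc (suc v)} _ (s≤s p) = there (nth-∈ xs (s≤s z≤n) p)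

nth-injective : ∀ xs {u v} → Unique xs → 1 ≤ u → u ≤ length xs → 1 ≤ v → v ≤ length xs → nth xs u ≡ nth xs v → u ≡ v
nth-injective (x ∷ xs) {suc zero} {suc zero} _ _ _ _ _ _ = refl
nth-injective (x ∷ xs) {suc zero} {suc (suc v)} U _ _ _ (s≤s q) eq =
  ⊥-elim (Unique⇒∉ U (subst (_∈ xs) (sym eq) (nth-∈ xs (s≤s z≤n) q)))
nth-injective (x ∷ xs) {suc (suc u)} {suc zero} U _ (s≤s q) _ _ eq =
  ⊥-elim (Unique⇒∉ U (subst (_∈ xs) eq (nth-∈ xs (s≤s z≤n) q)))
nth-injective (x ∷ xs) {suc (suc u)} {suc (suc v)} (_ ∷ U) _ (s≤s p) _ (s≤s q) eq =
  cong suc (nth-injective xs U (s≤s z≤n) p (s≤s z≤n) q eq)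

nth-reverse : ∀ xs {i} → 1 ≤ i → i ≤ length xs → nth (reverse xs) (length xs + 1 ∸ i) ≡ nth xs i
nth-reverse (x ∷ xs) {suc zero} _ _ rewrite List.unfold-reverse x xs | ℕ.+-comm (length xs) 1 | sym
    (List.length-reverse xs)
  | ℕ.+-comm 1 (length (reverse xs)) = nth-++ʳ (reverse xs) (s≤s z≤n)
nth-reverse (x ∷ xs) {suc (suc i)} _ (s≤s p) rewrite List.unfold-reverse x xs =
  trans (nth-++ˡ (reverse xs) (ℕ.≤-trans le (ℕ.≤-reflexive (sym (List.length-reverse xs)))))
        (nth-reverse xs (s≤s z≤n) p)
  where
  le : length xs + 1 ∸ suc i ≤ length xs
  le rewrite ℕ.+-comm (length xs) 1 = ℕ.m∸n≤m (length xs) i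

range : ℕ → ℕ → List ℕ
range k n = iterate suc k n

range-suc : ∀ k n → range (suc k) n ≡ map suc (range k n)
range-suc k zero    = refl
range-suc k (suc n) = cong (suc k ∷_) (range-suc (suc k) n)

range-snoc : ∀ k n → range k (suc n) ≡ range k n ++ [ k + n ]
range-snoc k zero    = cong [_] (sym (ℕ.+-identityʳ k))
range-snoc k (suc n) = cong (k ∷_) (trans (range-snoc (suc k) n) (cong (λ z → range (suc k) n ++ [ z ]) (sym
    (ℕ.+-suc k n))))

vertices-range : ∀ n → vertices n ≡ range 1 n
vertices-range zero    = refl
vertices-range (suc n) = trans (cong (_++ [ suc n ]) (vertices-range n)) (sym (range-snoc 1 n))

length-range : ∀ k n → length (range k n) ≡ n
length-range k n = List.length-iterate suc k n

∈-range⁻ : ∀ {v} k n → v ∈ range k n → k ≤ v × v < k + n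
∈-range⁻ k (suc n) (here refl) = ℕ.≤-refl , ℕ.m<m+n k (s≤s z≤n)
∈-range⁻ {v} k (suc n) (there p) with a , b ← ∈-range⁻ (suc k) n p =
  ℕ.<⇒≤ a , subst (v <_) (sym (ℕ.+-suc k n)) b

range-unique : ∀ k n → Unique (range k n)
range-unique k zero    = []
range-unique k (suc n) =
  All.tabulate (λ { v∈ refl → ℕ.<-irrefl refl (proj₁ (∈-range⁻ (suc k) n v∈)) }) ∷ range-unique (suc k) n

map-nth-range : ∀ xs → map (nth xs) (range 1 (length xs)) ≡ xs
map-nth-range [] = refl
map-nth-range (x ∷ xs) = cong (x ∷_) (begin
  map (nth (x ∷ xs)) (range 2 n)                ≡⟨ cong (map (nth (x ∷ xs))) (trans (range-suc 1 n) (cong (map suc)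
      (range-suc 0 n))) ⟩
  map (nth (x ∷ xs)) (map suc (map suc (range 0 n))) ≡⟨ List.map-∘ (map suc (range 0 n)) ⟨
  map (nth (x ∷ xs) ∘ suc) (map suc (range 0 n))     ≡⟨ List.map-∘ (range 0 n) ⟨
  map (nth xs ∘ suc) (range 0 n)                ≡⟨ List.map-∘ (range 0 n) ⟩
  map (nth xs) (map suc (range 0 n))            ≡⟨ cong (map (nth xs)) (range-suc 0 n) ⟨
  map (nth xs) (range 1 n)                      ≡⟨ map-nth-range xs ⟩
  xs ∎)
  where
  open ≡-Reasoning
  n = length xs

nth-range : ∀ k n i → nth (range (suc k) n) i ≡ 0 ⊎ (i ≤ n × nth (range (suc k) n) i ≡ k + i)
nth-range k zero    i             = inj₁ refl
nth-range k (suc n) zero          = inj₁ refl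
nth-range k (suc n) (suc zero)    = inj₂ (s≤s z≤n , sym (ℕ.+-comm k 1))
nth-range k (suc n) (suc (suc i)) with nth-range (suc k) n (suc i)
... | inj₁ p = inj₁ p
... | inj₂ (le , p) = inj₂ (s≤s le , trans p (sym (ℕ.+-suc k (suc i))))

fresh-for : ∀ ν n → ∃ λ ξ → length ξ ≡ n × Unique ξ × (∀ {z} → z ∈ ξ → z ∉ ν)
-- The sum of a list of naturals is at least each member, so every larger number is fresh.
fresh-for ν n = range (suc (bound ν)) n , length-range _ n , range-unique _ n ,
  λ p q → ℕ.<⇒≱ (proj₁ (∈-range⁻ _ n p)) (∈-bound ν q)
  where
  bound : List ℕ → ℕ
  bound [] = 0
  bound (x ∷ xs) = x + bound xs
  ∈-bound : ∀ {x} xs → x ∈ xs → x ≤ bound xs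
  ∈-bound (x ∷ xs) (here refl) = ℕ.m≤m+n x (bound xs)
  ∈-bound (x ∷ xs) (there p) = ℕ.≤-trans (∈-bound xs p) (ℕ.m≤n+m (bound xs) x)

fresh : ∀ ν n → Unique ν → ∃ λ ξ → length ξ ≡ n × Unique (ξ ++ ν)
fresh ν n u with ξ , l , uξ , d ← fresh-for ν n = ξ , l , Uniq.++⁺ uξ u λ { (p , q) → d p q }

split-length : ∀ {A : Set} (ν : List A) m {n} → length ν ≡ m + n →
               ∃₂ λ ν₁ ν₂ → ν ≡ ν₁ ++ ν₂ × length ν₁ ≡ m × length ν₂ ≡ n
split-length ν       zero    eq = [] , ν , refl , refl , eq
split-length (x ∷ ν) (suc m) eq with ν₁ , ν₂ , refl , e₁ , e₂ ← split-length ν m (ℕ.suc-injective eq) =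
  x ∷ ν₁ , ν₂ , refl , cong suc e₁ , e₂

split-≤ : ∀ m {v} → (v ≤ m) ⊎ (∃ λ i → 1 ≤ i × v ≡ m + i)
split-≤ m {v} with v Data.Nat.≤? m
... | yes p = inj₁ p
... | no ¬p = inj₂ (v ∸ m , ℕ.m<n⇒0<n∸m (ℕ.≰⇒> ¬p) , sym (ℕ.m+[n∸m]≡n (ℕ.<⇒≤ (ℕ.≰⇒> ¬p))))

≤ᵇ-true : ∀ {m n} → m ≤ n → (m ≤ᵇ n) ≡ true
≤ᵇ-true p = Bool.T-≡ .Equivalence.to (ℕ.≤⇒≤ᵇ p)

≤ᵇ-false : ∀ {m n} → n < m → (m ≤ᵇ n) ≡ false
≤ᵇ-false {m} {n} p with m ≤ᵇ n in eq
... | false = refl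
... | true  = ⊥-elim (ℕ.<⇒≱ p (ℕ.≤ᵇ⇒≤ m n (Bool.T-≡ .Equivalence.from eq)))

+-≤ᵇ-false : ∀ m {i} → 1 ≤ i → (m + i ≤ᵇ m) ≡ false
+-≤ᵇ-false m p = ≤ᵇ-false (ℕ.m<m+n m p)

-- The names of the left (b = true) or right (b = false) endpoints of X.
sel : Bool → Boundary → List ℕ → List ℕ
sel b     []          _       = []
sel b     (c ∷ X)     []      = []
sel true  (true ∷ X)  (x ∷ ν) = x ∷ sel true X ν
sel true  (false ∷ X) (x ∷ ν) = sel true X ν
sel false (true ∷ X)  (x ∷ ν) = sel false X ν
sel false (false ∷ X) (x ∷ ν) = x ∷ sel false X ν

sel-++ : ∀ b X {Y} ν {μ} → length ν ≡ length X → sel b (X ++ Y) (ν ++ μ) ≡ sel b X ν ++ sel b Y μ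
sel-++ b     []          []      eq = refl
sel-++ true  (true ∷ X)  (x ∷ ν) eq = cong (x ∷_) (sel-++ true X ν (ℕ.suc-injective eq))
sel-++ true  (false ∷ X) (x ∷ ν) eq = sel-++ true X ν (ℕ.suc-injective eq)
sel-++ false (true ∷ X)  (x ∷ ν) eq = sel-++ false X ν (ℕ.suc-injective eq)
sel-++ false (false ∷ X) (x ∷ ν) eq = cong (x ∷_) (sel-++ false X ν (ℕ.suc-injective eq))

ᵇ⊥-∷ : ∀ b X → (b ∷ X) ᵇ⊥ ≡ X ᵇ⊥ ++ [ not b ]
ᵇ⊥-∷ b X = trans (cong (map not) (List.unfold-reverse b X)) (List.map-++ not (reverse X) [ b ])

length-ᵇ⊥ : ∀ X → length (X ᵇ⊥) ≡ length X
length-ᵇ⊥ X = trans (List.length-map not (reverse X)) (List.length-reverse X)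

ᵇ⊥-++ : ∀ X Y → (X ++ Y) ᵇ⊥ ≡ Y ᵇ⊥ ++ X ᵇ⊥
ᵇ⊥-++ X Y = trans (cong (map not) (List.reverse-++ X Y)) (List.map-++ not (reverse Y) (reverse X))

ᵇ⊥-involutive : ∀ X → (X ᵇ⊥) ᵇ⊥ ≡ X
ᵇ⊥-involutive X = begin
  map not (reverse (map not (reverse X))) ≡⟨ cong (map not) (sym (List.reverse-map not (reverse X))) ⟩
  map not (map not (reverse (reverse X))) ≡⟨ List.map-∘ (reverse (reverse X)) ⟨
  map (not ∘ not) (reverse (reverse X))   ≡⟨ List.map-cong Bool.not-involutive _ ⟩
  map (λ b → b) (reverse (reverse X))     ≡⟨ List.map-id _ ⟩
  reverse (reverse X)                     ≡⟨ List.reverse-involutive X ⟩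
  X ∎
  where open ≡-Reasoning

-- The same names on the dual boundary, which is read backwards, have the opposite orientation: a
-- cut vertex is a source on one side and a target on the other.
sel-ᵇ⊥ : ∀ b X ν → length ν ≡ length X → sel b (X ᵇ⊥) (reverse ν) ↭ sel (not b) X ν
sel-ᵇ⊥ b [] [] eq = refl
sel-ᵇ⊥ b (c ∷ X) (x ∷ ν) eq rewrite ᵇ⊥-∷ c X | List.unfold-reverse x ν
  | sel-++ b (X ᵇ⊥) {[ not c ]} (reverse ν) {[ x ]}
      (trans (List.length-reverse ν) (trans (ℕ.suc-injective eq) (sym (length-ᵇ⊥ X)))) =
  ↭-trans (++⁺ʳ _ (sel-ᵇ⊥ b X ν (ℕ.suc-injective eq))) (last b c)
  where
  last : ∀ b c → sel (not b) X ν ++ sel b [ not c ] [ x ] ↭ sel (not b) (c ∷ X) (x ∷ ν)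
  last true  true  = ++-identityʳ _
  last true  false = ++-comm _ [ x ]
  last false true  = ++-comm _ [ x ]
  last false false = ++-identityʳ _

sel-all : ∀ X ν → length ν ≡ length X → sel true X ν ++ sel false X ν ↭ ν
sel-all [] [] eq = refl
sel-all (true ∷ X)  (x ∷ ν) eq = prep x (sel-all X ν (ℕ.suc-injective eq))
sel-all (false ∷ X) (x ∷ ν) eq = ↭-trans (shift x (sel true X ν) _) (prep x (sel-all X ν (ℕ.suc-injective eq)))

sel-⊆ : ∀ b X ν {v} → v ∈ sel b X ν → v ∈ ν
sel-⊆ true  (true ∷ X)  (x ∷ ν) (here refl) = here refl
sel-⊆ true  (true ∷ X)  (x ∷ ν) (there p)   = there (sel-⊆ true X ν p)
sel-⊆ true  (false ∷ X) (x ∷ ν) p           = there (sel-⊆ true X ν p)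
sel-⊆ false (true ∷ X)  (x ∷ ν) p           = there (sel-⊆ false X ν p)
sel-⊆ false (false ∷ X) (x ∷ ν) (here refl) = here refl
sel-⊆ false (false ∷ X) (x ∷ ν) (there p)   = there (sel-⊆ false X ν p)

sel-map : ∀ f b X ν → map f (sel b X ν) ≡ sel b X (map f ν)
sel-map f b     []          ν       = refl
sel-map f b     (c ∷ X)     []      = refl
sel-map f true  (true ∷ X)  (x ∷ ν) = cong (f x ∷_) (sel-map f true X ν)
sel-map f true  (false ∷ X) (x ∷ ν) = sel-map f true X ν
sel-map f false (true ∷ X)  (x ∷ ν) = sel-map f false X ν
sel-map f false (false ∷ X) (x ∷ ν) = cong (f x ∷_) (sel-map f false X ν)

at⇒sel : ∀ k b X i → at X i ≡ just b → k + i ∈ sel b X (range (suc k) (length X))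
at⇒sel k true  (true ∷ X)  (suc zero) refl = here (ℕ.+-comm k 1)
at⇒sel k false (false ∷ X) (suc zero) refl = here (ℕ.+-comm k 1)
at⇒sel k b (c ∷ X) (suc (suc i)) eq = go b c (subst (_∈ sel b X (range (2 + k) (length X))) (sym (ℕ.+-suc k
    (suc i))) (at⇒sel (suc k) b X (suc i) eq))
  where
  go : ∀ b c {v} → v ∈ sel b X (range (2 + k) (length X)) → v ∈ sel b (c ∷ X) (suc k ∷ range (2 + k) (length X))
  go true  true  p = there p
  go true  false p = p
  go false true  p = p
  go false false p = there p

sel⇒at : ∀ k b X {v} → v ∈ sel b X (range (suc k) (length X)) → ∃ λ i → v ≡ k + suc i × at X (suc i) ≡ just b
sel⇒at k true  (true ∷ X)  (here refl) = 0 , ℕ.+-comm 1 k , refl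
sel⇒at k true  (true ∷ X)  (there p) with i , eq , r ← sel⇒at (suc k) true X p = suc i , trans eq (sym
    (ℕ.+-suc k _)) , r
sel⇒at k true  (false ∷ X) p with i , eq , r ← sel⇒at (suc k) true X p = suc i , trans eq (sym (ℕ.+-suc k _)) , r
sel⇒at k false (true ∷ X)  p with i , eq , r ← sel⇒at (suc k) false X p = suc i , trans eq (sym (ℕ.+-suc k _)) , r
sel⇒at k false (false ∷ X) (here refl) = 0 , ℕ.+-comm 1 k , refl
sel⇒at k false (false ∷ X) (there p) with i , eq , r ← sel⇒at (suc k) false X p = suc i , trans eq (sym
    (ℕ.+-suc k _)) , r

-- Multiwords as soups on named vertices.

rn : ∀ {t} → List ℕ → List (Edge t) → Soup (Fin t)
rn ν = map (named (nth ν))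

-- A perfect matching from left to right endpoints, put as two permutations because elimination
-- removes its vertices from sources and targets alike. `Good` is the same for numbered vertices.
Match : ∀ {C} → Boundary → List ℕ → Soup C → Set
Match X ν E = srcs E ↭ sel true X ν × tgts E ↭ sel false X ν

Match⇒ends : ∀ {C X ν} {E : Soup C} → length ν ≡ length X → Match X ν E → ends E ↭ ν
Match⇒ends {X = X} {ν} eq (p , q) = ↭-trans (++⁺ p q) (sel-all X ν eq)

Good : ∀ {t} → Boundary → List (Edge t) → Set
Good X es = map src es ↭ sel true X (range 1 (length X)) × map tgt es ↭ sel false X (range 1 (length X))

InRange : ∀ {t} → ℕ → List (Edge t) → Set
InRange n es = ∀ {v} → v ∈ map src es ++ map tgt es → 1 ≤ v × v ≤ n

srcs-named : ∀ {t} f (es : List (Edge t)) → srcs (map (named f) es) ≡ map f (map src es)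
srcs-named f es = trans (sym (List.map-∘ es)) (List.map-∘ es)

tgts-named : ∀ {t} f (es : List (Edge t)) → tgts (map (named f) es) ≡ map f (map tgt es)
tgts-named f es = trans (sym (List.map-∘ es)) (List.map-∘ es)

Good⇒Match : ∀ {t X ν} {es : List (Edge t)} → length ν ≡ length X → Good X es → Match X ν (rn ν es)
Good⇒Match {X = X} {ν} {es} eq (p , q) = go (srcs-named (nth ν) es) p , go (tgts-named (nth ν) es) q
  where
  go : ∀ {b zs ws} → ws ≡ map (nth ν) zs → zs ↭ sel b X (range 1 (length X)) → ws ↭ sel b X ν
  go {b} refl r = ↭-trans (map⁺ (nth ν) r)
    (↭-reflexive (trans (sel-map (nth ν) b X _)
      (cong (sel b X) (trans (cong (map (nth ν) ∘ range 1) (sym eq)) (map-nth-range ν)))))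

Good⇒InRange : ∀ {t X} {es : List (Edge t)} → Good X es → InRange (length X) es
Good⇒InRange {X = X} {es} (p , q) v∈ with ∈-++⁻ (map src es) v∈
... | inj₁ r with a , b ← ∈-range⁻ 1 (length X) (sel-⊆ true X _ (∈-resp-↭ p r)) = a , ℕ.≤-pred b
... | inj₂ r with a , b ← ∈-range⁻ 1 (length X) (sel-⊆ false X _ (∈-resp-↭ q r)) = a , ℕ.≤-pred b

Match⇒Good : ∀ {t X} {es : List (Edge t)} → Match X (range 1 (length X)) (rn (range 1 (length X)) es) → Good X es
Match⇒Good {X = X} {es} (p , q) = go (srcs-named _ es) p , go (tgts-named _ es) q
  where
  ν = range 1 (length X)
  go : ∀ {b zs ws} → ws ≡ map (nth ν) zs → ws ↭ sel b X ν → zs ↭ sel b X ν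
  go {b} {zs} refl r = subst (_↭ sel b X ν) (fix zs (λ p → sel-⊆ b X ν (∈-resp-↭ r p))) r
    where
    fix : ∀ zs → (∀ {v} → v ∈ map (nth ν) zs → v ∈ ν) → map (nth ν) zs ≡ zs
    fix [] f = refl
    fix (z ∷ zs) f with nth-range 0 (length X) z
    -- The default value 0 of `nth` is not among the names 1, 2, ..., so the position was in range.
    ... | inj₁ eq0 with () ← subst (1 ≤_) eq0 (proj₁ (∈-range⁻ 1 (length X) (f (here refl))))
    ... | inj₂ (_ , eq) = cong₂ _∷_ eq (fix zs (λ p → f (there p)))

named-cong : ∀ {t} {f g : ℕ → ℕ} (es : List (Edge t)) → (∀ {v} → v ∈ map src es ++ map tgt es → f v ≡ g v) →
             map (named f) es ≡ map (named g) es
named-cong [] h = refl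
named-cong (edge u w v ∷ es) h = cong₂ _∷_
  (cong₂ (λ x y → ed x w y) (h (here refl)) (h (∈-++⁺ʳ (map src (edge u w v ∷ es)) (here refl))))
  (named-cong es λ p → h (∈-resp-↭ (↭-sym lemma) (there (there p))))
  where
  lemma : u ∷ map src es ++ v ∷ map tgt es ↭ u ∷ v ∷ map src es ++ map tgt es
  lemma = prep u (shift v (map src es) _)

named-renum : ∀ {t} (f g : ℕ → ℕ) (es : List (Edge t)) → map (named g) (renum f es) ≡ map (named (g ∘ f)) es
named-renum f g es = sym (List.map-∘ es)

endpoints-↭ : ∀ {t} (es : List (Edge t)) → map src es ++ map tgt es ↭ endpoints es
endpoints-↭ [] = refl
endpoints-↭ (e ∷ es) = prep _ (↭-trans (shift _ (map src es) _) (prep _ (endpoints-↭ es)))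

-- The endpoints exhaust the positions without repetition, and `at` decides for each whether it is a
-- source or a target; so both permutations reduce to mutual membership.
IsMultiword⇒Good : ∀ {t X} {σ : MW t} → IsMultiword X σ → Good X (reg σ)
IsMultiword⇒Good {X = X} {σ} (p , all) =
    unique-set⇒↭ (Unique-++ˡ _ U) (selU true) (λ v∈ → to true v∈ (s∈ v∈)) (λ v∈ → from-src (v⊆ true v∈) v∈)
  , unique-set⇒↭ (Unique-++ʳ (map src es) U) (selU false) (λ v∈ → to false v∈ (t∈ v∈)) (λ v∈ → from-tgt
      (v⊆ false v∈) v∈)
  where
  es = reg σ
  n = length X
  q : map src es ++ map tgt es ↭ range 1 n
  q = ↭-trans (endpoints-↭ es) (subst (endpoints es ↭_) (vertices-range n) p)
  U : Unique (map src es ++ map tgt es)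
  U = Unique-resp-↭ (↭-sym q) (range-unique 1 n)
  selU : ∀ b → Unique (sel b X (range 1 n))
  selU b with b | Unique-resp-↭ (↭-sym (sel-all X _ (length-range 1 n))) (range-unique 1 n)
  ... | true  | u = Unique-++ˡ _ u
  ... | false | u = Unique-++ʳ (sel true X (range 1 n)) u
  v⊆ : ∀ b {v} → v ∈ sel b X (range 1 n) → v ∈ map src es ++ map tgt es
  v⊆ b v∈ = ∈-resp-↭ (↭-sym q) (sel-⊆ b X _ v∈)
  s∈ : ∀ {v} → v ∈ map src es → at X v ≡ just true
  s∈ v∈ with e , e∈ , refl ← ∈-map⁻ src v∈ = proj₁ (All.lookup all e∈)
  t∈ : ∀ {v} → v ∈ map tgt es → at X v ≡ just false
  t∈ v∈ with e , e∈ , refl ← ∈-map⁻ tgt v∈ = proj₂ (All.lookup all e∈)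
  to : ∀ b {v vs} → v ∈ vs → at X v ≡ just b → v ∈ sel b X (range 1 n)
  to b _ eq = at⇒sel 0 b X _ eq
  from-src : ∀ {v} → v ∈ map src es ++ map tgt es → v ∈ sel true X (range 1 n) → v ∈ map src es
  from-src v∈ v∈s with ∈-++⁻ (map src es) v∈
  ... | inj₁ r = r
  ... | inj₂ r with i , refl , eq ← sel⇒at 0 true X v∈s with () ← trans (sym eq) (t∈ r)
  from-tgt : ∀ {v} → v ∈ map src es ++ map tgt es → v ∈ sel false X (range 1 n) → v ∈ map tgt es
  from-tgt v∈ v∈s with ∈-++⁻ (map src es) v∈
  ... | inj₂ r = r
  ... | inj₁ r with i , refl , eq ← sel⇒at 0 false X v∈s with () ← trans (sym eq) (s∈ r)

Good⇒IsMultiword : ∀ {t X} {σ : MW t} → Good X (reg σ) → IsMultiword X σ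
Good⇒IsMultiword {X = X} {σ} (p , q) =
  ↭-trans (↭-sym (endpoints-↭ (reg σ))) (subst (_ ↭_) (sym (vertices-range n)) (↭-trans (++⁺ p q) (sel-all X _
      (length-range 1 n)))) ,
  All.tabulate λ e∈ → is (∈-resp-↭ p (∈-map⁺ src e∈)) , is (∈-resp-↭ q (∈-map⁺ tgt e∈))
  where
  n = length X
  is : ∀ {b v} → v ∈ sel b X (range 1 n) → at X v ≡ just b
  is {b} v∈ with i , refl , eq ← sel⇒at 0 b X v∈ = eq

-- The renumberings of Ex, tensor and Cut, seen through names.

module Cut {t : ℕ} (G : LLG t) where

  -- Moving the names along with their blocks undoes the renumbering, so Ex leaves the named soup
  -- alone.
  exRenum-nth : ∀ δ β α γ v → 1 ≤ v →
    nth (δ ++ α ++ β ++ γ) (exRenum G (length δ) (length β) (length α) v) ≡ nth (δ ++ β ++ α ++ γ) v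
  exRenum-nth δ β α γ v 1≤v with split-≤ (length δ) {v}
  ... | inj₁ p rewrite ≤ᵇ-true p = trans (nth-++ˡ δ p) (sym (nth-++ˡ δ p))
  ... | inj₂ (i , 1≤i , refl) rewrite +-≤ᵇ-false (length δ) 1≤i with split-≤ (length β) {i}
  ...   | inj₁ p rewrite ≤ᵇ-true (ℕ.+-monoʳ-≤ (length δ) p) = begin
    nth (δ ++ α ++ β ++ γ) (length δ + i + length α)   ≡⟨ cong (nth (δ ++ α ++ β ++ γ)) (trans (ℕ.+-assoc
        (length δ) i _) (cong (length δ +_) (ℕ.+-comm i _))) ⟩
    nth (δ ++ α ++ β ++ γ) (length δ + (length α + i)) ≡⟨ nth-++ʳ δ (ℕ.≤-trans 1≤i (ℕ.m≤n+m i _)) ⟩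
    nth (α ++ β ++ γ) (length α + i)                   ≡⟨ nth-++ʳ α 1≤i ⟩
    nth (β ++ γ) i                                     ≡⟨ nth-++ˡ β p ⟩
    nth β i                                            ≡⟨ nth-++ˡ β p ⟨
    nth (β ++ α ++ γ) i                                ≡⟨ nth-++ʳ δ 1≤i ⟨
    nth (δ ++ β ++ α ++ γ) (length δ + i)              ∎
    where open ≡-Reasoning
  ...   | inj₂ (k , 1≤k , refl)
    rewrite ≤ᵇ-false (ℕ.+-monoʳ-< (length δ) (ℕ.m<m+n (length β) 1≤k)) with split-≤ (length α) {k}
  ...     | inj₁ p rewrite ≤ᵇ-true (ℕ.≤-trans (ℕ.≤-reflexive (sym (ℕ.+-assoc (length δ) (length β) k)))
      (ℕ.+-monoʳ-≤ (length δ + length β) p)) = begin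
    nth (δ ++ α ++ β ++ γ) (length δ + (length β + k) ∸ length β)  ≡⟨ cong (nth (δ ++ α ++ β ++ γ)) lemma ⟩
    nth (δ ++ α ++ β ++ γ) (length δ + k)              ≡⟨ nth-++ʳ δ 1≤k ⟩
    nth (α ++ β ++ γ) k                                ≡⟨ nth-++ˡ α p ⟩
    nth α k                                            ≡⟨ nth-++ˡ α p ⟨
    nth (α ++ γ) k                                     ≡⟨ nth-++ʳ β 1≤k ⟨
    nth (β ++ α ++ γ) (length β + k)                   ≡⟨ nth-++ʳ δ 1≤i ⟨
    nth (δ ++ β ++ α ++ γ) (length δ + (length β + k)) ∎
    where
    open ≡-Reasoning
    lemma : length δ + (length β + k) ∸ length β ≡ length δ + k
    lemma = trans (ℕ.+-∸-assoc (length δ) (ℕ.m≤m+n (length β) k)) (cong (length δ +_) (ℕ.m+n∸m≡n (length β) k))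
  ...     | inj₂ (l , 1≤l , refl)
    rewrite ≤ᵇ-false {length δ + (length β + (length α + l))} {length δ + length β + length α}
              (ℕ.<-≤-trans (ℕ.m<m+n (length δ + length β + length α) 1≤l)
                (ℕ.≤-reflexive (trans (ℕ.+-assoc (length δ + length β) (length α) l) (ℕ.+-assoc (length δ)
                    (length β) _)))) = begin
    nth (δ ++ α ++ β ++ γ) (length δ + (length β + (length α + l))) ≡⟨ nth-++ʳ δ 1≤i ⟩
    nth (α ++ β ++ γ) (length β + (length α + l))      ≡⟨ cong (nth (α ++ β ++ γ)) (trans (sym (ℕ.+-assoc
        (length β) (length α) l)) (trans (cong (_+ l) (ℕ.+-comm (length β) (length α))) (ℕ.+-assoc (length α)
        (length β) l))) ⟩
    nth (α ++ β ++ γ) (length α + (length β + l))      ≡⟨ nth-++ʳ α (ℕ.≤-trans 1≤l (ℕ.m≤n+m l _)) ⟩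
    nth (β ++ γ) (length β + l)                        ≡⟨ nth-++ʳ β 1≤l ⟩
    nth γ l                                            ≡⟨ nth-++ʳ α 1≤l ⟨
    nth (α ++ γ) (length α + l)                        ≡⟨ nth-++ʳ β 1≤k ⟨
    nth (β ++ α ++ γ) (length β + (length α + l))      ≡⟨ nth-++ʳ δ 1≤i ⟨
    nth (δ ++ β ++ α ++ γ) (length δ + (length β + (length α + l))) ∎
    where open ≡-Reasoning

  rn-ex : ∀ δ β α γ {d b a N} {es : List (Edge t)} → length δ ≡ d → length β ≡ b → length α ≡ a → InRange N es →
          rn (δ ++ α ++ β ++ γ) (renum (exRenum G d b a) es) ≡ rn (δ ++ β ++ α ++ γ) es
  rn-ex δ β α γ {es = es} refl refl refl r =
    trans (named-renum _ (nth (δ ++ α ++ β ++ γ)) es) (named-cong es λ v∈ → exRenum-nth δ β α γ _ (proj₁ (r v∈)))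

  rn-tens : ∀ δ β α γ {d b a N} {σ τ : MW t} → length δ ≡ d → length β ≡ b → length α ≡ a →
            InRange N (reg σ) → InRange (d + b) (reg τ) →
            rn (δ ++ α ++ β ++ γ) (reg (tensMW G d a b σ τ)) ≡ rn (α ++ γ) (reg σ) ++ rn (δ ++ β) (reg τ)
  rn-tens δ β α γ {σ = σ} {τ} refl refl refl r s =
    trans (List.map-++ _ (renum _ (reg σ)) _) (cong₂ _++_
      (trans (named-renum _ (nth ν) (reg σ)) (named-cong (reg σ) λ v∈ → left _ (proj₁ (r v∈))))
      (trans (named-renum _ (nth ν) (reg τ)) (named-cong (reg τ) λ v∈ → right _ (proj₁ (s v∈)) (proj₂ (s v∈)))))
    where
    open ≡-Reasoning
    d = length δ
    b = length β
    a = length α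
    ν = δ ++ α ++ β ++ γ
    left : ∀ v → 1 ≤ v → nth ν (if v ≤ᵇ a then d + v else d + b + v) ≡ nth (α ++ γ) v
    left v 1≤v with split-≤ a {v}
    ... | inj₁ p rewrite ≤ᵇ-true p = trans (nth-++ʳ δ 1≤v) (trans (nth-++ˡ α p) (sym (nth-++ˡ α p)))
    ... | inj₂ (i , 1≤i , refl) rewrite +-≤ᵇ-false a 1≤i = begin
      nth ν (d + b + (a + i))          ≡⟨ cong (nth ν) (trans (ℕ.+-assoc d b _) (cong (d +_)
                                            (trans (sym (ℕ.+-assoc b a i)) (trans (cong (_+ i) (ℕ.+-comm b a))
                                                (ℕ.+-assoc a b i))))) ⟩
      nth ν (d + (a + (b + i)))        ≡⟨ nth-++ʳ δ (ℕ.≤-trans (ℕ.≤-trans 1≤i (ℕ.m≤n+m i b)) (ℕ.m≤n+m _ a)) ⟩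
      nth (α ++ β ++ γ) (a + (b + i))  ≡⟨ nth-++ʳ α (ℕ.≤-trans 1≤i (ℕ.m≤n+m i b)) ⟩
      nth (β ++ γ) (b + i)             ≡⟨ nth-++ʳ β 1≤i ⟩
      nth γ i                          ≡⟨ nth-++ʳ α 1≤i ⟨
      nth (α ++ γ) (a + i)             ∎
    right : ∀ v → 1 ≤ v → v ≤ d + b → nth ν (if v ≤ᵇ d then v else a + v) ≡ nth (δ ++ β) v
    right v 1≤v v≤ with split-≤ d {v}
    ... | inj₁ p rewrite ≤ᵇ-true p = trans (nth-++ˡ δ p) (sym (nth-++ˡ δ p))
    ... | inj₂ (i , 1≤i , refl) rewrite +-≤ᵇ-false d 1≤i = begin
      nth ν (a + (d + i))              ≡⟨ cong (nth ν) (trans (sym (ℕ.+-assoc a d i)) (trans (cong (_+ i)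
          (ℕ.+-comm a d)) (ℕ.+-assoc d a i))) ⟩
      nth ν (d + (a + i))              ≡⟨ nth-++ʳ δ (ℕ.≤-trans 1≤i (ℕ.m≤n+m i a)) ⟩
      nth (α ++ β ++ γ) (a + i)        ≡⟨ nth-++ʳ α 1≤i ⟩
      nth (β ++ γ) i                   ≡⟨ nth-++ˡ β (ℕ.+-cancelˡ-≤ d _ _ v≤) ⟩
      nth β i                          ≡⟨ nth-++ʳ δ 1≤i ⟨
      nth (δ ++ β) (d + i)             ∎

  module _ (α γ δ : List ℕ) (σ τ : MW t) (uniq : Unique (α ++ γ ++ δ))
    (rσ : InRange (length α + length γ) (reg σ)) (rτ : InRange (length δ + length α) (reg τ))
    (oσ : ∀ {e e′} → e ∈ reg σ → e′ ∈ reg σ → tgt e ≢ src e′)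
    (oτ : ∀ {e e′} → e ∈ reg τ → e′ ∈ reg τ → tgt e ≢ src e′) where

    private
      a = length α
      g = length γ
      d = length δ
      -- In `cutE` the blocks come in the order A, Γ, Δ, dual of A. Vertex i of the first is glued
      -- to vertex a + 1 ∸ i of the last, so reversing `α` gives glued vertices the same name.
      ν = α ++ γ ++ δ ++ reverse α
      N = a + g + d
      E = cutE G a g σ τ

      -- Positions of the dual block are indexed by their partners in the block of A, so that both
      -- constructors name vertex i by entry i of `α`.
      data Block : ℕ → Set where
        inA  : ∀ {i} → 1 ≤ i → i ≤ a → Block i
        inΓ  : ∀ {i} → 1 ≤ i → i ≤ g → Block (a + i)
        inΔ  : ∀ {i} → 1 ≤ i → i ≤ d → Block (a + g + i)
        inA⊥ : ∀ {i} → 1 ≤ i → i ≤ a → Block (N + (a + 1 ∸ i))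

      rev-pos : ∀ {i} → 1 ≤ i → i ≤ a → 1 ≤ a + 1 ∸ i × a + 1 ∸ i ≤ a
      rev-pos {i} 1≤i i≤a = subst (1 ≤_) (sym eq) (s≤s z≤n) , subst (_≤ a) (sym eq) (ℕ.∸-monoʳ-< 1≤i i≤a)
        where
        eq : a + 1 ∸ i ≡ suc (a ∸ i)
        eq = trans (cong (_∸ i) (ℕ.+-comm a 1)) (ℕ.+-∸-assoc 1 i≤a)

      block : ∀ {v} → 1 ≤ v → v ≤ N + a → Block v
      block {v} 1≤v v≤ with split-≤ a {v}
      ... | inj₁ p = inA 1≤v p
      ... | inj₂ (i , 1≤i , refl) with split-≤ g {i}
      ...   | inj₁ p = inΓ 1≤i p
      ...   | inj₂ (j , 1≤j , refl) with split-≤ d {j}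
      ...     | inj₁ p = subst Block (ℕ.+-assoc a g j) (inΔ 1≤j p)
      ...     | inj₂ (k , 1≤k , refl) = subst Block
        (trans (cong (N +_) (ℕ.m∸[m∸n]≡n (ℕ.≤-trans k≤a (ℕ.m≤m+n a 1))))
               (trans (ℕ.+-assoc (a + g) d k) (ℕ.+-assoc a g _)))
        (inA⊥ {a + 1 ∸ k} (proj₁ (rev-pos 1≤k k≤a)) (proj₂ (rev-pos 1≤k k≤a)))
        where
        k≤a : k ≤ a
        k≤a = ℕ.+-cancelˡ-≤ N _ _ (subst (_≤ N + a) (sym (trans (ℕ.+-assoc (a + g) d k) (ℕ.+-assoc a g _))) v≤)

      nameA : ∀ {i} → 1 ≤ i → i ≤ a → nth ν i ≡ nth α i
      nameA _ p = nth-++ˡ α p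

      nameΓ : ∀ {i} → 1 ≤ i → i ≤ g → nth ν (a + i) ≡ nth γ i
      nameΓ q p = trans (nth-++ʳ α q) (nth-++ˡ γ p)

      nameΔ : ∀ {i} → 1 ≤ i → i ≤ d → nth ν (a + g + i) ≡ nth δ i
      nameΔ {i} q p = trans (cong (nth ν) (ℕ.+-assoc a g i))
        (trans (nth-++ʳ α (ℕ.≤-trans q (ℕ.m≤n+m i g))) (trans (nth-++ʳ γ q) (nth-++ˡ δ p)))

      name⊥ : ∀ {i} → 1 ≤ i → nth ν (N + i) ≡ nth (reverse α) i
      name⊥ {i} q = trans (cong (nth ν) (trans (ℕ.+-assoc (a + g) d i) (ℕ.+-assoc a g (d + i))))
        (trans (nth-++ʳ α (ℕ.≤-trans (ℕ.≤-trans q (ℕ.m≤n+m i d)) (ℕ.m≤n+m _ g)))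
          (trans (nth-++ʳ γ (ℕ.≤-trans q (ℕ.m≤n+m i d))) (nth-++ʳ δ q)))

      nameA⊥ : ∀ {i} → 1 ≤ i → i ≤ a → nth ν (N + (a + 1 ∸ i)) ≡ nth α i
      nameA⊥ q p = trans (name⊥ (proj₁ (rev-pos q p))) (nth-reverse α q p)

      role = cutRole G a g d

      roleA : ∀ {i} → 1 ≤ i → i ≤ a → role i ≡ int (N + (a + 1 ∸ i))
      roleA {i} q p rewrite ≤ᵇ-true p = cong int
        (trans (cong (_∸ i) (ℕ.+-assoc N a 1)) (ℕ.+-∸-assoc N (ℕ.≤-trans p (ℕ.m≤m+n a 1))))

      roleΓ : ∀ {i} → 1 ≤ i → i ≤ g → role (a + i) ≡ ext (d + i)
      roleΓ {i} q p rewrite +-≤ᵇ-false a q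
        | ≤ᵇ-false {N + 1} {a + i} (ℕ.≤-<-trans (ℕ.+-monoʳ-≤ a p) (ℕ.≤-<-trans (ℕ.m≤m+n (a + g) d) (ℕ.m<m+n N
            (s≤s z≤n))))
        | ≤ᵇ-true (ℕ.+-monoʳ-≤ a p) = cong ext (trans (cong (_+ d) (ℕ.m+n∸m≡n a i)) (ℕ.+-comm i d))

      roleΔ : ∀ {i} → 1 ≤ i → i ≤ d → role (a + g + i) ≡ ext i
      roleΔ {i} q p rewrite ≤ᵇ-false {a + g + i} {a} (ℕ.≤-<-trans (ℕ.m≤m+n a g) (ℕ.m<m+n (a + g) q))
        | ≤ᵇ-false {N + 1} {a + g + i} (ℕ.≤-<-trans (ℕ.+-monoʳ-≤ (a + g) p) (ℕ.m<m+n N (s≤s z≤n)))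
        | +-≤ᵇ-false (a + g) q = cong ext (ℕ.m+n∸m≡n (a + g) i)

      roleA⊥ : ∀ {i} → 1 ≤ i → i ≤ a → role (N + (a + 1 ∸ i)) ≡ int i
      roleA⊥ {i} q p rewrite ≤ᵇ-true {N + 1} {N + (a + 1 ∸ i)} (ℕ.+-monoʳ-≤ N (proj₁ (rev-pos q p)))
        | Bool.∨-zeroʳ (N + (a + 1 ∸ i) ≤ᵇ a) = cong int
        (trans (cong (_∸ (N + (a + 1 ∸ i))) (ℕ.+-assoc N a 1))
          (trans (ℕ.[m+n]∸[m+o]≡n∸o N (a + 1) (a + 1 ∸ i)) (ℕ.m∸[m∸n]≡n (ℕ.≤-trans p (ℕ.m≤m+n a 1)))))

      memE : ∀ {v} → v ∈ map src E ++ map tgt E →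
             (v ∈ map src (reg σ) ++ map tgt (reg σ)) ⊎ (∃ λ u → v ≡ a + g + u × u ∈ map src (reg τ) ++ map tgt
                 (reg τ))
      memE v∈ with ∈-++⁻ (map src E) v∈
      ... | inj₁ p with e , e∈ , refl ← ∈-map⁻ src p with ∈-++⁻ (reg σ) e∈
      ...   | inj₁ q = inj₁ (∈-++⁺ˡ (∈-map⁺ src q))
      ...   | inj₂ q with e′ , q′ , refl ← ∈-map⁻ _ q = inj₂ (_ , refl , ∈-++⁺ˡ (∈-map⁺ src q′))
      memE v∈ | inj₂ p with e , e∈ , refl ← ∈-map⁻ tgt p with ∈-++⁻ (reg σ) e∈
      ...   | inj₁ q = inj₁ (∈-++⁺ʳ (map src (reg σ)) (∈-map⁺ tgt q))
      ...   | inj₂ q with e′ , q′ , refl ← ∈-map⁻ _ q = inj₂ (_ , refl , ∈-++⁺ʳ (map src (reg τ)) (∈-map⁺ tgt q′))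

      blockE : ∀ {v} → v ∈ map src E ++ map tgt E → Block v
      blockE v∈ with memE v∈
      ... | inj₁ p with q , r ← rσ p = block q (ℕ.≤-trans r (ℕ.≤-trans (ℕ.m≤m+n (a + g) d) (ℕ.m≤m+n N a)))
      ... | inj₂ (u , refl , p) with q , r ← rτ p = block (ℕ.≤-trans q (ℕ.m≤n+m u (a + g)))
        (ℕ.≤-trans (ℕ.+-monoʳ-≤ (a + g) r) (ℕ.≤-reflexive (sym (ℕ.+-assoc (a + g) d a))))

      γ∉α : ∀ {x} → x ∈ γ → x ∉ α
      γ∉α p q = Unique-disjoint α uniq q (∈-++⁺ˡ p)

      δ∉α : ∀ {x} → x ∈ δ → x ∉ α
      δ∉α p q = Unique-disjoint α uniq q (∈-++⁺ʳ γ p)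

      roleOK : ∀ {v} → v ∈ map src E ++ map tgt E →
        (∃ λ y → role v ≡ int y × nth ν y ≡ nth ν v × nth ν v ∈ α) ⊎
        (∃ λ y → role v ≡ ext y × nth (δ ++ γ) y ≡ nth ν v × nth ν v ∉ α)
      roleOK v∈ with blockE v∈
      ... | inA q p  = inj₁ (_ , roleA q p , trans (nameA⊥ q p) (sym (nameA q p)) , subst (_∈ α) (sym (nameA q p))
          (nth-∈ α q p))
      ... | inA⊥ q p = inj₁ (_ , roleA⊥ q p , trans (nameA q p) (sym (nameA⊥ q p)) , subst (_∈ α) (sym
          (nameA⊥ q p)) (nth-∈ α q p))
      ... | inΓ q p  = inj₂ (_ , roleΓ q p , trans (nth-++ʳ δ q) (sym (nameΓ q p)) ,
                             subst (_∉ α) (sym (nameΓ q p)) (γ∉α (nth-∈ γ q p)))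
      ... | inΔ q p  = inj₂ (_ , roleΔ q p , trans (nth-++ˡ δ p) (sym (nameΔ q p)) ,
                             subst (_∉ α) (sym (nameΔ q p)) (δ∉α (nth-∈ δ q p)))

      -- Two positions in one block with the same name coincide; this excludes that such a pair is a
      -- target and a source.
      apart : ∀ {e e′} → e ∈ E → e′ ∈ E → tgt e ≢ src e′
      apart e∈ e′∈ eq with ∈-++⁻ (reg σ) e∈ | ∈-++⁻ (reg σ) e′∈
      ... | inj₁ p | inj₁ q = oσ p q eq
      ... | inj₂ p | inj₂ q with _ , p′ , refl ← ∈-map⁻ _ p | _ , q′ , refl ← ∈-map⁻ _ q =
        oτ p′ q′ (ℕ.+-cancelˡ-≡ (a + g) _ _ eq)
      ... | inj₁ p | inj₂ q with e , q′ , refl ← ∈-map⁻ _ q =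
        ℕ.<⇒≱ (ℕ.m<m+n (a + g) (proj₁ (rτ (∈-++⁺ˡ (∈-map⁺ src q′)))))
              (subst (_≤ a + g) eq (proj₂ (rσ (∈-++⁺ʳ (map src (reg σ)) (∈-map⁺ tgt p)))))
      apart e∈ e′∈ eq | inj₂ p | inj₁ q with e , p′ , refl ← ∈-map⁻ _ p =
        ℕ.<⇒≱ (ℕ.m<m+n (a + g) (proj₁ (rτ (∈-++⁺ʳ (map src (reg τ)) (∈-map⁺ tgt p′)))))
              (subst (_≤ a + g) (sym eq) (proj₂ (rσ (∈-++⁺ˡ (∈-map⁺ src q)))))

      same-A : ∀ {i j} → 1 ≤ i → i ≤ a → 1 ≤ j → j ≤ a → nth α i ≡ nth α j → i ≡ j
      same-A q p q′ p′ eq = nth-injective α (Unique-++ˡ α uniq) q p q′ p′ eq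

      Ê↭ : map (named (nth ν)) E ≡ rn (α ++ γ) (reg σ) ++ rn (δ ++ reverse α) (reg τ)
      Ê↭ = trans (List.map-++ _ (reg σ) _) (cong₂ _++_
        (named-cong (reg σ) λ v∈ → left (rσ v∈))
        (trans (named-renum _ (nth ν) (reg τ)) (named-cong (reg τ) λ v∈ → right (rτ v∈))))
        where
        left : ∀ {v} → 1 ≤ v × v ≤ a + g → nth ν v ≡ nth (α ++ γ) v
        left {v} (_ , p) = trans (cong (λ l → nth l v) (sym (List.++-assoc α γ _)))
          (nth-++ˡ (α ++ γ) (subst (v ≤_) (sym (List.length-++ α)) p))
        right : ∀ {v} → 1 ≤ v × v ≤ d + a → nth ν (a + g + v) ≡ nth (δ ++ reverse α) v
        right {v} (q , _) = trans (cong (nth ν) (ℕ.+-assoc a g v)) (trans (nth-++ʳ α (ℕ.≤-trans q (ℕ.m≤n+m v g)))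
            (nth-++ʳ γ q))

    module _ (S T : List ℕ) (uST : Unique (α ++ S ++ T))
      (ps : srcs (rn (α ++ γ) (reg σ) ++ rn (δ ++ reverse α) (reg τ)) ↭ α ++ S)
      (pt : tgts (rn (α ++ γ) (reg σ) ++ rn (δ ++ reverse α) (reg τ)) ↭ α ++ T) where

      private
        ext-apart : ∀ {e e′} → e ∈ E → e′ ∈ E → nth ν (tgt e) ∉ α → nth ν (tgt e) ≢ nth ν (src e′)
        ext-apart e∈ e′∈ ∉α eq
          with ∈-++⁻ α (∈-resp-↭ (↭-trans (↭-reflexive (cong tgts Ê↭)) pt) (∈-map⁺ etgt (∈-map⁺ (named
              (nth ν)) e∈)))
             | ∈-++⁻ α (∈-resp-↭ (↭-trans (↭-reflexive (cong srcs Ê↭)) ps) (∈-map⁺ esrc (∈-map⁺ (named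
                 (nth ν)) e′∈)))
        ... | inj₁ p | _ = ∉α p
        ... | _ | inj₁ q = ∉α (subst (_∈ α) (sym eq) q)
        ... | inj₂ p | inj₂ q = Unique-disjoint S (Unique-++ʳ α uST) q (subst (_∈ T) eq p)

        -- A common name of a target and a source must come from partner positions in the two blocks
        -- of A: `ext-apart` excludes external targets, disjointness of `α` from `γ` and `δ`
        -- excludes external sources, and `apart` excludes a single block.
        link : ∀ {e e′} → e ∈ E → e′ ∈ E → nth ν (tgt e) ≡ nth ν (src e′) → role (tgt e) ≡ int (src e′)
        link {e} {e′} e∈ e′∈ eq with tgt e | src e′ | apart e∈ e′∈ | ext-apart e∈ e′∈
            | blockE (∈-++⁺ʳ (map src E) (∈-map⁺ tgt e∈)) | blockE (∈-++⁺ˡ {ys = map tgt E} (∈-map⁺ src e′∈)) | eq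
        ... | _ | _ | ne | ex | inΓ q p | _ | eq = ⊥-elim (ex (subst (_∉ α) (sym (nameΓ q p)) (γ∉α
            (nth-∈ γ q p))) eq)
        ... | _ | _ | ne | ex | inΔ q p | _ | eq = ⊥-elim (ex (subst (_∉ α) (sym (nameΔ q p)) (δ∉α
            (nth-∈ δ q p))) eq)
        ... | _ | _ | ne | ex | inA q p | inA q′ p′ | eq =
          ⊥-elim (ne (same-A q p q′ p′ (trans (sym (nameA q p)) (trans eq (nameA q′ p′)))))
        ... | _ | _ | ne | ex | inA⊥ q p | inA⊥ q′ p′ | eq =
          ⊥-elim (ne (cong (λ i → N + (a + 1 ∸ i)) (same-A q p q′ p′ (trans (sym (nameA⊥ q p)) (trans eq
              (nameA⊥ q′ p′))))))
        ... | _ | _ | ne | ex | inA q p | inA⊥ q′ p′ | eq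
          with refl ← same-A q p q′ p′ (trans (sym (nameA q p)) (trans eq (nameA⊥ q′ p′))) = roleA q p
        ... | _ | _ | ne | ex | inA⊥ q p | inA q′ p′ | eq
          with refl ← same-A q p q′ p′ (trans (sym (nameA⊥ q p)) (trans eq (nameA q′ p′))) = roleA⊥ q p
        ... | _ | _ | ne | ex | inA q p | inΓ q′ p′ | eq =
          ⊥-elim (γ∉α (nth-∈ γ q′ p′) (subst (_∈ α) (trans (sym (nameA q p)) (trans eq (nameΓ q′ p′)))
              (nth-∈ α q p)))
        ... | _ | _ | ne | ex | inA q p | inΔ q′ p′ | eq =
          ⊥-elim (δ∉α (nth-∈ δ q′ p′) (subst (_∈ α) (trans (sym (nameA q p)) (trans eq (nameΔ q′ p′)))
              (nth-∈ α q p)))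
        ... | _ | _ | ne | ex | inA⊥ q p | inΓ q′ p′ | eq =
          ⊥-elim (γ∉α (nth-∈ γ q′ p′) (subst (_∈ α) (trans (sym (nameA⊥ q p)) (trans eq (nameΓ q′ p′)))
              (nth-∈ α q p)))
        ... | _ | _ | ne | ex | inA⊥ q p | inΔ q′ p′ | eq =
          ⊥-elim (δ∉α (nth-∈ δ q′ p′) (subst (_∈ α) (trans (sym (nameA⊥ q p)) (trans eq (nameΔ q′ p′)))
              (nth-∈ α q p)))

        module GE = GlueElim role E (nth ν) (nth (δ ++ γ)) α S T roleOK link
        ps′ = subst (λ Z → srcs Z ↭ α ++ S) (sym Ê↭) ps
        pt′ = subst (λ Z → tgts Z ↭ α ++ T) (sym Ê↭) pt

      cut-glue⇒elim : ∀ {W ρ} → Glueing.Glue role E W ρ → cyc ρ ≡ [] →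
                      Elim (rn (α ++ γ) (reg σ) ++ rn (δ ++ reverse α) (reg τ)) α (rn (δ ++ γ) (reg ρ))
      cut-glue⇒elim gl c = subst (λ Z → Elim Z α _) Ê↭ (GE.glue⇒elim ps′ pt′ uST gl c)

      cut-elim⇒glue : ∀ {W F} → Elim (rn (α ++ γ) (reg σ) ++ rn (δ ++ reverse α) (reg τ)) α F →
                      ∃ λ ρ → Glueing.Glue role E W ρ × cyc ρ ≡ W × rn (δ ++ γ) (reg ρ) ↭ F
      cut-elim⇒glue k = GE.elim⇒glue ps′ pt′ uST (subst (λ Z → Elim Z α _) (sym Ê↭) k)

  cut-correct : ∀ α γ δ {a g d} (σ τ : MW t) S T → length α ≡ a → length γ ≡ g → length δ ≡ d →
    Unique (α ++ γ ++ δ) → InRange (a + g) (reg σ) → InRange (d + a) (reg τ) →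
    (∀ {e e′} → e ∈ reg σ → e′ ∈ reg σ → tgt e ≢ src e′) → (∀ {e e′} → e ∈ reg τ → e′ ∈ reg τ → tgt e ≢ src e′) →
    Unique (α ++ S ++ T) → let Ê = rn (α ++ γ) (reg σ) ++ rn (δ ++ reverse α) (reg τ) in
    srcs Ê ↭ α ++ S → tgts Ê ↭ α ++ T → let open Glueing (cutRole G a g d) (cutE G a g σ τ) in
    (∀ {W ρ} → Glue W ρ → cyc ρ ≡ [] → Elim Ê α (rn (δ ++ γ) (reg ρ))) ×
    (∀ {W F} → Elim Ê α F → ∃ λ ρ → Glue W ρ × cyc ρ ≡ W × rn (δ ++ γ) (reg ρ) ↭ F)
  cut-correct α γ δ σ τ S T refl refl refl u rσ rτ oσ oτ uST ps pt =
    cut-glue⇒elim α γ δ σ τ u rσ rτ oσ oτ S T uST ps pt , cut-elim⇒glue α γ δ σ τ u rσ rτ oσ oτ S T uST ps pt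

-- Named derivations

links : ∀ {C} → Boundary → List ℕ → List ℕ → Soup C
links []          _       _       = []
links (b ∷ X)     []      _       = []
links (b ∷ X)     (x ∷ α) []      = []
links (true ∷ X)  (x ∷ α) (y ∷ β) = ed x [] y ∷ links X α β
links (false ∷ X) (x ∷ α) (y ∷ β) = ed y [] x ∷ links X α β

links-srcs : ∀ {C} X α β → length α ≡ length X → length β ≡ length X →
             srcs (links {C} X α β) ↭ sel true X α ++ sel false X β
links-srcs [] [] [] p q = refl
links-srcs (true ∷ X) (x ∷ α) (y ∷ β) p q = prep x (links-srcs X α β (ℕ.suc-injective p) (ℕ.suc-injective q))
links-srcs (false ∷ X) (x ∷ α) (y ∷ β) p q =
  ↭-trans (prep y (links-srcs X α β (ℕ.suc-injective p) (ℕ.suc-injective q))) (↭-sym (shift y (sel true X α) _))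

links-tgts : ∀ {C} X α β → length α ≡ length X → length β ≡ length X →
             tgts (links {C} X α β) ↭ sel false X α ++ sel true X β
links-tgts [] [] [] p q = refl
links-tgts (false ∷ X) (x ∷ α) (y ∷ β) p q = prep x (links-tgts X α β (ℕ.suc-injective p) (ℕ.suc-injective q))
links-tgts (true ∷ X) (x ∷ α) (y ∷ β) p q =
  ↭-trans (prep y (links-tgts X α β (ℕ.suc-injective p) (ℕ.suc-injective q))) (↭-sym (shift y (sel false X α) _))

rn-idEdges : ∀ {t} f k i X → map (named {t} f) (idEdges k i X) ≡
  links X (map f (range i (length X))) (map (λ v → f (2 * k + 1 ∸ v)) (range i (length X)))
rn-idEdges f k i []          = refl
rn-idEdges f k i (true ∷ X)  = cong (_ ∷_) (rn-idEdges f k (suc i) X)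
rn-idEdges f k i (false ∷ X) = cong (_ ∷_) (rn-idEdges f k (suc i) X)

-- The partner of i is counted down from 2k, hence the second block is met in reverse.
rn-id : ∀ {t} X α β → length α ≡ length X → length β ≡ length X →
        rn {t} (α ++ β) (idEdges (length X) 1 X) ≡ links X α (reverse β)
rn-id X α β p q = trans (rn-idEdges (nth (α ++ β)) k 1 X) (cong₂ (links X) left right)
  where
  open ≡-Reasoning
  k = length X
  α-ok : ∀ {v} → v ∈ range 1 k → nth (α ++ β) v ≡ nth α v
  α-ok v∈ = nth-++ˡ α (subst (_ ≤_) (sym p) (ℕ.≤-pred (proj₂ (∈-range⁻ 1 k v∈))))
  β-ok : ∀ {v} → v ∈ range 1 k → nth (α ++ β) (2 * k + 1 ∸ v) ≡ nth (reverse β) v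
  β-ok {v} v∈ with 1≤v , v< ← ∈-range⁻ 1 k v∈ = begin
    nth (α ++ β) (2 * k + 1 ∸ v)      ≡⟨ cong (nth (α ++ β)) (trans (cong (λ z → k + z + 1 ∸ v) (ℕ.+-identityʳ k))
                                                   (trans (cong (_∸ v) (ℕ.+-assoc k k 1)) (ℕ.+-∸-assoc k
                                                       (ℕ.≤-trans v≤k (ℕ.m≤m+n k 1))))) ⟩
    nth (α ++ β) (k + (k + 1 ∸ v))             ≡⟨ cong (λ z → nth (α ++ β) (z + (k + 1 ∸ v))) (sym p) ⟩
    nth (α ++ β) (length α + (k + 1 ∸ v))      ≡⟨ nth-++ʳ α (ℕ.m<n⇒0<n∸m (ℕ.≤-trans v< (ℕ.≤-reflexive
        (ℕ.+-comm 1 k)))) ⟩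
    nth β (k + 1 ∸ v)                          ≡⟨ cong₂ (λ l z → nth l (z + 1 ∸ v)) (List.reverse-involutive β)
        (trans (List.length-reverse β) q) ⟨
    nth (reverse (reverse β)) (length (reverse β) + 1 ∸ v) ≡⟨ nth-reverse (reverse β) 1≤v
                                                    (subst (v ≤_) (sym (trans (List.length-reverse β) q)) v≤k) ⟩
    nth (reverse β) v ∎
    where
    v≤k = ℕ.≤-pred v<
  left : map (nth (α ++ β)) (range 1 k) ≡ α
  left = trans (List.map-cong-local (All.tabulate α-ok)) (trans (cong (map (nth α) ∘ range 1) (sym p))
      (map-nth-range α))
  right : map (λ v → nth (α ++ β) (2 * k + 1 ∸ v)) (range 1 k) ≡ reverse β
  right = trans (List.map-cong-local (All.tabulate β-ok))
    (trans (cong (map (nth (reverse β)) ∘ range 1) (sym (trans (List.length-reverse β) q))) (map-nth-range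
        (reverse β)))

module Named {t : ℕ} (G : LLG t) where
  open LLG G
  open Interp bnd
  open Cut G

  ⟦⟧-⊥ : ∀ A → ⟦ A ^⊥ ⟧ ≡ ⟦ A ⟧ ᵇ⊥
  ⟦⟧-⊥ (pos P) = refl
  ⟦⟧-⊥ (neg P) = sym (ᵇ⊥-involutive (bnd P))
  ⟦⟧-⊥ (A ⊗ B) = trans (cong₂ _++_ (⟦⟧-⊥ B) (⟦⟧-⊥ A)) (sym (ᵇ⊥-++ ⟦ A ⟧ ⟦ B ⟧))
  ⟦⟧-⊥ (A ⅋ B) = trans (cong₂ _++_ (⟦⟧-⊥ A) (⟦⟧-⊥ B)) (sym (ᵇ⊥-++ ⟦ B ⟧ ⟦ A ⟧))

  sz-⊥ : ∀ A → sz (A ^⊥) ≡ sz A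
  sz-⊥ A = trans (cong length (⟦⟧-⊥ A)) (length-ᵇ⊥ ⟦ A ⟧)

  record NF : Set where
    constructor nf
    field
      fm  : Formula n
      nms : List ℕ
      len : length nms ≡ sz fm
  open NF public

  Ctx : Set
  Ctx = List NF

  fms : Ctx → List (Formula n)
  fms = map fm

  -- The order is that of `⟦_⟧ˢ`, where later formulas come first.
  nm : Ctx → List ℕ
  nm []      = []
  nm (a ∷ Γ) = nm Γ ++ nms a

  nm-++ : ∀ Γ Δ → nm (Γ ++ Δ) ≡ nm Δ ++ nm Γ
  nm-++ []      Δ = sym (List.++-identityʳ (nm Δ))
  nm-++ (a ∷ Γ) Δ = trans (cong (_++ nms a) (nm-++ Γ Δ)) (List.++-assoc (nm Δ) (nm Γ) (nms a))

  nm-concatMap : ∀ Γ → nm Γ ↭ concatMap nms Γ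
  nm-concatMap []      = refl
  nm-concatMap (a ∷ Γ) = ↭-trans (++-comm (nm Γ) (nms a)) (++⁺ˡ (nms a) (nm-concatMap Γ))

  nm-↭ : ∀ {Γ Δ} → Γ ↭ Δ → nm Γ ↭ nm Δ
  nm-↭ {Γ} {Δ} p = ↭-trans (nm-concatMap Γ) (↭-trans (concatMap-↭ nms p) (↭-sym (nm-concatMap Δ)))

  nm-++-↭ : ∀ Γ Δ → nm (Γ ++ Δ) ↭ nm Γ ++ nm Δ
  nm-++-↭ Γ Δ = ↭-trans (↭-reflexive (nm-++ Γ Δ)) (++-comm (nm Δ) (nm Γ))

  length-nm : ∀ Γ → length (nm Γ) ≡ szs (fms Γ)
  length-nm []      = refl
  length-nm (a ∷ Γ) = trans (List.length-++ (nm Γ)) (trans (cong₂ _+_ (length-nm Γ) (len a)) (sym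
      (List.length-++ ⟦ fms Γ ⟧ˢ)))

  ⟦⟧ˢ-++ : ∀ Γ Δ → ⟦ Γ ++ Δ ⟧ˢ ≡ ⟦ Δ ⟧ˢ ++ ⟦ Γ ⟧ˢ
  ⟦⟧ˢ-++ []      Δ = sym (List.++-identityʳ ⟦ Δ ⟧ˢ)
  ⟦⟧ˢ-++ (A ∷ Γ) Δ = trans (cong (_++ ⟦ A ⟧) (⟦⟧ˢ-++ Γ Δ)) (List.++-assoc ⟦ Δ ⟧ˢ ⟦ Γ ⟧ˢ ⟦ A ⟧)

  -- Collected formula by formula in the order of the context, so that a permutation of formulas
  -- acts through `concatMap-↭`; `csel-sel` returns to the order of `nm`.
  csel : Bool → Ctx → List ℕ
  csel b = concatMap λ a → sel b ⟦ fm a ⟧ (nms a)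

  csel-sel : ∀ b Γ → csel b Γ ↭ sel b ⟦ fms Γ ⟧ˢ (nm Γ)
  csel-sel b []      = refl
  csel-sel b (a ∷ Γ) = ↭-trans (++⁺ˡ (sel b ⟦ fm a ⟧ (nms a)) (csel-sel b Γ))
    (↭-trans (++-comm (sel b ⟦ fm a ⟧ (nms a)) _) (↭-reflexive (sym (sel-++ b ⟦ fms Γ ⟧ˢ (nm Γ) (length-nm Γ)))))

  csel-all : ∀ Γ → csel true Γ ++ csel false Γ ↭ nm Γ
  csel-all Γ = ↭-trans (++⁺ (csel-sel true Γ) (csel-sel false Γ)) (sel-all ⟦ fms Γ ⟧ˢ (nm Γ) (length-nm Γ))

  nameCtx : ∀ Γ ν → length ν ≡ szs Γ → ∃ λ Γ̂ → fms Γ̂ ≡ Γ × nm Γ̂ ≡ ν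
  nameCtx []      []  eq = [] , refl , refl
  nameCtx (A ∷ Γ) ν   eq with ν₁ , ν₂ , refl , e₁ , e₂ ← split-length ν (szs Γ) (trans eq (List.length-++ ⟦ Γ ⟧ˢ))
    with Γ̂ , refl , refl ← nameCtx Γ ν₁ e₁ = nf A ν₂ e₂ ∷ Γ̂ , refl , refl

  fms-split : ∀ {Γ̂} Γ {Δ} → fms Γ̂ ≡ Γ ++ Δ → ∃₂ λ Γ₁ Γ₂ → Γ̂ ≡ Γ₁ ++ Γ₂ × fms Γ₁ ≡ Γ × fms Γ₂ ≡ Δ
  fms-split {Γ̂} [] eq = [] , Γ̂ , refl , refl , eq
  fms-split {a ∷ Γ̂} (A ∷ Γ) eq with refl , eq′ ← List.∷-injective eq
    with Γ₁ , Γ₂ , refl , refl , e ← fms-split {Γ̂} Γ eq′ = a ∷ Γ₁ , Γ₂ , refl , refl , e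

  -- Derivations of regular multiwords, with named instead of numbered vertices.
  data NDer : Ctx → Soup (Fin t) → Set where
    nresp : ∀ {Γ E F} → E ↭ F → NDer Γ E → NDer Γ F
    nperm : ∀ {Γ Δ E} → Γ ↭ Δ → NDer Γ E → NDer Δ E
    nid   : ∀ A α β {l l′} → NDer (nf (A ^⊥) β l′ ∷ nf A α l ∷ []) (links ⟦ A ⟧ α (reverse β))
    nlex  : ∀ {j Γ} → j ∈ Lex → cyc (Judgement.word j) ≡ [] → fms Γ ≡ Judgement.seq j →
            NDer Γ (rn (nm Γ) (reg (Judgement.word j)))
    npar  : ∀ {A B α β Γ E l l′ l″} → NDer (nf A α l ∷ nf B β l′ ∷ Γ) E → NDer (nf (A ⅋ B) (β ++ α) l″ ∷ Γ) E
    nten  : ∀ {A B α β Γ Δ E F l l′ l″} → NDer (nf A α l ∷ Γ) E → NDer (nf B β l′ ∷ Δ) F →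
            NDer (nf (A ⊗ B) (α ++ β) l″ ∷ Γ ++ Δ) (E ++ F)
    ncut  : ∀ {A α Γ Δ E F H l l′} → NDer (nf A α l ∷ Γ) E → NDer (nf (A ^⊥) (reverse α) l′ ∷ Δ) F →
            Unique (α ++ nm Γ ++ nm Δ) → Elim (E ++ F) α H → NDer (Γ ++ Δ) H

  MatchC : Ctx → Soup (Fin t) → Set
  MatchC Γ E = srcs E ↭ csel true Γ × tgts E ↭ csel false Γ

  sel-⊥ : ∀ b A α → length α ≡ sz A → sel b ⟦ A ^⊥ ⟧ (reverse α) ↭ sel (not b) ⟦ A ⟧ α
  sel-⊥ b A α l rewrite ⟦⟧-⊥ A = sel-ᵇ⊥ b ⟦ A ⟧ α l

  sel-⊥′ : ∀ b A β → length β ≡ sz (A ^⊥) → sel b ⟦ A ^⊥ ⟧ β ↭ sel (not b) ⟦ A ⟧ (reverse β)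
  sel-⊥′ b A β l = subst (λ z → sel b ⟦ A ^⊥ ⟧ z ↭ sel (not b) ⟦ A ⟧ (reverse β)) (List.reverse-involutive β)
    (sel-⊥ b A (reverse β) (trans (List.length-reverse β) (trans l (sz-⊥ A))))

  -- The endpoints of orientation `b` in the block of A and those in the dual block are
  -- complementary halves of `α`. Thus each cut vertex occurs once among the sources and once among
  -- the targets, as `Elim` requires.
  cut-csel : ∀ {A α Γ Δ l l′} {xs ys : List ℕ} b → xs ↭ csel b (nf A α l ∷ Γ) →
             ys ↭ csel b (nf (A ^⊥) (reverse α) l′ ∷ Δ) → xs ++ ys ↭ α ++ csel b (Γ ++ Δ)
  cut-csel {A} {α} {Γ} {Δ} {l} b p q = ↭-trans (++⁺ p (↭-trans q (++⁺ʳ (csel b Δ) (sel-⊥ b A α l))))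
    (↭-trans (solve 4 (λ a b c d → (a ⊕ b) ⊕ (c ⊕ d) ⊜ (a ⊕ c) ⊕ (b ⊕ d)) ↭-refl
        (sel b ⟦ A ⟧ α) (csel b Γ) (sel (not b) ⟦ A ⟧ α) (csel b Δ))
      (++⁺ (both b) (↭-reflexive (sym (List.concatMap-++ _ Γ Δ)))))
    where
    both : ∀ b → sel b ⟦ A ⟧ α ++ sel (not b) ⟦ A ⟧ α ↭ α
    both true  = sel-all ⟦ A ⟧ α l
    both false = ↭-trans (++-comm (sel false ⟦ A ⟧ α) _) (sel-all ⟦ A ⟧ α l)

  NDer⇒Match : ∀ {Γ E} → NDer Γ E → MatchC Γ E
  NDer⇒Match (nresp p d) with a , b ← NDer⇒Match d = ↭-trans (↭-sym (map⁺ esrc p)) a , ↭-trans (↭-sym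
      (map⁺ etgt p)) b
  NDer⇒Match (nperm p d) with a , b ← NDer⇒Match d = ↭-trans a (concatMap-↭ _ p) , ↭-trans b (concatMap-↭ _ p)
  NDer⇒Match (nid A α β {l} {l′}) =
      ↭-trans (links-srcs ⟦ A ⟧ α (reverse β) l lr) (go true)
    , ↭-trans (links-tgts ⟦ A ⟧ α (reverse β) l lr) (go false)
    where
    lr = trans (List.length-reverse β) (trans l′ (sz-⊥ A))
    go : ∀ b → sel b ⟦ A ⟧ α ++ sel (not b) ⟦ A ⟧ (reverse β) ↭ csel b (nf (A ^⊥) β l′ ∷ nf A α l ∷ [])
    go b = ↭-trans (++-comm (sel b ⟦ A ⟧ α) _)
      (++⁺ (↭-sym (sel-⊥′ b A β l′)) (↭-reflexive (sym (List.++-identityʳ _))))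
  NDer⇒Match (nlex {j} {Γ} j∈ c refl)
    with a , b ← Good⇒Match {X = ⟦ fms Γ ⟧ˢ} {nm Γ} (length-nm Γ)
        (IsMultiword⇒Good {X = ⟦ fms Γ ⟧ˢ} {Judgement.word j} (Judgement.isMW j)) =
    ↭-trans a (↭-sym (csel-sel true Γ)) , ↭-trans b (↭-sym (csel-sel false Γ))
  NDer⇒Match (npar {A} {B} {α} {β} {Γ} {l = l} {l′} d) with a , b ← NDer⇒Match d = ↭-trans a (go true) , ↭-trans b
      (go false)
    where
    go : ∀ b → sel b ⟦ A ⟧ α ++ sel b ⟦ B ⟧ β ++ csel b Γ ↭ sel b (⟦ B ⟧ ++ ⟦ A ⟧) (β ++ α) ++ csel b Γ
    go b rewrite sel-++ b ⟦ B ⟧ {⟦ A ⟧} β {α} l′ =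
      solve 3 (λ x y z → x ⊕ y ⊕ z ⊜ (y ⊕ x) ⊕ z) ↭-refl (sel b ⟦ A ⟧ α) (sel b ⟦ B ⟧ β) (csel b Γ)
  NDer⇒Match (nten {A} {B} {α} {β} {Γ} {Δ} {E} {F} {l} d d′) with a , b ← NDer⇒Match d | a′ , b′ ← NDer⇒Match d′ =
      ↭-trans (↭-reflexive (List.map-++ esrc E F)) (↭-trans (++⁺ a a′) (go true))
    , ↭-trans (↭-reflexive (List.map-++ etgt E F)) (↭-trans (++⁺ b b′) (go false))
    where
    go : ∀ b → (sel b ⟦ A ⟧ α ++ csel b Γ) ++ (sel b ⟦ B ⟧ β ++ csel b Δ) ↭ sel b (⟦ A ⟧ ++ ⟦ B ⟧)
        (α ++ β) ++ csel b (Γ ++ Δ)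
    go b rewrite sel-++ b ⟦ A ⟧ {⟦ B ⟧} α {β} l | List.concatMap-++ (λ a → sel b ⟦ fm a ⟧ (nms a)) Γ Δ =
      solve 4 (λ x y z u → (x ⊕ y) ⊕ (z ⊕ u) ⊜ (x ⊕ z) ⊕ (y ⊕ u)) ↭-refl (sel b ⟦ A ⟧ α) (csel b Γ) (sel b ⟦ B ⟧ β)
          (csel b Δ)
  NDer⇒Match (ncut {A} {α} {Γ} {Δ} {E} {F} {l = l} {l′} d d′ u k) with a , b ← NDer⇒Match d | a′ , b′ ← NDer⇒Match
      d′ =
      drop-++ α (↭-trans (↭-sym (Elim-srcs k)) (↭-trans (↭-reflexive (List.map-++ esrc E F))
          (cut-csel {A} {α} {Γ} {Δ} {l} {l′} true a a′)))
    , drop-++ α (↭-trans (↭-sym (Elim-tgts k)) (↭-trans (↭-reflexive (List.map-++ etgt E F))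
        (cut-csel {A} {α} {Γ} {Δ} {l} {l′} false b b′)))

  NDer⇒ends : ∀ {Γ E} → NDer Γ E → ends E ↭ nm Γ
  NDer⇒ends {Γ} d with a , b ← NDer⇒Match d = ↭-trans (++⁺ a b) (csel-all Γ)

  oriented : ∀ {Γ} {es : List (Edge t)} → Unique (nm Γ) → MatchC Γ (rn (nm Γ) es) →
             ∀ {e e′} → e ∈ es → e′ ∈ es → tgt e ≢ src e′
  oriented {Γ} u (p , q) e∈ e′∈ eq = Unique-disjoint (csel true Γ) (Unique-resp-↭ (↭-sym (csel-all Γ)) u)
    (∈-resp-↭ p (∈-map⁺ esrc (∈-map⁺ (named (nth (nm Γ))) e′∈)))
    (subst (λ z → nth (nm Γ) z ∈ csel false Γ) eq (∈-resp-↭ q (∈-map⁺ etgt (∈-map⁺ (named (nth (nm Γ))) e∈))))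

  nm-ex : ∀ Γ a b Δ → nm (Γ ++ a ∷ b ∷ Δ) ≡ nm Δ ++ nms b ++ nms a ++ nm Γ
  nm-ex Γ a b Δ = trans (nm-++ Γ _) (trans (List.++-assoc (nm Δ ++ nms b) (nms a) (nm Γ)) (List.++-assoc (nm Δ)
      (nms b) _))

  nm-ten : ∀ Γ Δ A B α β {l : length (α ++ β) ≡ sz (A ⊗ B)} → nm (Γ ++ nf (A ⊗ B)
      (α ++ β) l ∷ Δ) ≡ nm Δ ++ α ++ β ++ nm Γ
  nm-ten Γ Δ A B α β = trans (nm-++ Γ _) (trans (List.++-assoc (nm Δ) (α ++ β) (nm Γ)) (cong (nm Δ ++_)
      (List.++-assoc α β (nm Γ))))

  MatchC⇒Good : ∀ {Γ̂ Γ} {es : List (Edge t)} → fms Γ̂ ≡ Γ → nm Γ̂ ≡ range 1 (szs Γ) → MatchC Γ̂ (rn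
      (nm Γ̂) es) → Good ⟦ Γ ⟧ˢ es
  MatchC⇒Good {Γ̂} {Γ} {es} refl eq (p , q) = Match⇒Good {X = ⟦ Γ ⟧ˢ}
    (subst (λ ν → Match ⟦ fms Γ̂ ⟧ˢ ν (rn ν es)) eq (↭-trans p (csel-sel true Γ̂) , ↭-trans q (csel-sel false Γ̂)))

  mutual
    -- Renumbering and naming agree only on positions in range, so each rule needs the range of its
    -- premises. That is read off from the matching of the named premise under the names 1, 2, ...,
    -- whence the mutual induction.
    ⊩⇒NDer : ∀ {σ Γ} → _⊩_ G σ Γ → cyc σ ≡ [] → ∀ {Γ̂} → fms Γ̂ ≡ Γ → Unique (nm Γ̂) → NDer Γ̂ (rn (nm Γ̂) (reg σ))
    ⊩⇒NDer (idR A) c {nf _ β l′ ∷ nf _ α l ∷ []} refl u =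
      nresp (↭-reflexive (sym (rn-id ⟦ A ⟧ α β l (trans l′ (sz-⊥ A))))) (nid A α β)
    ⊩⇒NDer (lexR j∈) c eq u = nlex j∈ c eq
    ⊩⇒NDer (exR Γ A B Δ {σ} d) c eq u with fms-split Γ eq
    ... | Γ₁ , b@(nf _ β lb) ∷ a@(nf _ α la) ∷ Δ₁ , refl , refl , refl =
      nresp (↭-reflexive (trans (cong (λ ν → rn ν (reg σ)) (nm-ex Γ₁ a b Δ₁))
              (trans (sym (rn-ex (nm Δ₁) β α (nm Γ₁) (length-nm Δ₁) lb la (⊩⇒range d c)))
                (cong (λ ν → rn ν (renum _ (reg σ))) (sym (nm-ex Γ₁ b a Δ₁))))))
        (nperm p (⊩⇒NDer d c (List.map-++ fm Γ₁ _) (Unique-resp-↭ (nm-↭ (↭-sym p)) u)))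
      where
      p : Γ₁ ++ a ∷ b ∷ Δ₁ ↭ Γ₁ ++ b ∷ a ∷ Δ₁
      p = ++⁺ˡ Γ₁ (swap a b refl)
    ⊩⇒NDer (parR Γ A B {σ} d) c eq u with fms-split Γ eq
    ... | Γ₁ , nf _ ν l ∷ [] , refl , refl , refl
      with β , α , refl , lb , la ← split-length ν (sz B) (trans l (List.length-++ ⟦ B ⟧)) =
      nperm (++-comm [ _ ] Γ₁) (npar (nperm (++-comm Γ₁ _) (nresp (↭-reflexive (cong (λ ν → rn ν (reg σ)) eqn))
        (⊩⇒NDer d c {Γ₁ ++ nf A α la ∷ nf B β lb ∷ []} (List.map-++ fm Γ₁ _) (subst Unique (sym eqn) u)))))
      where
      eqn : nm (Γ₁ ++ nf A α la ∷ nf B β lb ∷ []) ≡ nm (Γ₁ ++ nf (A ⅋ B) (β ++ α) l ∷ [])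
      eqn = trans (nm-++ Γ₁ _) (sym (nm-++ Γ₁ _))
    ⊩⇒NDer (tenR Γ A B Δ {σ} {τ} d d′) c eq u with fms-split Γ eq
    ... | Γ₁ , nf _ ν l ∷ Δ₁ , refl , refl , refl
      with α , β , refl , la , lb ← split-length ν (sz A) (trans l (List.length-++ ⟦ A ⟧)) =
      nresp (↭-reflexive (trans (cong₂ _++_ (cong (λ ν → rn ν (reg σ)) (nm-++ Γ₁ _)) refl)
              (trans (sym (rn-tens (nm Δ₁) β α (nm Γ₁) {σ = σ} {τ} (length-nm Δ₁) lb la (⊩⇒range d cσ)
                             (subst (λ z → InRange z (reg τ)) (List.length-++ ⟦ fms Δ₁ ⟧ˢ {⟦ B ⟧})
                                 (⊩⇒range d′ cτ))))
                (cong (λ ν → rn ν (reg (tensMW G _ _ _ σ τ))) (sym (nm-ten Γ₁ Δ₁ A B α β {l}))))))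
        (nperm (↭-sym (shift _ Γ₁ Δ₁)) (nten
          (nperm (++-comm Γ₁ _) (⊩⇒NDer d cσ {Γ₁ ++ nf A α la ∷ []} (List.map-++ fm Γ₁ _)
            (Unique-++ʳ (nm Δ₁ ++ β) (Unique-resp-↭ (↭-trans (solve 4 (λ x y z w → x ⊕ y ⊕ z ⊕ w ⊜ (x ⊕ z) ⊕
                (y ⊕ w)) ↭-refl (nm Δ₁) α β (nm Γ₁))
               (++⁺ˡ (nm Δ₁ ++ β) (↭-reflexive (sym (nm-++ Γ₁ _))))) u′))))
          (⊩⇒NDer d′ cτ {nf B β lb ∷ Δ₁} refl
            (Unique-++ʳ (α ++ nm Γ₁) (Unique-resp-↭ (solve 4 (λ x y z w → x ⊕ y ⊕ z ⊕ w ⊜ (y ⊕ w) ⊕ (x ⊕ z)) ↭-refl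
                (nm Δ₁) α β (nm Γ₁)) u′)))))
      where
      cσ = List.++-conicalˡ (cyc σ) _ c
      cτ = List.++-conicalʳ (cyc σ) _ c
      u′ = subst Unique (nm-ten Γ₁ Δ₁ A B α β {l}) u
    ⊩⇒NDer (cutR Γ A Δ {σ} {τ} {ρ} d d′ gl) c eq u with fms-split Γ eq
    -- The names of the conclusion say nothing about the cut formula, whose block receives fresh
    -- names `ξ`.
    ... | Γ₁ , Δ₁ , refl , refl , refl with ξ , la , uξ ← fresh (nm (Γ₁ ++ Δ₁)) (sz A) u =
      subst (λ ν → NDer (Γ₁ ++ Δ₁) (rn ν (reg ρ))) (sym (nm-++ Γ₁ Δ₁))
        (ncut nσ nτ u′ (proj₁ (cut-correct ξ (nm Γ₁) (nm Δ₁) σ τ (csel true (Γ₁ ++ Δ₁)) (csel false (Γ₁ ++ Δ₁))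
          la (length-nm Γ₁) (length-nm Δ₁) u′
          (subst (λ z → InRange z (reg σ)) (trans (cong length (⟦⟧ˢ-++ (fms Γ₁) [ A ]))
              (List.length-++ ⟦ A ⟧ {⟦ fms Γ₁ ⟧ˢ})) (⊩⇒range d cσ))
          (subst (λ z → InRange z (reg τ)) (trans (List.length-++ ⟦ fms Δ₁ ⟧ˢ {⟦ A ^⊥ ⟧}) (cong (szs (fms Δ₁) +_)
              (sz-⊥ A))) (⊩⇒range d′ cτ))
          (oriented {Γ₁ ++ [ a ]} uσ (NDer⇒Match nσ₀)) (oriented {a⊥ ∷ Δ₁} uτ (NDer⇒Match nτ))
          (Unique-resp-↭ (++⁺ˡ ξ (↭-sym (csel-all (Γ₁ ++ Δ₁)))) uξ)
          (↭-trans (↭-reflexive (List.map-++ esrc (rn (ξ ++ nm Γ₁) (reg σ)) _))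
            (cut-csel {A} {ξ} {Γ₁} {Δ₁} {la} {len a⊥} true (proj₁ (NDer⇒Match nσ)) (proj₁ (NDer⇒Match nτ))))
          (↭-trans (↭-reflexive (List.map-++ etgt (rn (ξ ++ nm Γ₁) (reg σ)) _))
            (cut-csel {A} {ξ} {Γ₁} {Δ₁} {la} {len a⊥} false (proj₂ (NDer⇒Match nσ)) (proj₂ (NDer⇒Match nτ)))))
          gl c))
      where
      -- The cyclic words of both premises are kept in those of `ρ`, so the premises are regular as
      -- well.
      cσ : cyc σ ≡ []
      cσ = List.++-conicalˡ (cyc σ) _ (List.++-conicalˡ (cyc σ ++ cyc τ) _ (trans (sym
          (Glueing.Glue.cycword gl)) c))
      cτ : cyc τ ≡ []
      cτ = List.++-conicalʳ (cyc σ) _ (List.++-conicalˡ (cyc σ ++ cyc τ) _ (trans (sym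
          (Glueing.Glue.cycword gl)) c))
      a a⊥ : NF
      a = nf A ξ la
      a⊥ = nf (A ^⊥) (reverse ξ) (trans (List.length-reverse ξ) (trans la (sym (sz-⊥ A))))
      u′ : Unique (ξ ++ nm Γ₁ ++ nm Δ₁)
      u′ = Unique-resp-↭ (++⁺ˡ ξ (nm-++-↭ Γ₁ Δ₁)) uξ
      uσ : Unique (nm (Γ₁ ++ [ a ]))
      uσ = subst Unique (sym (nm-++ Γ₁ _)) (Unique-++ˡ (ξ ++ nm Γ₁) (subst Unique (sym (List.++-assoc ξ
          (nm Γ₁) _)) u′))
      uτ : Unique (nm (a⊥ ∷ Δ₁))
      uτ = Unique-++ʳ (nm Γ₁) (Unique-resp-↭ (↭-trans (solve 3 (λ x y z → x ⊕ y ⊕ z ⊜ y ⊕ z ⊕ x) ↭-refl ξ (nm Γ₁)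
          (nm Δ₁))
             (++⁺ˡ (nm Γ₁) (++⁺ˡ (nm Δ₁) (↭-sym (↭-reverse ξ))))) u′)
      nσ₀ : NDer (Γ₁ ++ [ a ]) (rn (nm (Γ₁ ++ [ a ])) (reg σ))
      nσ₀ = ⊩⇒NDer d cσ {Γ₁ ++ [ a ]} (List.map-++ fm Γ₁ _) uσ
      nσ : NDer (a ∷ Γ₁) (rn (ξ ++ nm Γ₁) (reg σ))
      nσ = subst (λ ν → NDer (a ∷ Γ₁) (rn ν (reg σ))) (nm-++ Γ₁ _) (nperm (++-comm Γ₁ _) nσ₀)
      nτ : NDer (a⊥ ∷ Δ₁) (rn (nm Δ₁ ++ reverse ξ) (reg τ))
      nτ = ⊩⇒NDer d′ cτ {a⊥ ∷ Δ₁} refl uτ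

    ⊩⇒Good : ∀ {σ Γ} → _⊩_ G σ Γ → cyc σ ≡ [] → Good ⟦ Γ ⟧ˢ (reg σ)
    ⊩⇒Good {Γ = Γ} d c = let Γ̂ , e₁ , e₂ = nameCtx Γ (range 1 (szs Γ)) (length-range 1 (szs Γ)) in
      MatchC⇒Good e₁ e₂ (NDer⇒Match (⊩⇒NDer d c {Γ̂} e₁ (subst Unique (sym e₂) (range-unique 1 (szs Γ)))))

    ⊩⇒range : ∀ {σ Γ} → _⊩_ G σ Γ → cyc σ ≡ [] → InRange (szs Γ) (reg σ)
    ⊩⇒range {Γ = Γ} d c = Good⇒InRange {X = ⟦ Γ ⟧ˢ} (⊩⇒Good d c)

-- Renaming as substitution and as glueing of identities.

sub : List ℕ → List ℕ → ℕ → ℕ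
sub []      _       z = z
sub (x ∷ ξ) []      z = z
sub (x ∷ ξ) (y ∷ α) z with z ≟ x
... | yes _ = y
... | no _  = sub ξ α z

sub-∉ : ∀ ξ α {z} → z ∉ ξ → sub ξ α z ≡ z
sub-∉ []      α       z∉ = refl
sub-∉ (x ∷ ξ) []      z∉ = refl
sub-∉ (x ∷ ξ) (y ∷ α) {z} z∉ with z ≟ x
... | yes eq = ⊥-elim (z∉ (here eq))
... | no _   = sub-∉ ξ α (z∉ ∘ there)

map-sub : ∀ ξ α → Unique ξ → length α ≡ length ξ → map (sub ξ α) ξ ≡ α
map-sub [] [] u eq = refl
map-sub (x ∷ ξ) (y ∷ α) u@(_ ∷ u′) eq = cong₂ _∷_ first
  (trans (List.map-cong-local (All.tabulate rest)) (map-sub ξ α u′ (ℕ.suc-injective eq)))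
  where
  first : sub (x ∷ ξ) (y ∷ α) x ≡ y
  first with x ≟ x
  ... | yes _ = refl
  ... | no ne = ⊥-elim (ne refl)
  rest : ∀ {z} → z ∈ ξ → sub (x ∷ ξ) (y ∷ α) z ≡ sub ξ α z
  rest {z} z∈ with z ≟ x
  ... | yes refl = ⊥-elim (Unique⇒∉ u z∈)
  ... | no _ = refl

map-fix : ∀ {h : ℕ → ℕ} xs → map h xs ≡ xs → ∀ {z} → z ∈ xs → h z ≡ z
map-fix (x ∷ xs) eq (here refl) = proj₁ (List.∷-injective eq)
map-fix (x ∷ xs) eq (there p)   = map-fix xs (proj₂ (List.∷-injective eq)) p

mapV-fix : ∀ {C} {f : ℕ → ℕ} (E : Soup C) → (∀ {z} → z ∈ ends E → f z ≡ z) → mapV f E ≡ E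
mapV-fix [] h = refl
mapV-fix (ed u w v ∷ E) h = cong₂ _∷_ (cong₂ (λ x y → ed x w y) (h (here refl)) (h (∈-++⁺ʳ (u ∷ srcs E)
    (here refl))))
  (mapV-fix E λ p → h (∈-resp-↭ (↭-sym (prep u (shift v (srcs E) (tgts E)))) (there (there p))))

mapV-∘ : ∀ {C} (f g : ℕ → ℕ) (E : Soup C) → mapV g (mapV f E) ≡ mapV (g ∘ f) E
mapV-∘ f g []             = refl
mapV-∘ f g (ed u w v ∷ E) = cong (_ ∷_) (mapV-∘ f g E)

srcs-mapV : ∀ {C} f (E : Soup C) → srcs (mapV f E) ≡ map f (srcs E)
srcs-mapV f []             = refl
srcs-mapV f (ed u w v ∷ E) = cong (_ ∷_) (srcs-mapV f E)

tgts-mapV : ∀ {C} f (E : Soup C) → tgts (mapV f E) ≡ map f (tgts E)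
tgts-mapV f []             = refl
tgts-mapV f (ed u w v ∷ E) = cong (_ ∷_) (tgts-mapV f E)

ends-mapV : ∀ {C} f (E : Soup C) → ends (mapV f E) ≡ map f (ends E)
ends-mapV f E = trans (cong₂ _++_ (srcs-mapV f E) (tgts-mapV f E)) (sym (List.map-++ f (srcs E) (tgts E)))

links-++ : ∀ {C} X Y α ξ {β ζ} → length α ≡ length X → length ξ ≡ length X →
           links {C} (X ++ Y) (α ++ β) (ξ ++ ζ) ≡ links X α ξ ++ links Y β ζ
links-++ []          Y []      []      p q = refl
links-++ (true ∷ X)  Y (x ∷ α) (y ∷ ξ) p q = cong (_ ∷_) (links-++ X Y α ξ (ℕ.suc-injective p) (ℕ.suc-injective q))
links-++ (false ∷ X) Y (x ∷ α) (y ∷ ξ) p q = cong (_ ∷_) (links-++ X Y α ξ (ℕ.suc-injective p) (ℕ.suc-injective q))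

-- Glueing an identity onto the block of vertices ξ renames this block.
Elim-links : ∀ {C} X α ξ (E : Soup C) S T (f : ℕ → ℕ) → length α ≡ length X → length ξ ≡ length X →
  map f ξ ≡ α → (∀ {z} → z ∈ α → f z ≡ z) → (∀ {z} → z ∈ S → f z ≡ z) → (∀ {z} → z ∈ T → f z ≡ z) →
  srcs E ↭ sel true X ξ ++ S → tgts E ↭ sel false X ξ ++ T → Elim (E ++ links X α ξ) ξ (mapV f E)
Elim-links [] [] [] E S T f _ _ _ _ fS fT ps pt = done (↭-reflexive (trans (List.++-identityʳ E)
  (sym (mapV-fix E λ {z} z∈ → fix z (∈-++⁻ (srcs E) z∈)))))
  where
  fix : ∀ z → z ∈ srcs E ⊎ z ∈ tgts E → f z ≡ z
  fix z (inj₁ p) = fS (∈-resp-↭ ps p)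
  fix z (inj₂ p) = fT (∈-resp-↭ pt p)
Elim-links (true ∷ X) (y ∷ α) (x ∷ ξ) E S T f la lξ eq fα fS fT ps pt
  with ed .x w v , e∈ , refl ← ∈-map⁻ esrc (∈-resp-↭ (↭-sym ps) (here refl))
  with R , p ← ∈⇒↭ e∈ =
  merge (↭-trans (++⁺ʳ (ed y [] x ∷ L) p)
          (solve 4 (λ a b c d → (a ⊕ b) ⊕ (c ⊕ d) ⊜ c ⊕ a ⊕ b ⊕ d) ↭-refl [ ed x w v ] R [ ed y [] x ] L))
    (Elim-respʳ (↭-trans (prep _ (↭-reflexive refl)) (↭-trans (↭-reflexive (cong (λ z → ed z w (f v) ∷ mapV f R)
        (trans (fα (here refl)) (sym (proj₁ eqs)))))
                  (↭-sym (map⁺ _ p))))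
      (Elim-links X α ξ (ed y w v ∷ R) (y ∷ S) T f (ℕ.suc-injective la) (ℕ.suc-injective lξ) (proj₂ eqs)
        (fα ∘ there) fS′ fT
        (↭-trans (prep y (drop-∷ (↭-trans (↭-sym (map⁺ esrc p)) ps))) (↭-sym (shift y (sel true X ξ) S)))
        (↭-trans (↭-sym (map⁺ etgt p)) pt)))
  where
  L = links X α ξ
  eqs = List.∷-injective eq
  fS′ : ∀ {z} → z ∈ y ∷ S → f z ≡ z
  fS′ (here refl) = fα (here refl)
  fS′ (there p)   = fS p
Elim-links (false ∷ X) (y ∷ α) (x ∷ ξ) E S T f la lξ eq fα fS fT ps pt
  with ed u w .x , e∈ , refl ← ∈-map⁻ etgt (∈-resp-↭ (↭-sym pt) (here refl))
  with R , p ← ∈⇒↭ e∈ =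
  merge (↭-trans (++⁺ʳ (ed x [] y ∷ L) p)
          (solve 4 (λ a b c d → (a ⊕ b) ⊕ (c ⊕ d) ⊜ a ⊕ c ⊕ b ⊕ d) ↭-refl [ ed u w x ] R [ ed x [] y ] L))
    (subst (λ l → Elim (ed u l y ∷ R ++ L) ξ (mapV f E)) (sym (List.++-identityʳ w))
    (Elim-respʳ (↭-trans (↭-reflexive (cong (λ z → ed (f u) w z ∷ mapV f R) (trans (fα (here refl)) (sym
        (proj₁ eqs)))))
                  (↭-sym (map⁺ _ p)))
      (Elim-links X α ξ (ed u w y ∷ R) S (y ∷ T) f (ℕ.suc-injective la) (ℕ.suc-injective lξ) (proj₂ eqs)
        (fα ∘ there) fS fT′
        (↭-trans (↭-sym (map⁺ esrc p)) ps)
        (↭-trans (prep y (drop-∷ (↭-trans (↭-sym (map⁺ etgt p)) pt))) (↭-sym (shift y (sel false X ξ) T))))))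
  where
  L = links X α ξ
  eqs = List.∷-injective eq
  fT′ : ∀ {z} → z ∈ y ∷ T → f z ≡ z
  fT′ (here refl) = fα (here refl)
  fT′ (there p)   = fT p

-- From named derivations back to derivations; reversibility of ⅋.

module Complete {t : ℕ} (G : LLG t) where
  open LLG G
  open Interp bnd
  open Cut G
  open Named G

  Der : Ctx → Soup (Fin t) → Set
  Der Γ E = ∃ λ σ → _⊩_ G σ (fms Γ) × cyc σ ≡ [] × rn (nm Γ) (reg σ) ↭ E

  der-ex : ∀ Γ a b Δ {E} → Der (Γ ++ a ∷ b ∷ Δ) E → Der (Γ ++ b ∷ a ∷ Δ) E
  der-ex Γ a b Δ (σ , d , c , p) =
    _ , subst (_⊩_ G _) (sym (List.map-++ fm Γ _)) (exR (fms Γ) (fm a) (fm b) (fms Δ) (subst (_⊩_ G σ)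
        (List.map-++ fm Γ _) d)) , c ,
    ↭-trans (↭-reflexive (trans (cong (λ ν → rn ν (renum _ (reg σ))) (nm-ex Γ b a Δ))
      (trans (rn-ex (nm Δ) (nms b) (nms a) (nm Γ) (length-nm Δ) (len b) (len a) (⊩⇒range d c))
        (cong (λ ν → rn ν (reg σ)) (sym (nm-ex Γ a b Δ)))))) p

  -- The prefix `Θ` collects the formulas already passed, as `exR` exchanges neighbours in the
  -- middle of a sequent.
  der-perm : ∀ Θ {Γ Δ E} → Γ ↭ Δ → Der (Θ ++ Γ) E → Der (Θ ++ Δ) E
  der-perm Θ refl d = d
  der-perm Θ {E = E} (prep {xs} {ys} x p) d = subst (λ Z → Der Z E) (List.++-assoc Θ [ x ] ys)
    (der-perm (Θ ++ [ x ]) p (subst (λ Z → Der Z E) (sym (List.++-assoc Θ [ x ] xs)) d))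
  der-perm Θ {E = E} (swap {xs} {ys} x y p) d = subst (λ Z → Der Z E) (List.++-assoc Θ (y ∷ x ∷ []) ys)
    (der-perm (Θ ++ y ∷ x ∷ []) p (subst (λ Z → Der Z E) (sym (List.++-assoc Θ (y ∷ x ∷ []) xs))
        (der-ex Θ x y xs d)))
  der-perm Θ (_↭_.trans p q) d = der-perm Θ q (der-perm Θ p d)

  NDer⇒Der : ∀ {Γ E} → NDer Γ E → Der Γ E
  NDer⇒Der (nresp p d) with σ , d′ , c , q ← NDer⇒Der d = σ , d′ , c , ↭-trans q p
  NDer⇒Der (nperm p d) = der-perm [] p (NDer⇒Der d)
  NDer⇒Der (nid A α β {l} {l′}) = _ , idR A , refl , ↭-reflexive (rn-id ⟦ A ⟧ α β l (trans l′ (sz-⊥ A)))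
  NDer⇒Der (nlex j∈ c eq) = _ , subst (_⊩_ G _) (sym eq) (lexR j∈) , c , refl
  NDer⇒Der (npar {A} {B} {α} {β} {Γ} {l = l} {l′} {l″} d)
    with σ , d′ , c , q ← der-perm [] (++-comm (nf A α l ∷ nf B β l′ ∷ []) Γ) (NDer⇒Der d) =
    der-perm [] (++-comm Γ [ nf (A ⅋ B) (β ++ α) l″ ]) (σ ,
      subst (_⊩_ G σ) (sym (List.map-++ fm Γ _)) (parR (fms Γ) A B (subst (_⊩_ G σ) (List.map-++ fm Γ _) d′)) , c ,
      ↭-trans (↭-reflexive (cong (λ ν → rn ν (reg σ)) (trans (nm-++ Γ _) (sym (nm-++ Γ _))))) q)
  NDer⇒Der (nten {A} {B} {α} {β} {Γ} {Δ} {l = l} {l′} {l″} d₁ d₂)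
    with σ , d , c , q ← der-perm [] (++-comm [ nf A α l ] Γ) (NDer⇒Der d₁)
       | τ , d′ , c′ , q′ ← NDer⇒Der d₂ =
    der-perm [] (shift (nf (A ⊗ B) (α ++ β) l″) Γ Δ) (_ ,
      subst (_⊩_ G _) (sym (List.map-++ fm Γ _)) (tenR (fms Γ) A B (fms Δ) (subst (_⊩_ G σ)
          (List.map-++ fm Γ _) d) d′) ,
      cong₂ _++_ c c′ ,
      ↭-trans (↭-reflexive (trans (cong (λ ν → rn ν (reg (tensMW G _ _ _ σ τ))) (nm-ten Γ Δ A B α β {l″}))
          (trans (rn-tens (nm Δ) β α (nm Γ) {σ = σ} {τ} (length-nm Δ) l′ l (⊩⇒range d c)
                             (subst (λ z → InRange z (reg τ)) (List.length-++ ⟦ fms Δ ⟧ˢ {⟦ B ⟧}) (⊩⇒range d′ c′)))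
            (cong₂ _++_ (cong (λ ν → rn ν (reg σ)) (sym (nm-++ Γ _))) refl))))
        (++⁺ q q′))
  NDer⇒Der (ncut {A} {α} {Γ} {Δ} {E} {F} {H} {l} {l′} d₁ d₂ u k)
    with σ , d , c , q ← der-perm [] (++-comm [ nf A α l ] Γ) (NDer⇒Der d₁)
       | τ , d′ , c′ , q′ ← NDer⇒Der d₂ =
    let ρ , gl , cρ , r = glued (Elim-respˡ (++⁺ qσ q′) k) in
    ρ , subst (_⊩_ G ρ) (sym (List.map-++ fm Γ Δ)) (cutR (fms Γ) A (fms Δ) dσ d′ gl) , trans cρ (cong₂ _++_ c c′) ,
      ↭-trans (↭-reflexive (cong (λ ν → rn ν (reg ρ)) (nm-++ Γ Δ))) r
    where
    dσ = subst (_⊩_ G σ) (List.map-++ fm Γ [ nf A α l ]) d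
    qσ : rn (α ++ nm Γ) (reg σ) ↭ E
    qσ = ↭-trans (↭-reflexive (cong (λ ν → rn ν (reg σ)) (sym (nm-++ Γ [ nf A α l ])))) q
    mσ : MatchC (nf A α l ∷ Γ) (rn (α ++ nm Γ) (reg σ))
    mσ = NDer⇒Match (nresp (↭-sym qσ) d₁)
    mτ : MatchC (nf (A ^⊥) (reverse α) l′ ∷ Δ) (rn (nm Δ ++ reverse α) (reg τ))
    mτ = NDer⇒Match (nresp (↭-sym q′) d₂)
    uσ : Unique (nm (Γ ++ [ nf A α l ]))
    uσ = subst Unique (sym (nm-++ Γ _)) (Unique-++ˡ (α ++ nm Γ) (subst Unique (sym (List.++-assoc α (nm Γ) _)) u))
    uτ : Unique (nm Δ ++ reverse α)
    uτ = Unique-++ʳ (nm Γ) (Unique-resp-↭ (↭-trans (solve 3 (λ x y z → x ⊕ y ⊕ z ⊜ y ⊕ z ⊕ x) ↭-refl α (nm Γ)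
        (nm Δ))
           (++⁺ˡ (nm Γ) (++⁺ˡ (nm Δ) (↭-sym (↭-reverse α))))) u)
    glued = proj₂ (cut-correct α (nm Γ) (nm Δ) σ τ (csel true (Γ ++ Δ)) (csel false (Γ ++ Δ)) l (length-nm Γ)
        (length-nm Δ) u
      (subst (λ z → InRange z (reg σ)) (trans (cong length (⟦⟧ˢ-++ (fms Γ) [ A ]))
          (List.length-++ ⟦ A ⟧ {⟦ fms Γ ⟧ˢ})) (⊩⇒range dσ c))
      (subst (λ z → InRange z (reg τ)) (trans (List.length-++ ⟦ fms Δ ⟧ˢ {⟦ A ^⊥ ⟧}) (cong (szs (fms Δ) +_)
          (sz-⊥ A))) (⊩⇒range d′ c′))
      (oriented {Γ ++ [ nf A α l ]} uσ (NDer⇒Match (nperm (++-comm [ nf A α l ] Γ) (nresp (↭-sym q) d₁))))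
      (oriented {nf (A ^⊥) (reverse α) l′ ∷ Δ} uτ mτ)
      (Unique-resp-↭ (++⁺ˡ α (↭-trans (↭-sym (nm-++-↭ Γ Δ)) (↭-sym (csel-all (Γ ++ Δ))))) u)
      (↭-trans (↭-reflexive (List.map-++ esrc (rn (α ++ nm Γ) (reg σ)) _)) (cut-csel {A} {α} {Γ} {Δ} {l} {l′} true
          (proj₁ mσ) (proj₁ mτ)))
      (↭-trans (↭-reflexive (List.map-++ etgt (rn (α ++ nm Γ) (reg σ)) _)) (cut-csel {A} {α} {Γ} {Δ} {l} {l′} false
          (proj₂ mσ) (proj₂ mτ))))

  nf-cong : ∀ {A μ ν} {l : length μ ≡ sz A} {l′ : length ν ≡ sz A} → μ ≡ ν → nf A μ l ≡ nf A ν l′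
  nf-cong {l = l} {l′} refl = cong (nf _ _) (ℕ.≡-irrelevant l l′)

  -- A cut against links only renames. `Ψ` may be any context on the names `α`: for `Ψ` consisting
  -- of A this is renaming, and `nunpar` takes the two components of a ⅋ instead.
  relabel : ∀ {A ξ Γ E l Ψ l′ L} α → NDer (nf A ξ l ∷ Γ) E → NDer (nf (A ^⊥) (reverse ξ) l′ ∷ Ψ) L →
            L ↭ links ⟦ A ⟧ α ξ → length α ≡ sz A → nm Ψ ↭ α → Unique (α ++ ξ ++ nm Γ) →
            NDer (Γ ++ Ψ) (mapV (sub ξ α) E)
  relabel {A} {ξ} {Γ} {E} {l} {Ψ} α d d′ p la q u =
    ncut d d′ (Unique-resp-↭ (↭-trans (solve 3 (λ x y z → x ⊕ y ⊕ z ⊜ y ⊕ z ⊕ x) ↭-refl α ξ (nm Γ)) (++⁺ˡ ξ (++⁺ˡ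
        (nm Γ) (↭-sym q)))) u)
      (Elim-respˡ (++⁺ˡ E p) (Elim-links ⟦ A ⟧ α ξ E (csel true Γ) (csel false Γ) (sub ξ α) la l
        (map-sub ξ α (Unique-++ˡ ξ uξ) (trans la (sym l)))
        (λ z∈ → sub-∉ ξ α λ z∈ξ → Unique-disjoint α u z∈ (∈-++⁺ˡ z∈ξ))
        (λ z∈ → other (∈-++⁺ˡ z∈)) (λ z∈ → other (∈-++⁺ʳ (csel true Γ) z∈))
        (proj₁ (NDer⇒Match d)) (proj₂ (NDer⇒Match d))))
    where
    uξ = Unique-++ʳ α u
    other : ∀ {z} → z ∈ csel true Γ ++ csel false Γ → sub ξ α z ≡ z
    other z∈ = sub-∉ ξ α λ z∈ξ → Unique-disjoint ξ uξ z∈ξ (∈-resp-↭ (csel-all Γ) z∈)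

  -- Reversibility of ⅋: rename the block of A ⅋ B to fresh vertices, then cut against A^⊥ ⊗ B^⊥, A, B.
  nunpar : ∀ {A B α β Γ E l l₁ l₂} → Unique (nm Γ ++ β ++ α) → NDer (nf (A ⅋ B) (β ++ α) l ∷ Γ) E →
           NDer (nf A α l₁ ∷ nf B β l₂ ∷ Γ) E
  nunpar {A} {B} {α} {β} {Γ} {E} {l} {l₁} {l₂} u d
    with ξ , lξ , uξ ← fresh (nm Γ ++ β ++ α) (sz (A ⅋ B)) u
    with β′ , α′ , refl , lβ′ , lα′ ← split-length ξ (sz B) (trans lξ (List.length-++ ⟦ B ⟧)) =
    nperm (++-comm Γ _) (nresp (↭-reflexive (trans (mapV-∘ _ _ E) (mapV-fix E back))) (relabel (β ++ α) d₁ d₂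
      (↭-trans (↭-reflexive (cong₂ (λ x y → links ⟦ A ⟧ α x ++ links ⟦ B ⟧ β y) (List.reverse-involutive α′)
          (List.reverse-involutive β′)))
        (↭-trans (++-comm (links ⟦ A ⟧ α α′) _) (↭-reflexive (sym (links-++ ⟦ B ⟧ ⟦ A ⟧ β β′ l₂ lβ′)))))
      l refl
      (Unique-resp-↭ (solve 3 (λ x y z → x ⊕ y ⊕ z ⊜ z ⊕ x ⊕ y) ↭-refl ξ (nm Γ) (β ++ α)) uξ)))
    where
    uc : Unique (β ++ α)
    uc = Unique-++ʳ (nm Γ) u
    l⊥ : length (reverse (β ++ α)) ≡ sz ((A ⅋ B) ^⊥)
    l⊥ = trans (List.length-reverse (β ++ α)) (trans l (sym (sz-⊥ (A ⅋ B))))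
    d₁ : NDer (nf (A ⅋ B) ξ lξ ∷ Γ) (mapV (sub (β ++ α) ξ) E)
    d₁ = nperm (++-comm Γ _) (relabel ξ d (nid (A ⅋ B) ξ (reverse (β ++ α)) {lξ} {l⊥})
      (↭-reflexive (cong (links ⟦ A ⅋ B ⟧ ξ) (List.reverse-involutive (β ++ α)))) lξ refl
      (Unique-resp-↭ (++⁺ˡ ξ (++-comm (nm Γ) (β ++ α))) uξ))
    rα : length (reverse α′) ≡ sz (A ^⊥)
    rα = trans (List.length-reverse α′) (trans lα′ (sym (sz-⊥ A)))
    rβ : length (reverse β′) ≡ sz (B ^⊥)
    rβ = trans (List.length-reverse β′) (trans lβ′ (sym (sz-⊥ B)))
    rξ : length (reverse ξ) ≡ sz ((A ⅋ B) ^⊥)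
    rξ = trans (List.length-reverse ξ) (trans lξ (sym (sz-⊥ (A ⅋ B))))
    d₂ : NDer (nf ((A ⅋ B) ^⊥) (reverse ξ) rξ ∷ nf A α l₁ ∷ nf B β l₂ ∷ [])
              (links ⟦ A ⟧ α (reverse (reverse α′)) ++ links ⟦ B ⟧ β (reverse (reverse β′)))
    d₂ = subst (λ a → NDer (a ∷ nf A α l₁ ∷ nf B β l₂ ∷ []) (links ⟦ A ⟧ α (reverse (reverse α′)) ++ links ⟦ B ⟧ β
        (reverse (reverse β′)))) (nf-cong {l = trans (cong length (sym (List.reverse-++ β′ α′))) rξ} (sym
        (List.reverse-++ β′ α′)))
           (nten (nid A α (reverse α′) {l₁} {rα}) (nid B β (reverse β′) {l₂} {rβ}))
    back : ∀ {z} → z ∈ ends E → sub ξ (β ++ α) (sub (β ++ α) ξ z) ≡ z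
    back {z} z∈ with ∈-++⁻ (nm Γ) (∈-resp-↭ (NDer⇒ends d) z∈)
    ... | inj₁ p rewrite sub-∉ (β ++ α) ξ (λ q → Unique-disjoint (nm Γ) u p q) =
      sub-∉ ξ (β ++ α) λ q → Unique-disjoint ξ uξ q (∈-++⁺ˡ p)
    ... | inj₂ p = map-fix (β ++ α) (trans (List.map-∘ (β ++ α))
      (trans (cong (map (sub ξ (β ++ α))) (map-sub (β ++ α) ξ uc (trans lξ (sym l))))
        (map-sub ξ (β ++ α) (Unique-++ˡ ξ uξ) (trans l (sym lξ))))) p

  -- Unfolds ⅋, the reversible connective, and stops at a tensor. Without tensors only literals
  -- remain.
  flat : ∀ A (ν : List ℕ) → length ν ≡ sz A → Ctx
  flat (pos P) ν l = [ nf (pos P) ν l ]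
  flat (neg P) ν l = [ nf (neg P) ν l ]
  flat (A ⊗ B) ν l = [ nf (A ⊗ B) ν l ]
  flat (A ⅋ B) ν l = let β , α , _ , lβ , lα = split-length ν (sz B) (trans l (List.length-++ ⟦ B ⟧))
                     in flat A α lα ++ flat B β lβ

  flatC : Ctx → Ctx
  flatC = concatMap λ a → flat (fm a) (nms a) (len a)

  nm-flat : ∀ A ν l → nm (flat A ν l) ≡ ν
  nm-flat (pos P) ν l = refl
  nm-flat (neg P) ν l = refl
  nm-flat (A ⊗ B) ν l = refl
  nm-flat (A ⅋ B) ν l = let β , α , eq , lβ , lα = split-length ν (sz B) (trans l (List.length-++ ⟦ B ⟧))
    in trans (nm-++ (flat A α lα) (flat B β lβ)) (trans (cong₂ _++_ (nm-flat B β lβ) (nm-flat A α lα)) (sym eq))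

  nm-flatC : ∀ Γ → nm (flatC Γ) ≡ nm Γ
  nm-flatC []      = refl
  nm-flatC (a ∷ Γ) = trans (nm-++ (flat (fm a) (nms a) (len a)) (flatC Γ)) (cong₂ _++_ (nm-flatC Γ) (nm-flat (fm a)
      (nms a) (len a)))

  flat-der : ∀ A ν l {Γ E} → Unique (nm Γ ++ ν) → NDer (nf A ν l ∷ Γ) E → NDer (flat A ν l ++ Γ) E
  flat-der (pos P) ν l u d = d
  flat-der (neg P) ν l u d = d
  flat-der (A ⊗ B) ν l u d = d
  flat-der (A ⅋ B) ν l {Γ} {E} u d with split-length ν (sz B) (trans l (List.length-++ ⟦ B ⟧))
  ... | β , α , refl , lβ , lα =
    subst (λ Z → NDer Z E) (sym (List.++-assoc (flat A α lα) (flat B β lβ) Γ))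
      (nperm (shifts (flat B β lβ) (flat A α lα)) (flat-der B β lβ
        (Unique-resp-↭ (↭-trans (solve 3 (λ x y z → x ⊕ y ⊕ z ⊜ (x ⊕ z) ⊕ y) ↭-refl (nm Γ) β α)
          (++⁺ʳ β (↭-reflexive (sym (trans (nm-++ (flat A α lα) Γ) (cong (nm Γ ++_) (nm-flat A α lα))))))) u)
        (nperm (shift _ (flat A α lα) Γ) (flat-der A α lα (subst Unique (sym (List.++-assoc (nm Γ) β α)) u)
          (nunpar u d)))))

  flatC-der : ∀ Γ Θ {E} → Unique (nm (Γ ++ Θ)) → NDer (Γ ++ Θ) E → NDer (flatC Γ ++ Θ) E
  flatC-der [] Θ u d = d
  flatC-der (a ∷ Γ) Θ {E} u d = subst (λ Z → NDer Z E) (sym (List.++-assoc (flat (fm a) (nms a) (len a))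
      (flatC Γ) Θ))
    (nperm (shifts (flatC Γ) (flat (fm a) (nms a) (len a))) (flatC-der Γ (flat (fm a) (nms a) (len a) ++ Θ)
      (Unique-resp-↭ (↭-trans (nm-↭ (↭-sym (shift a Γ Θ))) (↭-trans (nm-++-↭ Γ (a ∷ Θ))
          (↭-trans (++⁺ˡ (nm Γ) (↭-reflexive (sym (trans (nm-++ (flat (fm a) (nms a) (len a)) Θ) (cong (nm Θ ++_)
              (nm-flat (fm a) (nms a) (len a)))))))
            (↭-sym (nm-++-↭ Γ _))))) u)
      (nperm (shifts (flat (fm a) (nms a) (len a)) Γ) (flat-der (fm a) (nms a) (len a) u d))))

-- Soundness of the double glueing interpretation

++-injective : ∀ {A : Set}
    (as bs : List A) {cs ds} → length as ≡ length bs → as ++ cs ≡ bs ++ ds → as ≡ bs × cs ≡ ds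
++-injective []       []       l eq = refl , eq
++-injective (a ∷ as) (b ∷ bs) l eq with refl , eq′ ← List.∷-injective eq
  with refl , r ← ++-injective as bs (ℕ.suc-injective l) eq′ = refl , r

Elim-ends-cut : ∀ {C} {E F H : Soup C} {ν₁ ν₂ xs} → ends E ↭ ν₂ ++ ν₁ → ends F ↭ ν₁ → xs ↭ ν₁ →
                Elim (E ++ F) xs H → ends H ↭ ν₂
Elim-ends-cut {E = E} {F} {H} {ν₁} {ν₂} {xs} p q r k = drop-++ xs (drop-++ xs
  (↭-trans (↭-sym (Elim-ends k)) (↭-trans (ends-++ E F) (↭-trans (++⁺ p q)
    (↭-trans (solve 2 (λ x y → (y ⊕ x) ⊕ x ⊜ x ⊕ x ⊕ y) ↭-refl ν₁ ν₂) (++⁺ (↭-sym r) (++⁺ʳ ν₂ (↭-sym r))))))))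

-- `Elim-split` after a rearrangement; `zs` is any list disjoint from `xs` that contains the
-- vertices of `F`. All soundness proofs below decompose one big elimination in this way.
peel : ∀ {C} {E₀ H : Soup C} {ns} E F xs {ys zs} → Elim E₀ ns H → E₀ ↭ E ++ F → ns ↭ xs ++ ys →
       Unique (xs ++ zs) → (∀ {z} → z ∈ ends F → z ∈ zs) → ∃ λ H′ → Elim E xs H′ × Elim (H′ ++ F) ys H
peel E F xs k p q u sub = Elim-split E xs (All.tabulate λ x∈ x∈F → Unique-disjoint xs u x∈ (sub x∈F))
  (Elim-respˡ (↭-sym p) (Elim-perm q k))

⊆-++ : ∀ {A : Set} (xs : List A) {ys zs} → (∀ {z} → z ∈ xs → z ∈ zs) → (∀ {z} → z ∈ ys → z ∈ zs) →
       ∀ {z} → z ∈ xs ++ ys → z ∈ zs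
⊆-++ xs f g z∈ with ∈-++⁻ xs z∈
... | inj₁ p = f p
... | inj₂ p = g p

ends-⊆ : ∀ {C} (E F : Soup C) {zs} → (∀ {z} → z ∈ ends E → z ∈ zs) → (∀ {z} → z ∈ ends F → z ∈ zs) →
         ∀ {z} → z ∈ ends (E ++ F) → z ∈ zs
ends-⊆ E F f g z∈ = ⊆-++ (ends E) f g (∈-resp-↭ (ends-++ E F) z∈)

links-not : ∀ {C} X α β → links {C} X α β ≡ links (map not X) β α
links-not []          []      []      = refl
links-not []          []      (_ ∷ _) = refl
links-not []          (_ ∷ _) _       = refl
links-not (true ∷ X)  []      []      = refl
links-not (true ∷ X)  []      (_ ∷ _) = refl
links-not (true ∷ X)  (_ ∷ _) []      = refl
links-not (true ∷ X)  (x ∷ α) (y ∷ β) = cong (_ ∷_) (links-not X α β)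
links-not (false ∷ X) []      []      = refl
links-not (false ∷ X) []      (_ ∷ _) = refl
links-not (false ∷ X) (_ ∷ _) []      = refl
links-not (false ∷ X) (x ∷ α) (y ∷ β) = cong (_ ∷_) (links-not X α β)

⊆-↭ : ∀ {A : Set} (xs : List A) {ys} → Unique xs → (∀ {z} → z ∈ xs → z ∈ ys) → ∃ λ zs → ys ↭ xs ++ zs
⊆-↭ [] {ys} u f = ys , refl
⊆-↭ (x ∷ xs) {ys} u@(_ ∷ u′) f =
  let ys′ , p = ∈⇒↭ (f (here refl))
      zs , q = ⊆-↭ xs u′ (λ z∈ → strip z∈ (∈-resp-↭ p (f (there z∈))))
  in zs , ↭-trans p (prep x q)
  where
  strip : ∀ {z ys′} → z ∈ xs → z ∈ x ∷ ys′ → z ∈ ys′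
  strip z∈ (here refl) = ⊥-elim (Unique⇒∉ u z∈)
  strip z∈ (there q)   = q

sel-unique : ∀ b X ν → length ν ≡ length X → Unique ν → Unique (sel b X ν)
sel-unique true  X ν l u = Unique-++ˡ _ (Unique-resp-↭ (↭-sym (sel-all X ν l)) u)
sel-unique false X ν l u = Unique-++ʳ (sel true X ν) (Unique-resp-↭ (↭-sym (sel-all X ν l)) u)

-- That the elimination succeeds forces F to be oriented as prescribed by X.
Elim-links⁻ : ∀ {C} X α ξ (F : Soup C) {H} → length α ≡ length X → length ξ ≡ length X → Unique (α ++ ξ) →
              ends F ↭ ξ → Elim (F ++ links X α ξ) ξ H → H ↭ mapV (sub ξ α) F
Elim-links⁻ X α ξ F {H} la lξ u pF k =
  Elim-deterministic usrc utgt k (Elim-links X α ξ F [] [] (sub ξ α) la lξ (map-sub ξ α uξ (trans la (sym lξ)))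
    (λ z∈ → sub-∉ ξ α (Unique-disjoint α u z∈)) (λ ()) (λ ())
    (↭-trans srcF (↭-sym (++-identityʳ _))) (↭-trans tgtF (↭-sym (++-identityʳ _))))
  where
  uξ = Unique-++ʳ α u
  L = links X α ξ
  balance : ∀ {b} {xs ys : List ℕ} → xs ++ sel b X α ++ sel (not b) X ξ ↭ ξ ++ ys → sel b X ξ ++ sel
      (not b) X ξ ↭ ξ →
            xs ++ sel b X α ↭ sel b X ξ ++ ys
  balance {b} {xs} {ys} p q = drop-++ (sel (not b) X ξ)
    (↭-trans (solve 3 (λ x y z → z ⊕ x ⊕ y ⊜ x ⊕ y ⊕ z) ↭-refl xs (sel b X α) (sel (not b) X ξ))
      (↭-trans p (↭-trans (++⁺ʳ ys (↭-sym q))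
        (solve 3 (λ x y z → (x ⊕ z) ⊕ y ⊜ z ⊕ x ⊕ y) ↭-refl (sel b X ξ) ys (sel (not b) X ξ)))))
  within : ∀ {b} {xs ys : List ℕ} → xs ++ sel b X α ↭ sel b X ξ ++ ys → ∀ {z} → z ∈ sel b X ξ → z ∈ xs
  within {b} {xs} p z∈ with ∈-++⁻ xs (∈-resp-↭ (↭-sym p) (∈-++⁺ˡ z∈))
  ... | inj₁ q = q
  ... | inj₂ q = ⊥-elim (Unique-disjoint α u (sel-⊆ b X α q) (sel-⊆ b X ξ z∈))
  all = sel-all X ξ lξ
  S′ : ∃ λ S → srcs F ↭ sel true X ξ ++ S
  S′ = ⊆-↭ _ (sel-unique true X ξ lξ uξ) (within {true} (balance {true} (↭-trans (++⁺ˡ (srcs F) (↭-sym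
      (links-srcs X α ξ la lξ)))
         (↭-trans (↭-reflexive (sym (List.map-++ esrc F L))) (Elim-srcs k))) all))
  T′ : ∃ λ T → tgts F ↭ sel false X ξ ++ T
  T′ = ⊆-↭ _ (sel-unique false X ξ lξ uξ) (within {false} (balance {false} (↭-trans (++⁺ˡ (tgts F) (↭-sym
      (links-tgts X α ξ la lξ)))
         (↭-trans (↭-reflexive (sym (List.map-++ etgt F L))) (Elim-tgts k))) (↭-trans (++-comm
             (sel false X ξ) _) all)))
  nil : proj₁ S′ ++ proj₁ T′ ≡ []
  nil = ↭-empty-inv (drop-++ ξ (↭-trans (++⁺ʳ _ (↭-sym all)) (↭-trans
    (solve 4 (λ a b c d → (a ⊕ b) ⊕ (c ⊕ d) ⊜ (a ⊕ c) ⊕ (b ⊕ d)) ↭-refl (sel true X ξ) (sel false X ξ) (proj₁ S′)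
        (proj₁ T′))
    (↭-trans (↭-sym (++⁺ (proj₂ S′) (proj₂ T′))) (↭-trans pF (↭-sym (++-identityʳ ξ)))))))
  srcF : srcs F ↭ sel true X ξ
  srcF = ↭-trans (proj₂ S′) (↭-trans (++⁺ˡ _ (↭-reflexive (List.++-conicalˡ (proj₁ S′) _ nil))) (++-identityʳ _))
  tgtF : tgts F ↭ sel false X ξ
  tgtF = ↭-trans (proj₂ T′) (↭-trans (++⁺ˡ _ (↭-reflexive (List.++-conicalʳ (proj₁ S′) _ nil))) (++-identityʳ _))
  uα : ∀ b → Unique (ξ ++ sel b X α)
  uα b = Uniq.++⁺ uξ (sel-unique b X α la (Unique-++ˡ α u)) λ { (p , q) → Unique-disjoint α u (sel-⊆ b X α q) p }
  usrc : Unique (srcs (F ++ L))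
  usrc = Unique-resp-↭ (↭-sym (↭-trans (↭-reflexive (List.map-++ esrc F L)) (↭-trans (++⁺ srcF
      (links-srcs X α ξ la lξ))
    (↭-trans (solve 3 (λ a b c → a ⊕ b ⊕ c ⊜ (a ⊕ c) ⊕ b) ↭-refl (sel true X ξ) (sel true X α) (sel false X ξ))
        (++⁺ʳ _ all))))) (uα true)
  utgt : Unique (tgts (F ++ L))
  utgt = Unique-resp-↭ (↭-sym (↭-trans (↭-reflexive (List.map-++ etgt F L)) (↭-trans (++⁺ tgtF
      (links-tgts X α ξ la lξ))
    (↭-trans (solve 3 (λ a b c → a ⊕ b ⊕ c ⊜ (c ⊕ a) ⊕ b) ↭-refl (sel false X ξ) (sel false X α) (sel true X ξ))
        (++⁺ʳ _ all))))) (uα false)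

-- Values, covalues and the soundness of the rules.

module Semantics {t : ℕ} (G : LLG t)
  (D : Bool → Fin (LLG.n G) → List ℕ → Soup (Fin t) → Set)
  (D-resp : ∀ {b P ν E F} → E ↭ F → D b P ν E → D b P ν F)
  (D-ends : ∀ {b P ν E} → D b P ν E → ends E ↭ ν)
  (D-rename : ∀ {b P ν E} f → D b P ν E → D b P (map f ν) (mapV f E)) where
  open LLG G
  open Interp bnd
  open Named G
  open Complete G

  Pr : Set₁
  Pr = List ℕ → Soup (Fin t) → Set

  Tens : ℕ → Pr → Pr → Pr
  Tens a p q ν E = ∃₂ λ ν₁ ν₂ → ∃₂ λ E₁ E₂ → ν ≡ ν₁ ++ ν₂ × length ν₁ ≡ a × E ↭ E₁ ++ E₂ × p ν₁ E₁ × q ν₂ E₂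

  -- A tested block is read in the order of the dual formula, hence `reverse`. The splitting of ν is
  -- quantified over, but the lengths leave at most one. A test whose glueing closes a cycle has no
  -- `Elim` and imposes nothing.
  Par : ℕ → ℕ → (pv qv pc qc : Pr) → Pr
  Par a b pv qv pc qc ν E = ends E ↭ ν × (∀ {ν₁ ν₂} → ν ≡ ν₂ ++ ν₁ → length ν₁ ≡ a → length ν₂ ≡ b →
    (∀ {F H} → pc (reverse ν₁) F → Elim (E ++ F) ν₁ H → qv ν₂ H) ×
    (∀ {F H} → qc (reverse ν₂) F → Elim (E ++ F) ν₂ H → pv ν₁ H))

  -- V A are the values and C A the covalues of A; ν lists the vertices in the order of ⟦ A ⟧ and of ⟦ A ^⊥ ⟧ respectively.
  mutual
    V : Formula n → Pr
    V (pos P) = D true P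
    V (neg P) = D false P
    V (A ⊗ B) = Tens (sz A) (V A) (V B)
    V (A ⅋ B) = Par (sz A) (sz B) (V A) (V B) (C A) (C B)

    C : Formula n → Pr
    C (pos P) = D false P
    C (neg P) = D true P
    C (A ⊗ B) = Par (sz A) (sz B) (C A) (C B) (V A) (V B)
    C (A ⅋ B) = Tens (sz A) (C A) (C B)

  mutual
    V-⊥ : ∀ A → V (A ^⊥) ≡ C A
    V-⊥ (pos P) = refl
    V-⊥ (neg P) = refl
    V-⊥ (A ⊗ B) rewrite sz-⊥ A | sz-⊥ B | V-⊥ A | V-⊥ B | C-⊥ A | C-⊥ B = refl
    V-⊥ (A ⅋ B) rewrite sz-⊥ A | V-⊥ A | V-⊥ B = refl

    C-⊥ : ∀ A → C (A ^⊥) ≡ V A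
    C-⊥ (pos P) = refl
    C-⊥ (neg P) = refl
    C-⊥ (A ⊗ B) rewrite sz-⊥ A | C-⊥ A | C-⊥ B = refl
    C-⊥ (A ⅋ B) rewrite sz-⊥ A | sz-⊥ B | V-⊥ A | V-⊥ B | C-⊥ A | C-⊥ B = refl

  Tens-ends : ∀ {a p q} → (∀ {ν E} → p ν E → ends E ↭ ν) → (∀ {ν E} → q ν E → ends E ↭ ν) →
              ∀ {ν E} → Tens a p q ν E → ends E ↭ ν
  Tens-ends f g (ν₁ , ν₂ , E₁ , E₂ , refl , _ , p , x , y) = ↭-trans (ends-↭ p) (↭-trans (ends-++ E₁ E₂) (++⁺ (f x)
      (g y)))

  mutual
    V-ends : ∀ A {ν E} → V A ν E → ends E ↭ ν
    V-ends (pos P) = D-ends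
    V-ends (neg P) = D-ends
    V-ends (A ⊗ B) = Tens-ends (V-ends A) (V-ends B)
    V-ends (A ⅋ B) = proj₁

    C-ends : ∀ A {ν E} → C A ν E → ends E ↭ ν
    C-ends (pos P) = D-ends
    C-ends (neg P) = D-ends
    C-ends (A ⊗ B) = proj₁
    C-ends (A ⅋ B) = Tens-ends (C-ends A) (C-ends B)

  -- `Par` is contravariant in the covalues, so a test of the renamed soup must be pulled back; this
  -- is why a renaming comes with a left inverse `g` on ν.
  Resp Rename : Pr → Set
  Resp p = ∀ {ν E F} → E ↭ F → p ν E → p ν F
  Rename p = ∀ {ν E} (f g : ℕ → ℕ) → (∀ {z} → z ∈ ν → g (f z) ≡ z) → p ν E → p (map f ν) (mapV f E)

  Tens-resp : ∀ {a p q} → Resp (Tens a p q)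
  Tens-resp r (ν₁ , ν₂ , E₁ , E₂ , eq , l , p , x , y) = ν₁ , ν₂ , E₁ , E₂ , eq , l , ↭-trans (↭-sym r) p , x , y

  Par-resp : ∀ {a b pv qv pc qc} → Resp (Par a b pv qv pc qc)
  Par-resp r (e , h) = ↭-trans (↭-sym (ends-↭ r)) e , λ eq l l′ → let h₁ , h₂ = h eq l l′ in
    (λ {F} c k → h₁ c (Elim-respˡ (++⁺ʳ F r) k)) , (λ {F} c k → h₂ c (Elim-respˡ (++⁺ʳ F r) k))

  V-resp : ∀ A → Resp (V A)
  V-resp (pos P) = D-resp
  V-resp (neg P) = D-resp
  V-resp (A ⊗ B) = Tens-resp {sz A} {V A} {V B}
  V-resp (A ⅋ B) = Par-resp {sz A} {sz B} {V A} {V B} {C A} {C B}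

  C-resp : ∀ A → Resp (C A)
  C-resp A = subst Resp (V-⊥ A) (V-resp (A ^⊥))

  Tens-rename : ∀ {a p q} → Rename p → Rename q → Rename (Tens a p q)
  Tens-rename r s f g inv (ν₁ , ν₂ , E₁ , E₂ , refl , l , p , x , y) =
    map f ν₁ , map f ν₂ , mapV f E₁ , mapV f E₂ , List.map-++ f ν₁ ν₂ , trans (List.length-map f ν₁) l ,
    ↭-trans (map⁺ _ p) (↭-reflexive (List.map-++ _ E₁ E₂)) , r f g (inv ∘ ∈-++⁺ˡ) x , s f g (inv ∘ ∈-++⁺ʳ ν₁) y

  map-inverse : ∀ {f g : ℕ → ℕ} ν → (∀ {z} → z ∈ ν → g (f z) ≡ z) → map g (map f ν) ≡ ν
  map-inverse ν inv = trans (sym (List.map-∘ ν)) (trans (List.map-cong-local (All.tabulate inv)) (List.map-id ν))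

  Par-rename : ∀ {a b pv qv pc qc} → Rename pv → Rename qv → Rename pc → Rename qc →
               (∀ {ν E} → pc ν E → ends E ↭ ν) → (∀ {ν E} → qc ν E → ends E ↭ ν) → Rename (Par a b pv qv pc qc)
  Par-rename {pv = pv} {qv} {pc} {qc} rpv rqv rpc rqc epc eqc {ν} {E} f g inv (e , h) =
    ↭-trans (↭-reflexive (ends-mapV f E)) (map⁺ f e) , λ {ν₁} {ν₂} eq l l′ → go ν₁ ν₂ eq l l′
    where
    inv′ : ∀ {z} → z ∈ map f ν → f (g z) ≡ z
    inv′ z∈ with y , y∈ , refl ← ∈-map⁻ f z∈ = cong f (inv y∈)
    E-id : mapV g (mapV f E) ≡ E
    E-id = trans (mapV-∘ f g E) (mapV-fix E (inv ∘ ∈-resp-↭ e))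
    e′ : ends (mapV f E) ↭ map f ν
    e′ = ↭-trans (↭-reflexive (ends-mapV f E)) (map⁺ f e)
    -- The test and the whole elimination are pulled back along `g`, the hypothesis on `E` is
    -- applied, and its result is pushed forward along `f`.
    step : ∀ {μ₁ μ₂ F H} {pc qv : Pr} → Rename pc → Rename qv → (∀ {ν E} → pc ν E → ends E ↭ ν) →
           ν ↭ μ₂ ++ μ₁ → (∀ {F H} → pc (reverse μ₁) F → Elim (E ++ F) μ₁ H → qv μ₂ H) →
           pc (reverse (map f μ₁)) F → Elim (mapV f E ++ F) (map f μ₁) H → qv (map f μ₂) H
    step {μ₁} {μ₂} {F} {H} {pc} {qv} rpc rqv epc p h c k =
      subst (qv (map f μ₂)) (trans (mapV-∘ g f H) (mapV-fix H λ z∈ → inv′ (∈-resp-↭ (map⁺ f (↭-sym p))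
          (subst (_ ∈_) (sym (List.map-++ f μ₂ μ₁)) (∈-++⁺ˡ (∈-resp-↭ endH z∈))))))
        (rqv f g (λ z∈ → inv (∈-resp-↭ (↭-sym p) (∈-++⁺ˡ z∈))) (h c′ k′))
      where
      i₁ : ∀ {z} → z ∈ μ₁ → g (f z) ≡ z
      i₁ z∈ = inv (∈-resp-↭ (↭-sym p) (∈-++⁺ʳ μ₂ z∈))
      endH : ends H ↭ map f μ₂
      endH = Elim-ends-cut {E = mapV f E} {F} (↭-trans e′ (↭-trans (map⁺ f p) (↭-reflexive (List.map-++ f μ₂ μ₁))))
               (↭-trans (epc c) (↭-reverse (map f μ₁))) refl k
      c′ : pc (reverse μ₁) (mapV g F)
      c′ = subst (λ z → pc z (mapV g F))
        (trans (List.reverse-map g (map f μ₁)) (cong reverse (map-inverse μ₁ i₁)))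
        (rpc g f (λ z∈ → inv′ (∈-resp-↭ (map⁺ f (↭-sym p)) (subst (_ ∈_) (sym (List.map-++ f μ₂ μ₁))
          (∈-++⁺ʳ (map f μ₂) (∈-resp-↭ (↭-reverse (map f μ₁)) z∈))))) c)
      k′ : Elim (E ++ mapV g F) μ₁ (mapV g H)
      k′ = subst₂ (λ a b → Elim a b (mapV g H)) (trans (List.map-++ _ (mapV f E) F) (cong (_++ mapV g F) E-id))
             (map-inverse μ₁ i₁) (Elim-mapV g k)
    go : ∀ ν₁ ν₂ → map f ν ≡ ν₂ ++ ν₁ → length ν₁ ≡ _ → length ν₂ ≡ _ →
         (∀ {F H} → pc (reverse ν₁) F → Elim (mapV f E ++ F) ν₁ H → qv ν₂ H) ×
         (∀ {F H} → qc (reverse ν₂) F → Elim (mapV f E ++ F) ν₂ H → pv ν₁ H)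
    go ν₁ ν₂ eq l l′
      with μ₂ , μ₁ , refl , m₂ , m₁ ← split-length ν (length ν₂) (trans (sym (List.length-map f ν)) (trans
          (cong length eq) (List.length-++ ν₂)))
      with refl , refl ← ++-injective (map f μ₂) ν₂ (trans (List.length-map f μ₂) m₂) (trans (sym
          (List.map-++ f μ₂ μ₁)) eq)
      with h₁ , h₂ ← h {μ₁} {μ₂} refl (trans m₁ l) (trans m₂ l′) =
      step {pc = pc} {qv} rpc rqv epc refl h₁ , step {pc = qc} {pv} rqc rpv eqc (++-comm μ₂ μ₁) h₂

  mutual
    V-rename : ∀ A → Rename (V A)
    V-rename (pos P) f g _ = D-rename f
    V-rename (neg P) f g _ = D-rename f
    V-rename (A ⊗ B) = Tens-rename (V-rename A) (V-rename B)
    V-rename (A ⅋ B) = Par-rename {pv = V A} {V B} {C A} {C B} (V-rename A) (V-rename B) (C-rename A) (C-rename B)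
        (C-ends A) (C-ends B)

    C-rename : ∀ A → Rename (C A)
    C-rename (pos P) f g _ = D-rename f
    C-rename (neg P) f g _ = D-rename f
    C-rename (A ⊗ B) = Par-rename {pv = C A} {C B} {V A} {V B} (C-rename A) (C-rename B) (V-rename A) (V-rename B)
        (V-ends A) (V-ends B)
    C-rename (A ⅋ B) = Tens-rename (C-rename A) (C-rename B)

  -- One covalue for each formula, on separate parts of the soup.
  Test : Ctx → Soup (Fin t) → Set
  Test []      F = F ↭ []
  Test (a ∷ Γ) F = ∃₂ λ F₁ F₂ → F ↭ F₁ ++ F₂ × C (fm a) (reverse (nms a)) F₁ × Test Γ F₂

  Test-↭ : ∀ {Γ Δ F} → Γ ↭ Δ → Test Γ F → Test Δ F
  Test-↭ refl t = t
  Test-↭ (prep a p) (F₁ , F₂ , q , c , t) = F₁ , F₂ , q , c , Test-↭ p t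
  Test-↭ (swap a b p) (F₁ , F₂ , q , c , F₃ , F₄ , q′ , c′ , t) =
    F₃ , F₁ ++ F₄ , ↭-trans q (↭-trans (++⁺ˡ F₁ q′) (shifts F₁ F₃)) , c′ , F₁ , F₄ , refl , c , Test-↭ p t
  Test-↭ (_↭_.trans p q) t = Test-↭ q (Test-↭ p t)

  Test-++⁻ : ∀ Γ {Δ F} → Test (Γ ++ Δ) F → ∃₂ λ F₁ F₂ → F ↭ F₁ ++ F₂ × Test Γ F₁ × Test Δ F₂
  Test-++⁻ [] {F = F} t = [] , F , refl , refl , t
  Test-++⁻ (a ∷ Γ) (F₁ , F₂ , p , c , t) with F₃ , F₄ , q , t₁ , t₂ ← Test-++⁻ Γ t =
    F₁ ++ F₃ , F₄ , ↭-trans p (↭-trans (++⁺ˡ F₁ q) (↭-sym (++-assoc F₁ F₃ F₄))) , (F₁ , F₃ , refl , c , t₁) , t₂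

  Test-ends : ∀ Γ {F} → Test Γ F → ends F ↭ nm Γ
  Test-ends [] t = ends-↭ t
  Test-ends (a ∷ Γ) (F₁ , F₂ , p , c , t) = ↭-trans (ends-↭ p) (↭-trans (ends-++ F₁ F₂)
    (↭-trans (++⁺ (↭-trans (C-ends (fm a) c) (↭-reverse (nms a))) (Test-ends Γ t)) (++-comm (nms a) (nm Γ))))

  -- Any formula `a` of the sequent may serve as the output, all others being inputs fed by tests.
  -- Having every choice available makes exchange trivial and lets a cut be evaluated from either
  -- side.
  Valid : Ctx → Soup (Fin t) → Set
  Valid Γ E = ∀ {a Θ F H} → Γ ↭ a ∷ Θ → Test Θ F → Elim (E ++ F) (nm Θ) H → V (fm a) (nms a) H

  valid-↭ : ∀ {Γ Δ E} → Γ ↭ Δ → Valid Γ E → Valid Δ E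
  valid-↭ p v q = v (↭-trans p q)

  -- If the output is the ⅋ itself, the two clauses of `Par` are the two choices of output in the
  -- premise. If it lies elsewhere, the test of the ⅋ is a pair of tests for A and B.
  valid-par : ∀ {A B α β Γ E l l′ l″} → ends E ↭ nm Γ ++ β ++ α →
              Valid (nf A α l ∷ nf B β l′ ∷ Γ) E → Valid (nf (A ⅋ B) (β ++ α) l″ ∷ Γ) E
  valid-par {A} {B} {α} {β} {Γ} {E} {l} {l′} pE v {a} {Θ} {F} {H} p t k with ∷-↭-inv p
  ... | inj₁ (refl , q) =
    Elim-ends-cut {E = E} {F} (↭-trans pE (↭-trans (++-comm (nm Γ) (β ++ α)) (++⁺ˡ (β ++ α) (nm-↭ q))))
        (Test-ends Θ t) refl k ,
    split
    where
    split : ∀ {ν₁ ν₂} → β ++ α ≡ ν₂ ++ ν₁ → length ν₁ ≡ sz A → length ν₂ ≡ sz B →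
      (∀ {F′ H′} → C A (reverse ν₁) F′ → Elim (H ++ F′) ν₁ H′ → V B ν₂ H′) ×
      (∀ {F′ H′} → C B (reverse ν₂) F′ → Elim (H ++ F′) ν₂ H′ → V A ν₁ H′)
    split {ν₁} {ν₂} eq l₁ l₂ with refl , refl ← ++-injective β ν₂ (trans l′ (sym l₂)) eq =
      (λ {F′} c k′ → v (swap _ _ q) (F′ , F , refl , c , t)
         (Elim-respˡ (solve 3 (λ x y z → x ⊕ y ⊕ z ⊜ (x ⊕ z) ⊕ y) ↭-refl E F′ F) (Elim-++ k k′))) ,
      (λ {F′} c k′ → v (prep _ (prep _ q)) (F′ , F , refl , c , t)
         (Elim-respˡ (solve 3 (λ x y z → x ⊕ y ⊕ z ⊜ (x ⊕ z) ⊕ y) ↭-refl E F′ F) (Elim-++ k k′)))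
  ... | inj₂ (Γ′ , q , r)
    with F₁ , F₂ , f , (ν₁ , ν₂ , FA , FB , eq , l₁ , g , cA , cB) , t′ ← Test-↭ r t
    with refl , refl ← ++-injective (reverse α) ν₁ (trans (List.length-reverse α) (trans l (sym l₁)))
           (trans (sym (List.reverse-++ β α)) eq) =
    v (↭-trans (prep _ (prep _ q)) (solve 4
        (λ x y z w → x ⊕ y ⊕ z ⊕ w ⊜ z ⊕ x ⊕ y ⊕ w) ↭-refl [ _ ] [ _ ] [ a ] Γ′))
      (FA , FB ++ F₂ , ↭-trans f (↭-trans (++⁺ʳ F₂ g) (++-assoc FA FB F₂)) , cA , FB , F₂ , refl , cB , t′)
      (Elim-perm (↭-trans (nm-↭ r) (↭-reflexive (sym (List.++-assoc (nm Γ′) β α)))) k)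

  -- The opposite direction to `flat-der`: derivations of a lexicon sequent are flattened, whereas
  -- validity is shown for the literals and folded up again.
  valid-flat : ∀ A ν l {Γ E} → ends E ↭ nm Γ ++ ν → Valid (flat A ν l ++ Γ) E → Valid (nf A ν l ∷ Γ) E
  valid-flat (pos P) ν l e v = v
  valid-flat (neg P) ν l e v = v
  valid-flat (A ⊗ B) ν l e v = v
  valid-flat (A ⅋ B) ν l {Γ} {E} e v with split-length ν (sz B) (trans l (List.length-++ ⟦ B ⟧))
  ... | β , α , refl , lβ , lα = valid-par {l = lα} {lβ} e (valid-flat A α lα (↭-trans e (↭-reflexive (sym
      (List.++-assoc (nm Γ) β α))))
      (valid-↭ (↭-sym (shift _ (flat A α lα) Γ)) (valid-flat B β lβ
        (↭-trans e (↭-trans (solve 3 (λ x y z → x ⊕ y ⊕ z ⊜ (x ⊕ z) ⊕ y) ↭-refl (nm Γ) β α)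
          (++⁺ʳ β (↭-reflexive (sym (trans (nm-++ (flat A α lα) Γ) (cong (nm Γ ++_) (nm-flat A α lα))))))))
        (valid-↭ (↭-trans (↭-reflexive (List.++-assoc (flat A α lα) (flat B β lβ) Γ)) (shifts (flat A α lα)
            (flat B β lβ))) v))))

  valid-flatC : ∀ Γ Θ {E} → ends E ↭ nm (Γ ++ Θ) → Valid (flatC Γ ++ Θ) E → Valid (Γ ++ Θ) E
  valid-flatC [] Θ e v = v
  valid-flatC (a ∷ Γ) Θ {E} e v = valid-flat (fm a) (nms a) (len a) e (valid-↭ (shifts Γ fl)
    (valid-flatC Γ (fl ++ Θ)
      (↭-trans e (↭-trans (nm-↭ (↭-sym (shift a Γ Θ))) (↭-trans (nm-++-↭ Γ (a ∷ Θ))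
        (↭-trans (++⁺ˡ (nm Γ) (↭-reflexive (sym (trans (nm-++ fl Θ) (cong (nm Θ ++_) (nm-flat (fm a) (nms a)
            (len a))))))) (↭-sym (nm-++-↭ Γ _))))))
      (valid-↭ (↭-trans (↭-reflexive (List.++-assoc fl (flatC Γ) Θ)) (shifts fl (flatC Γ))) v)))
    where
    fl = flat (fm a) (nms a) (len a)

  Test-one : ∀ a {F} → Test [ a ] F → C (fm a) (reverse (nms a)) F
  Test-one a (F₁ , F₂ , p , c , q) = C-resp (fm a) (↭-sym (↭-trans p (↭-trans (++⁺ˡ F₁ q) (++-identityʳ F₁)))) c

  -- Glueing links renames the test, whichever formula is the output. Of the test only the set of
  -- vertices is known, not the orientation; `Elim-links⁻` recovers it from the success of the
  -- elimination.
  valid-id : ∀ A α β {l l′} → Unique (α ++ β) → Valid (nf (A ^⊥) β l′ ∷ nf A α l ∷ []) (links ⟦ A ⟧ α (reverse β))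
  valid-id A α β {l} {l′} u {a} {Θ} {F} p t k = go (∷-↭-inv p)
    where
    lβ : length (reverse β) ≡ sz A
    lβ = trans (List.length-reverse β) (trans l′ (sz-⊥ A))
    uαβ : Unique (α ++ reverse β)
    uαβ = Unique-resp-↭ (++⁺ˡ α (↭-sym (↭-reverse β))) u
    uβα : Unique (reverse β ++ α)
    uβα = Unique-resp-↭ (++-comm α (reverse β)) uαβ
    inverse : ∀ {ξ μ z} → Unique ξ → Unique μ → length ξ ≡ length μ → z ∈ ξ → sub μ ξ (sub ξ μ z) ≡ z
    inverse {ξ} {μ} uξ uμ eq z∈ = map-fix ξ (trans (List.map-∘ ξ)
      (trans (cong (map (sub μ ξ)) (map-sub ξ μ uξ (sym eq))) (map-sub μ ξ uμ eq))) z∈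
    go : (nf (A ^⊥) β l′ ≡ a × [ nf A α l ] ↭ Θ) ⊎ (∃ λ zs → [ nf A α l ] ↭ a ∷ zs × Θ ↭ nf (A ^⊥) β l′ ∷ zs) →
         V (fm a) (nms a) _
    go (inj₁ (refl , q)) = subst (λ P → P β _) (sym (V-⊥ A)) (C-resp A (↭-sym H↭)
      (subst (λ z → C A z (mapV (sub α (reverse β)) F)) eqβ (C-rename A (sub α (reverse β)) (sub (reverse β) α)
        (λ z∈ → inverse (Unique-++ˡ α u) (Unique-++ʳ α uαβ) (trans l (sym lβ)) (∈-resp-↭ (↭-reverse α) z∈)) c)))
      where
      c : C A (reverse α) F
      c = Test-one (nf A α l) (Test-↭ (↭-sym q) t)
      eqβ : map (sub α (reverse β)) (reverse α) ≡ β
      eqβ = trans (List.reverse-map _ α) (trans (cong reverse (map-sub α (reverse β) (Unique-++ˡ α u) (trans lβ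
          (sym l)))) (List.reverse-involutive β))
      H↭ = Elim-links⁻ (map not ⟦ A ⟧) (reverse β) α F (trans lβ (sym (List.length-map not ⟦ A ⟧))) (trans l (sym
          (List.length-map not ⟦ A ⟧))) uβα
             (↭-trans (C-ends A c) (↭-reverse α))
             (Elim-respˡ (↭-trans (++-comm F _) (↭-reflexive (cong (_++ F) (sym (links-not ⟦ A ⟧ α (reverse β))))))
                 (Elim-perm (nm-↭ (↭-sym q)) k))
    go (inj₂ (zs , q , r)) with refl ← ↭-singleton-inv (↭-sym q) =
      V-resp A (↭-sym H↭) (subst (λ z → V A z (mapV (sub (reverse β) α) F)) (map-sub (reverse β) α
          (Unique-++ʳ α uαβ) (trans l (sym lβ)))
        (V-rename A (sub (reverse β) α) (sub α (reverse β)) (inverse (Unique-++ʳ α uαβ) (Unique-++ˡ α u) (trans lβ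
            (sym l))) c))
      where
      c : V A (reverse β) F
      c = subst (λ P → P (reverse β) F) (C-⊥ A) (Test-one (nf (A ^⊥) β l′) (Test-↭ r t))
      H↭ = Elim-links⁻ ⟦ A ⟧ α (reverse β) F l lβ uαβ (V-ends A c)
             (Elim-respˡ (++-comm F _) (Elim-perm (↭-trans (nm-↭ r) (↭-sym (↭-reverse β))) k))

  module _ {A B : Formula n} {α β : List ℕ} {Γ Δ : Ctx} {E₁ E₂ : Soup (Fin t)}
    {l : length α ≡ sz A} {l′ : length β ≡ sz B} {l″ : length (α ++ β) ≡ sz (A ⊗ B)}
    (u : Unique ((nm Γ ++ α) ++ (nm Δ ++ β))) (e₁ : ends E₁ ↭ nm Γ ++ α) (e₂ : ends E₂ ↭ nm Δ ++ β)
    (v₁ : Valid (nf A α l ∷ Γ) E₁) (v₂ : Valid (nf B β l′ ∷ Δ) E₂) where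

    -- The output lies in the premise of A. The other premise, fully tested, yields a value of B;
    -- the covalue of the tensor sends it to a covalue of A; this is the missing test for the
    -- premise of A.
    valid-ten-left : ∀ {a Γ′ F₀ F₁ F₂ H} → Γ ↭ a ∷ Γ′ → C (A ⊗ B) (reverse (α ++ β)) F₀ → Test Γ′ F₁ → Test Δ F₂ →
      Elim ((E₂ ++ F₂) ++ (E₁ ++ F₀ ++ F₁)) (nm Δ ++ β ++ α ++ nm Γ′) H → V (fm a) (nms a) H
    valid-ten-left {a} {Γ′} {F₀} {F₁} {F₂} p c t₁ t₂ k
      with H₂ , k₂ , k₃ ← peel (E₂ ++ F₂) (E₁ ++ F₀ ++ F₁) (nm Δ) {zs = β ++ nm Γ ++ α} k refl refl
             (Unique-resp-↭ (solve 4 (λ x y z w → (x ⊕ y) ⊕ (z ⊕ w) ⊜ z ⊕ w ⊕ x ⊕ y) ↭-refl (nm Γ) α (nm Δ) β) u)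
             (ends-⊆ E₁ (F₀ ++ F₁) (λ z∈ → ∈-++⁺ʳ β (∈-resp-↭ e₁ z∈)) (ends-⊆ F₀ F₁
               (λ z∈ → ⊆-++ α (λ q → ∈-++⁺ʳ β (∈-++⁺ʳ (nm Γ) q)) ∈-++⁺ˡ (∈-resp-↭ (↭-trans (C-ends (A ⊗ B) c)
                   (↭-reverse (α ++ β))) z∈))
               (λ z∈ → ∈-++⁺ʳ β (∈-++⁺ˡ (∈-resp-↭ (nm-↭ (↭-sym p)) (∈-++⁺ˡ (∈-resp-↭ (Test-ends Γ′ t₁) z∈)))))))
      with vB ← v₂ refl t₂ k₂
      with H₃ , k₄ , k₅ ← peel (F₀ ++ H₂) (E₁ ++ F₁) β {zs = nm Γ ++ α} k₃
             (solve 4 (λ x y z w → x ⊕ y ⊕ z ⊕ w ⊜ (z ⊕ x) ⊕ (y ⊕ w)) ↭-refl H₂ E₁ F₀ F₁) refl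
             (Unique-++ʳ (nm Δ) (Unique-resp-↭ (solve 4 (λ x y z w → (x ⊕ y) ⊕ (z ⊕ w) ⊜ z ⊕ w ⊕ x ⊕ y) ↭-refl
                 (nm Γ) α (nm Δ) β) u))
             (ends-⊆ E₁ F₁ (∈-resp-↭ e₁) (λ z∈ → ∈-++⁺ˡ (∈-resp-↭ (nm-↭ (↭-sym p)) (∈-++⁺ˡ (∈-resp-↭
                 (Test-ends Γ′ t₁) z∈))))) =
      v₁ (↭-trans (prep _ p) (swap _ _ refl)) (H₃ , F₁ , refl , cA , t₁)
        (Elim-perm (++-comm α (nm Γ′)) (Elim-respˡ (solve 3 (λ x y z → x ⊕ y ⊕ z ⊜ y ⊕ x ⊕ z) ↭-refl E₁ H₃ F₁) k₅))
      where
      cA : C A (reverse α) H₃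
      cA = proj₂ (proj₂ c (List.reverse-++ α β) (trans (List.length-reverse α) l) (trans
          (List.length-reverse β) l′))
             (subst (λ z → V B z H₂) (sym (List.reverse-involutive β)) vB) (Elim-perm (↭-sym (↭-reverse β)) k₄)

    valid-ten-right : ∀ {a Δ′ F₀ F₁ F₂ H} → Δ ↭ a ∷ Δ′ → C (A ⊗ B) (reverse (α ++ β)) F₀ → Test Γ F₁ → Test Δ′ F₂ →
      Elim ((E₁ ++ F₁) ++ (E₂ ++ F₀ ++ F₂)) (nm Γ ++ α ++ β ++ nm Δ′) H → V (fm a) (nms a) H
    valid-ten-right {a} {Δ′} {F₀} {F₁} {F₂} p c t₁ t₂ k
      with H₁ , k₂ , k₃ ← peel (E₁ ++ F₁) (E₂ ++ F₀ ++ F₂) (nm Γ) {zs = α ++ nm Δ ++ β} k refl refl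
             (Unique-resp-↭ (++-assoc (nm Γ) α _) u)
             (ends-⊆ E₂ (F₀ ++ F₂) (λ z∈ → ∈-++⁺ʳ α (∈-resp-↭ e₂ z∈)) (ends-⊆ F₀ F₂
               (λ z∈ → ⊆-++ α ∈-++⁺ˡ (λ q → ∈-++⁺ʳ α (∈-++⁺ʳ (nm Δ) q)) (∈-resp-↭ (↭-trans (C-ends (A ⊗ B) c)
                   (↭-reverse (α ++ β))) z∈))
               (λ z∈ → ∈-++⁺ʳ α (∈-++⁺ˡ (∈-resp-↭ (nm-↭ (↭-sym p)) (∈-++⁺ˡ (∈-resp-↭ (Test-ends Δ′ t₂) z∈)))))))
      with vA ← v₁ refl t₁ k₂
      with H₃ , k₄ , k₅ ← peel (F₀ ++ H₁) (E₂ ++ F₂) α {zs = nm Δ ++ β} k₃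
             (solve 4 (λ x y z w → x ⊕ y ⊕ z ⊕ w ⊜ (z ⊕ x) ⊕ (y ⊕ w)) ↭-refl H₁ E₂ F₀ F₂) refl
             (Unique-++ʳ (nm Γ) (Unique-resp-↭ (++-assoc (nm Γ) α _) u))
             (ends-⊆ E₂ F₂ (∈-resp-↭ e₂) (λ z∈ → ∈-++⁺ˡ (∈-resp-↭ (nm-↭ (↭-sym p)) (∈-++⁺ˡ (∈-resp-↭
                 (Test-ends Δ′ t₂) z∈))))) =
      v₂ (↭-trans (prep _ p) (swap _ _ refl)) (H₃ , F₂ , refl , cB , t₂)
        (Elim-perm (++-comm β (nm Δ′)) (Elim-respˡ (solve 3 (λ x y z → x ⊕ y ⊕ z ⊜ y ⊕ x ⊕ z) ↭-refl E₂ H₃ F₂) k₅))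
      where
      cB : C B (reverse β) H₃
      cB = proj₁ (proj₂ c (List.reverse-++ α β) (trans (List.length-reverse α) l) (trans
          (List.length-reverse β) l′))
             (subst (λ z → V A z H₁) (sym (List.reverse-involutive α)) vA) (Elim-perm (↭-sym (↭-reverse α)) k₄)

    valid-ten : Valid (nf (A ⊗ B) (α ++ β) l″ ∷ Γ ++ Δ) (E₁ ++ E₂)
    valid-ten {a} {Θ} {F} {H} p t k with ∷-↭-inv p
    ... | inj₁ (refl , q) with F₁ , F₂ , f , t₁ , t₂ ← Test-++⁻ Γ (Test-↭ (↭-sym q) t)
      with H₁ , k₁ , k₂ ← peel (E₁ ++ F₁) (E₂ ++ F₂) (nm Γ) {nm Δ} {α ++ nm Δ ++ β} k
             (↭-trans (++⁺ˡ (E₁ ++ E₂) f) (solve 4 (λ x y z w → (x ⊕ y) ⊕ (z ⊕ w) ⊜ (x ⊕ z) ⊕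
                 (y ⊕ w)) ↭-refl E₁ E₂ F₁ F₂))
             (↭-trans (nm-↭ (↭-sym q)) (nm-++-↭ Γ Δ)) (Unique-resp-↭ (++-assoc (nm Γ) α _) u)
             (ends-⊆ E₂ F₂ (λ z∈ → ∈-++⁺ʳ α (∈-resp-↭ e₂ z∈)) (λ z∈ → ∈-++⁺ʳ α (∈-++⁺ˡ (∈-resp-↭
                 (Test-ends Δ t₂) z∈))))
      with vA ← v₁ refl t₁ k₁
      with H₂ , k₃ , done r ← peel (E₂ ++ F₂) H₁ (nm Δ) {[]} {(nm Γ ++ α) ++ β} k₂ (++-comm H₁ _) (↭-sym
          (++-identityʳ _))
             (Unique-resp-↭ (solve 3 (λ x y z → x ⊕ (y ⊕ z) ⊜ y ⊕ (x ⊕ z)) ↭-refl (nm Γ ++ α) (nm Δ) β) u)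
             (λ z∈ → ∈-++⁺ˡ (∈-++⁺ʳ (nm Γ) (∈-resp-↭ (V-ends A vA) z∈))) =
      α , β , H₁ , H₂ , refl , l , ↭-trans (↭-sym r) (++-comm H₂ H₁) , vA , v₂ refl t₂ k₃
    valid-ten {a} {Θ} {F} {H} p t k | inj₂ (Ψ , q , r)
      with F₀ , F′ , f , c , t′ ← Test-↭ r t with ++-↭-inv Γ q
    ... | inj₁ (Γ′ , q₁ , q₂) with F₁ , F₂ , f′ , t₁ , t₂ ← Test-++⁻ Γ′ (Test-↭ q₂ t′) =
      valid-ten-left q₁ c t₁ t₂ (Elim-respˡ
        (↭-sym (↭-trans (++⁺ˡ (E₁ ++ E₂) (↭-trans f (++⁺ˡ F₀ f′)))
          (solve 5 (λ x y z v w → (x ⊕ y) ⊕ (z ⊕ v ⊕ w) ⊜ (y ⊕ w) ⊕ (x ⊕ z ⊕ v)) ↭-refl E₁ E₂ F₀ F₁ F₂)))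
        (Elim-perm (↭-trans (nm-↭ r) (↭-trans (++⁺ʳ (α ++ β) (↭-trans (nm-↭ q₂) (nm-++-↭ Γ′ Δ)))
          (solve 4 (λ x y z w → (x ⊕ y) ⊕ (z ⊕ w) ⊜ y ⊕ w ⊕ z ⊕ x) ↭-refl (nm Γ′) (nm Δ) α β))) k))
    ... | inj₂ (Δ′ , q₁ , q₂) with F₁ , F₂ , f′ , t₁ , t₂ ← Test-++⁻ Γ (Test-↭ q₂ t′) =
      valid-ten-right q₁ c t₁ t₂ (Elim-respˡ
        (↭-sym (↭-trans (++⁺ˡ (E₁ ++ E₂) (↭-trans f (++⁺ˡ F₀ f′)))
          (solve 5 (λ x y z v w → (x ⊕ y) ⊕ (z ⊕ v ⊕ w) ⊜ (x ⊕ v) ⊕ (y ⊕ z ⊕ w)) ↭-refl E₁ E₂ F₀ F₁ F₂)))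
        (Elim-perm (↭-trans (nm-↭ r) (↭-trans (++⁺ʳ (α ++ β) (↭-trans (nm-↭ q₂) (nm-++-↭ Γ Δ′)))
          (solve 4 (λ x y z w → (x ⊕ y) ⊕ (z ⊕ w) ⊜ x ⊕ z ⊕ w ⊕ y) ↭-refl (nm Γ) (nm Δ′) α β))) k))

  -- The premise without the output formula is evaluated first, with its cut formula as output. A
  -- value of one cut formula is a covalue of the other, hence a test for the remaining premise.
  valid-cut : ∀ {A ξ Γ Δ E₁ E₂ R l l′} → Unique
      (ξ ++ nm Γ ++ nm Δ) → ends E₁ ↭ nm Γ ++ ξ → ends E₂ ↭ nm Δ ++ reverse ξ →
    Valid (nf A ξ l ∷ Γ) E₁ → Valid (nf (A ^⊥) (reverse ξ) l′ ∷ Δ) E₂ → Elim (E₁ ++ E₂) ξ R → Valid (Γ ++ Δ) R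
  valid-cut {A} {ξ} {Γ} {Δ} {E₁} {E₂} u e₁ e₂ v₁ v₂ k₀ {a} {Θ} {F} p t k with ++-↭-inv Γ p
  ... | inj₁ (Γ′ , q₁ , q₂) with F₁ , F₂ , f , t₁ , t₂ ← Test-++⁻ Γ′ (Test-↭ q₂ t)
    with H₂ , k₁ , k₂ ← peel (E₂ ++ F₂) (E₁ ++ F₁) (nm Δ) {ξ ++ nm Γ′} {nm Γ ++ ξ} (Elim-++ k₀ k)
           (↭-trans (++⁺ˡ (E₁ ++ E₂) f) (solve 4 (λ x y z w → (x ⊕ y) ⊕ (z ⊕ w) ⊜ (y ⊕ w) ⊕
               (x ⊕ z)) ↭-refl E₁ E₂ F₁ F₂))
           (↭-trans (++⁺ˡ ξ (↭-trans (nm-↭ q₂) (nm-++-↭ Γ′ Δ))) (solve 3 (λ x y z → x ⊕ y ⊕ z ⊜ z ⊕ x ⊕ y) ↭-refl ξ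
               (nm Γ′) (nm Δ)))
           (Unique-resp-↭ (solve 3 (λ x y z → x ⊕ y ⊕ z ⊜ z ⊕ y ⊕ x) ↭-refl ξ (nm Γ) (nm Δ)) u)
           (ends-⊆ E₁ F₁ (∈-resp-↭ e₁) (λ z∈ → ∈-++⁺ˡ (∈-resp-↭ (nm-↭ (↭-sym q₁)) (∈-++⁺ˡ (∈-resp-↭
               (Test-ends Γ′ t₁) z∈))))) =
    v₁ (↭-trans (prep _ q₁) (swap _ _ refl)) (H₂ , F₁ , refl , subst (λ P → P (reverse ξ) H₂) (V-⊥ A)
        (v₂ refl t₂ k₁) , t₁)
      (Elim-perm (++-comm ξ (nm Γ′)) (Elim-respˡ (solve 3 (λ x y z → x ⊕ y ⊕ z ⊜ y ⊕ x ⊕ z) ↭-refl E₁ H₂ F₁) k₂))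
  ... | inj₂ (Δ′ , q₁ , q₂) with F₁ , F₂ , f , t₁ , t₂ ← Test-++⁻ Γ (Test-↭ q₂ t)
    with H₁ , k₁ , k₂ ← peel (E₁ ++ F₁) (E₂ ++ F₂) (nm Γ) {ξ ++ nm Δ′} {nm Δ ++ ξ} (Elim-++ k₀ k)
           (↭-trans (++⁺ˡ (E₁ ++ E₂) f) (solve 4 (λ x y z w → (x ⊕ y) ⊕ (z ⊕ w) ⊜ (x ⊕ z) ⊕
               (y ⊕ w)) ↭-refl E₁ E₂ F₁ F₂))
           (↭-trans (++⁺ˡ ξ (↭-trans (nm-↭ q₂) (nm-++-↭ Γ Δ′))) (solve 3 (λ x y z → x ⊕ y ⊕ z ⊜ y ⊕ x ⊕ z) ↭-refl ξ
               (nm Γ) (nm Δ′)))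
           (Unique-resp-↭ (solve 3 (λ x y z → x ⊕ y ⊕ z ⊜ y ⊕ z ⊕ x) ↭-refl ξ (nm Γ) (nm Δ)) u)
           (ends-⊆ E₂ F₂ (∈-resp-↭ (↭-trans e₂ (++⁺ˡ (nm Δ) (↭-reverse ξ))))
             (λ z∈ → ∈-++⁺ˡ (∈-resp-↭ (nm-↭ (↭-sym q₁)) (∈-++⁺ˡ (∈-resp-↭ (Test-ends Δ′ t₂) z∈))))) =
    v₂ (↭-trans (prep _ q₁) (swap _ _ refl))
      (H₁ , F₂ , refl , subst₂ (λ P z → P z H₁) (sym (C-⊥ A)) (sym (List.reverse-involutive ξ))
          (v₁ refl t₁ k₁) , t₂)
      (Elim-perm (↭-trans (++-comm ξ (nm Δ′)) (++⁺ˡ (nm Δ′) (↭-sym (↭-reverse ξ))))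
        (Elim-respˡ (solve 3 (λ x y z → x ⊕ y ⊕ z ⊜ y ⊕ x ⊕ z) ↭-refl E₂ H₁ F₂) k₂))

  module _ (lex : ∀ {j Γ} → j ∈ Lex → cyc (Judgement.word j) ≡ [] → fms Γ ≡ Judgement.seq j → Unique (nm Γ) →
                  Valid Γ (rn (nm Γ) (reg (Judgement.word j)))) where

    sound : ∀ {Γ E} → NDer Γ E → Unique (nm Γ) → Valid Γ E
    sound (nresp {E = E} {F} p d) u q t k = sound d u q t (Elim-respˡ (++⁺ʳ _ p) k)
    sound (nperm p d) u = valid-↭ p (sound d (Unique-resp-↭ (nm-↭ (↭-sym p)) u))
    sound (nid A α β) u = valid-id A α β u
    sound (nlex j∈ c eq) u = lex j∈ c eq u
    sound (npar {α = α} {β} {Γ} d) u = valid-par (↭-trans (NDer⇒ends d) (++-assoc (nm Γ) β α))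
      (sound d (subst Unique (sym (List.++-assoc (nm Γ) β α)) u))
    sound (nten {α = α} {β} {Γ} {Δ} d d′) u = valid-ten u′ (NDer⇒ends d) (NDer⇒ends d′)
      (sound d (Unique-++ˡ (nm Γ ++ α) u′)) (sound d′ (Unique-++ʳ (nm Γ ++ α) u′))
      where
      u′ = Unique-resp-↭ (↭-trans (++⁺ʳ (α ++ β) (nm-++-↭ Γ Δ))
             (solve 4 (λ x y z w → (x ⊕ y) ⊕ (z ⊕ w) ⊜ (x ⊕ z) ⊕ (y ⊕ w)) ↭-refl (nm Γ) (nm Δ) α β)) u
    sound (ncut {α = ξ} {Γ} {Δ} d d′ u′ k) u = valid-cut u′ (NDer⇒ends d) (NDer⇒ends d′)
      (sound d (Unique-++ʳ (nm Δ) (Unique-resp-↭ (solve 3 (λ x y z → x ⊕ y ⊕ z ⊜ z ⊕ y ⊕ x) ↭-refl ξ (nm Γ)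
          (nm Δ)) u′)))
      (sound d′ (Unique-++ʳ (nm Γ) (Unique-resp-↭ (↭-trans (solve 3 (λ x y z → x ⊕ y ⊕ z ⊜ y ⊕ z ⊕ x) ↭-refl ξ
          (nm Γ) (nm Δ))
        (++⁺ˡ (nm Γ) (++⁺ˡ (nm Δ) (↭-sym (↭-reverse ξ))))) u′))) k

-- From MCFG to LLG

overFin : {X : Set} → ∀ k → (Fin k → List X) → List X
overFin zero    g = []
overFin (suc k) g = g zero ++ overFin k (λ i → g (suc i))

module Vars {n : ℕ} (ar : Fin n → ℕ) where

  record Var (body : List (Fin n)) : Set where
    constructor _▹_
    field
      slot : Fin (length body)
      comp : Fin (ar (lookup body slot))

  overVars : {X : Set} (body : List (Fin n)) → (Var body → List X) → List X
  overVars []         f = []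
  overVars (b ∷ body) f = overFin (ar b) (λ i → f (zero ▹ i)) ++ overVars body (λ { (j ▹ i) → f (suc j ▹ i) })

  allVars : ∀ body → List (Var body)
  allVars body = overVars body [_]

  vars : ∀ {t body} → List (Sym t ar body) → List (Var body)
  vars []            = []
  vars (term a ∷ s)  = vars s
  vars (var j i ∷ s) = (j ▹ i) ∷ vars s

  hit : ∀ {body} → Var body → Var body → ℕ
  hit (j ▹ i) (j′ ▹ i′) = if (toℕ j ≡ᵇ toℕ j′) ∧ (toℕ i ≡ᵇ toℕ i′) then 1 else 0

  cnt : ∀ {body} → Var body → List (Var body) → ℕ
  cnt x []       = 0
  cnt x (y ∷ ys) = hit x y + cnt x ys

  countVar-cnt : ∀ {t body} j i (s : List (Sym t ar body)) → countVar j i s ≡ cnt (j ▹ i) (vars s)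
  countVar-cnt j i []              = refl
  countVar-cnt j i (term a ∷ s)    = countVar-cnt j i s
  countVar-cnt j i (var j′ i′ ∷ s) = cong (_ +_) (countVar-cnt j i s)

  ≡ᵇ-refl : ∀ m → (m ≡ᵇ m) ≡ true
  ≡ᵇ-refl zero    = refl
  ≡ᵇ-refl (suc m) = ≡ᵇ-refl m

  hit-refl : ∀ {body} (x : Var body) → hit x x ≡ 1
  hit-refl (j ▹ i) rewrite ≡ᵇ-refl (toℕ j) | ≡ᵇ-refl (toℕ i) = refl

  hit-cases : ∀ {body} (x y : Var body) → hit x y ≡ 0 ⊎ x ≡ y
  hit-cases (j ▹ i) (j′ ▹ i′) with toℕ j ≡ᵇ toℕ j′ in p
  ... | false = inj₁ refl
  ... | true with refl ← toℕ-injective (ℕ.≡ᵇ⇒≡ (toℕ j) (toℕ j′)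
      (Bool.T-≡ .Equivalence.from p)) with toℕ i ≡ᵇ toℕ i′ in q
  ...   | false = inj₁ refl
  ...   | true with refl ← toℕ-injective (ℕ.≡ᵇ⇒≡ (toℕ i) (toℕ i′) (Bool.T-≡ .Equivalence.from q)) = inj₂ refl

  cnt-++ : ∀ {body} (x : Var body) ys zs → cnt x (ys ++ zs) ≡ cnt x ys + cnt x zs
  cnt-++ x []       zs = refl
  cnt-++ x (y ∷ ys) zs = trans (cong (hit x y +_) (cnt-++ x ys zs)) (sym (ℕ.+-assoc (hit x y) _ _))

  cnt-↭ : ∀ {body} (x : Var body) {ys zs} → ys ↭ zs → cnt x ys ≡ cnt x zs
  cnt-↭ x refl = refl
  cnt-↭ x (prep y p) = cong (hit x y +_) (cnt-↭ x p)
  cnt-↭ x (swap {xs} {ys} y z p) = trans (sym (ℕ.+-assoc (hit x y) (hit x z) _))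
    (trans (cong₂ _+_ (ℕ.+-comm (hit x y) (hit x z)) (cnt-↭ x p)) (ℕ.+-assoc (hit x z) (hit x y) _))
  cnt-↭ x (_↭_.trans p q) = trans (cnt-↭ x p) (cnt-↭ x q)

  cnt⇒∈ : ∀ {body} (x : Var body) ys {m} → cnt x ys ≡ suc m → x ∈ ys
  cnt⇒∈ x (y ∷ ys) eq with hit-cases x y
  ... | inj₁ h rewrite h = there (cnt⇒∈ x ys eq)
  ... | inj₂ refl = here refl

  cnt⇒↭ : ∀ {body} (xs ys : List (Var body)) → (∀ x → cnt x xs ≡ cnt x ys) → xs ↭ ys
  cnt⇒↭ [] [] h = refl
  cnt⇒↭ [] (y ∷ ys) h with () ← trans (h y) (cong (_+ cnt y ys) (hit-refl y))
  cnt⇒↭ (x ∷ xs) ys h with ys′ , p ← ∈⇒↭ (cnt⇒∈ x ys (trans (sym (h x)) (cong (_+ cnt x xs) (hit-refl x)))) =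
    ↭-trans (prep x (cnt⇒↭ xs ys′ λ z → ℕ.+-cancelˡ-≡ (hit z x) _ _ (trans (h z) (cnt-↭ z p)))) (↭-sym p)

  cnt-none : ∀ {X : Set} {body} (x : Var body) (f : X → Var body) (xs : List X) → (∀ y → hit x (f y) ≡ 0) → cnt x
      (map f xs) ≡ 0
  cnt-none x f []       h = refl
  cnt-none x f (y ∷ xs) h rewrite h y = cnt-none x f xs h

  overFin-map : ∀ {X Y : Set} (h : X → Y) k (g : Fin k → List X) → map h (overFin k g) ≡ overFin k (map h ∘ g)
  overFin-map h zero    g = refl
  overFin-map h (suc k) g = trans (List.map-++ h (g zero) _) (cong (map h (g zero) ++_) (overFin-map h k _))

  overVars-map : ∀ {X Y : Set} (h : X → Y) body (f : Var body → List X) → map h (overVars body f) ≡ overVars body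
      (map h ∘ f)
  overVars-map h []         f = refl
  overVars-map h (b ∷ body) f = trans (List.map-++ h (overFin (ar b) _) _)
    (cong₂ _++_ (overFin-map h (ar b) _) (overVars-map h body _))

  sumFin : ∀ k → (Fin k → ℕ) → ℕ
  sumFin zero    g = 0
  sumFin (suc k) g = g zero + sumFin k (λ i → g (suc i))

  sumFin-zero : ∀ k {g : Fin k → ℕ} → (∀ i → g i ≡ 0) → sumFin k g ≡ 0
  sumFin-zero zero    h = refl
  sumFin-zero (suc k) h = cong₂ _+_ (h zero) (sumFin-zero k (λ i → h (suc i)))

  sumFin-one : ∀ k (i : Fin k) → sumFin k (λ i′ → if toℕ i ≡ᵇ toℕ i′ then 1 else 0) ≡ 1
  sumFin-one (suc k) zero    = cong suc (sumFin-zero k (λ _ → refl))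
  sumFin-one (suc k) (suc i) = sumFin-one k i

  cnt-overFin : ∀ {body} (x : Var body) k (g : Fin k → Var body) → cnt x (overFin k ([_] ∘ g)) ≡ sumFin k
      (λ i → hit x (g i))
  cnt-overFin x zero    g = refl
  cnt-overFin x (suc k) g = cong (hit x (g zero) +_) (cnt-overFin x k _)

  cnt-allVars : ∀ body (x : Var body) → cnt x (allVars body) ≡ 1
  cnt-allVars (b ∷ body) (zero ▹ i) = trans (cnt-++ (zero ▹ i) (overFin (ar b) _) _)
    (cong₂ _+_ (trans (cnt-overFin (zero ▹ i) (ar b) (λ i → zero ▹ i)) (sumFin-one (ar b) i))
      (trans (cong (cnt (zero ▹ i)) (sym (overVars-map (λ { (j ▹ i) → suc j ▹ i }) body [_])))
        (cnt-none (zero ▹ i) _ (allVars body) (λ _ → refl))))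
  cnt-allVars (b ∷ body) (suc j ▹ i) = trans (cnt-++ (suc j ▹ i) (overFin (ar b) _) _)
    (cong₂ _+_ (trans (cnt-overFin (suc j ▹ i) (ar b) (λ i → zero ▹ i)) (sumFin-zero (ar b) (λ _ → refl)))
      (trans (cong (cnt (suc j ▹ i)) (sym (overVars-map (λ { (j ▹ i) → suc j ▹ i }) body [_])))
        (trans (shifted (allVars body)) (cnt-allVars body (j ▹ i)))))
    where
    shifted : ∀ xs → cnt (suc j ▹ i) (map (λ { (j ▹ i) → suc j ▹ i }) xs) ≡ cnt (j ▹ i) xs
    shifted []       = refl
    shifted (x ∷ xs) = cong (hit (j ▹ i) x +_) (shifted xs)

  -- A multiset of variables is determined by its counts. In this form linearity can be carried
  -- along permutations of sources, targets and labels.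
  linear⇒↭ : ∀ {t body} (s : List (Sym t ar body)) → (∀ j i → countVar j i s ≡ 1) → vars s ↭ allVars body
  linear⇒↭ {body = body} s h = cnt⇒↭ (vars s) (allVars body) λ { (j ▹ i) →
    trans (sym (countVar-cnt j i s)) (trans (h j i) (sym (cnt-allVars body (j ▹ i)))) }

  ↭⇒linear : ∀ {t body} (s : List (Sym t ar body)) → vars s ↭ allVars body → ∀ j i → countVar j i s ≡ 1
  ↭⇒linear {body = body} s p j i = trans (countVar-cnt j i s) (trans (cnt-↭ (j ▹ i) p) (cnt-allVars body (j ▹ i)))

  vars-++ : ∀ {t body} (s s′ : List (Sym t ar body)) → vars (s ++ s′) ≡ vars s ++ vars s′
  vars-++ []            s′ = refl
  vars-++ (term a ∷ s)  s′ = vars-++ s s′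
  vars-++ (var j i ∷ s) s′ = cong (_ ∷_) (vars-++ s s′)

  overFin-concatMap : ∀ {X Y : Set} (h : X → List Y) k (g : Fin k → List X) → concatMap h (overFin k g) ≡ overFin k
      (concatMap h ∘ g)
  overFin-concatMap h zero    g = refl
  overFin-concatMap h (suc k) g = trans (List.concatMap-++ h (g zero) _) (cong (concatMap h (g zero) ++_)
      (overFin-concatMap h k _))

  overVars-concatMap : ∀ {X Y : Set} (h : X → List Y) body (f : Var body → List X) → concatMap h
      (overVars body f) ≡ overVars body (concatMap h ∘ f)
  overVars-concatMap h []         f = refl
  overVars-concatMap h (b ∷ body) f = trans (List.concatMap-++ h (overFin (ar b) _) _)
    (cong₂ _++_ (overFin-concatMap h (ar b) _) (overVars-concatMap h body _))

  overFin-cong : ∀ {X : Set} k {g g′ : Fin k → List X} → (∀ i → g i ≡ g′ i) → overFin k g ≡ overFin k g′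
  overFin-cong zero    h = refl
  overFin-cong (suc k) h = cong₂ _++_ (h zero) (overFin-cong k (λ i → h (suc i)))

  overVars-cong : ∀ {X : Set} body {f f′ : Var body → List X} →
      (∀ x → f x ≡ f′ x) → overVars body f ≡ overVars body f′
  overVars-cong []         h = refl
  overVars-cong (b ∷ body) h = cong₂ _++_ (overFin-cong (ar b) (λ i → h (zero ▹ i))) (overVars-cong body (λ {
      (j ▹ i) → h (suc j ▹ i) }))

  concatMap-allVars : ∀ {X : Set} body (f : Var body → List X) → concatMap f (allVars body) ≡ overVars body f
  concatMap-allVars body f = trans (overVars-concatMap f body [_]) (overVars-cong body (λ x → List.++-identityʳ
      (f x)))

-- Tuples of words as soups on consecutive pairs of endpoints.

lft rgt : ∀ {k} → List ℕ → Fin k → ℕ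
lft (x ∷ y ∷ ν) zero    = x
lft (x ∷ y ∷ ν) (suc i) = lft ν i
lft _           _       = 0
rgt (x ∷ y ∷ ν) zero    = y
rgt (x ∷ y ∷ ν) (suc i) = rgt ν i
rgt _           _       = 0

blk : ℕ → Boundary
blk zero    = []
blk (suc k) = true ∷ false ∷ blk k

lft-map : ∀ f k ν → length ν ≡ length (blk k) → (i : Fin k) → lft (map f ν) i ≡ f (lft ν i)
lft-map f (suc k) (x ∷ y ∷ ν) l zero    = refl
lft-map f (suc k) (x ∷ y ∷ ν) l (suc i) = lft-map f k ν (ℕ.suc-injective (ℕ.suc-injective l)) i

rgt-map : ∀ f k ν → length ν ≡ length (blk k) → (i : Fin k) → rgt (map f ν) i ≡ f (rgt ν i)
rgt-map f (suc k) (x ∷ y ∷ ν) l zero    = refl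
rgt-map f (suc k) (x ∷ y ∷ ν) l (suc i) = rgt-map f k ν (ℕ.suc-injective (ℕ.suc-injective l)) i

comps : ∀ {C k} → (Fin k → ℕ) → (Fin k → ℕ) → Vec (List C) k → Soup C
comps L R []      = []
comps L R (w ∷ v) = ed (L zero) w (R zero) ∷ comps (λ i → L (suc i)) (λ i → R (suc i)) v

comps-cong : ∀ {C k} {L L′ R R′ : Fin k → ℕ} (v : Vec (List C) k) → (∀ i → L i ≡ L′ i) → (∀ i → R i ≡ R′ i) →
             comps L R v ≡ comps L′ R′ v
comps-cong []      p q = refl
comps-cong (w ∷ v) p q = cong₂ _∷_ (cong₂ (λ x y → ed x w y) (p zero) (q zero)) (comps-cong v (λ i → p (suc i))
    (λ i → q (suc i)))

mapV-comps : ∀ {C k} f (L R : Fin k → ℕ) (v : Vec (List C) k) → mapV f (comps L R v) ≡ comps (f ∘ L) (f ∘ R) v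
mapV-comps f L R []      = refl
mapV-comps f L R (w ∷ v) = cong (_ ∷_) (mapV-comps f _ _ v)

comps-overFin : ∀ {C k} (L R : Fin k → ℕ) (v : Vec (List C) k) → comps L R v ≡ overFin k (λ i → [ ed (L i)
    (Vec.lookup v i) (R i) ])
comps-overFin L R []      = refl
comps-overFin L R (w ∷ v) = cong (_ ∷_) (comps-overFin _ _ v)

srcs-comps : ∀ {C} k ν (v : Vec (List C) k) → length ν ≡ length (blk k) → srcs (comps (lft ν) (rgt ν) v) ≡ sel true
    (blk k) ν
srcs-comps zero    []          []      l = refl
srcs-comps (suc k) (x ∷ y ∷ ν) (w ∷ v) l = cong (x ∷_) (srcs-comps k ν v (ℕ.suc-injective (ℕ.suc-injective l)))

tgts-comps : ∀ {C} k ν (v : Vec (List C) k) → length ν ≡ length (blk k) → tgts (comps (lft ν)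
    (rgt ν) v) ≡ sel false (blk k) ν
tgts-comps zero    []          []      l = refl
tgts-comps (suc k) (x ∷ y ∷ ν) (w ∷ v) l = cong (y ∷_) (tgts-comps k ν v (ℕ.suc-injective (ℕ.suc-injective l)))

overFin-lft : ∀ k ν → length ν ≡ length (blk k) → overFin k (λ i → [ lft ν i ]) ≡ sel true (blk k) ν
overFin-lft zero    []          l = refl
overFin-lft (suc k) (x ∷ y ∷ ν) l = cong (x ∷_) (overFin-lft k ν (ℕ.suc-injective (ℕ.suc-injective l)))

overFin-rgt : ∀ k ν → length ν ≡ length (blk k) → overFin k (λ i → [ rgt ν i ]) ≡ sel false (blk k) ν
overFin-rgt zero    []          l = refl
overFin-rgt (suc k) (x ∷ y ∷ ν) l = cong (y ∷_) (overFin-rgt k ν (ℕ.suc-injective (ℕ.suc-injective l)))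

overFin-both : ∀ k ν → length ν ≡ length (blk k) → overFin k (λ i → lft ν i ∷ rgt ν i ∷ []) ≡ ν
overFin-both zero    []          l = refl
overFin-both (suc k) (x ∷ y ∷ ν) l = cong (λ z → x ∷ y ∷ z) (overFin-both k ν (ℕ.suc-injective (ℕ.suc-injective l)))

comps-ends : ∀ {C} k ν (v : Vec (List C) k) → length ν ≡ length (blk k) → ends (comps (lft ν) (rgt ν) v) ↭ ν
comps-ends k ν v l = ↭-trans (↭-reflexive (cong₂ _++_ (srcs-comps k ν v l) (tgts-comps k ν v l))) (sel-all
    (blk k) ν l)

module Wiring {t n : ℕ} (ar : Fin n → ℕ) {body : List (Fin n)} where
  open Vars ar

  -- wire l acc s r is a path from l to r labelled acc s, interrupted at each variable x of s by the gap from inn x to out x.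
  wire : (inn out : Var body → ℕ) → ℕ → Word t → List (Sym t ar body) → ℕ → Soup (Fin t)
  wire inn out l acc []            r = [ ed l acc r ]
  wire inn out l acc (term a ∷ s)  r = wire inn out l (acc ++ [ a ]) s r
  wire inn out l acc (var j i ∷ s) r = ed l acc (inn (j ▹ i)) ∷ wire inn out (out (j ▹ i)) [] s r

  wires : ∀ {k} (inn out : Var body → ℕ) → (L R : Fin k → ℕ) → Vec (List (Sym t ar body)) k → Soup (Fin t)
  wires inn out L R []       = []
  wires inn out L R (s ∷ ss) = wire inn out (L zero) [] s (R zero) ++ wires inn out (λ i → L (suc i)) (λ i → R
      (suc i)) ss

  fill : (Var body → Word t) → List (Sym t ar body) → Word t
  fill val []            = []
  fill val (term a ∷ s)  = a ∷ fill val s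
  fill val (var j i ∷ s) = val (j ▹ i) ++ fill val s

  wire-cong : ∀ {inn inn′ out out′ : Var body → ℕ} {l l′ r r′} acc s → (∀ x → inn x ≡ inn′ x) →
      (∀ x → out x ≡ out′ x) →
              l ≡ l′ → r ≡ r′ → wire inn out l acc s r ≡ wire inn′ out′ l′ acc s r′
  wire-cong acc []            p q refl refl = refl
  wire-cong acc (term a ∷ s)  p q e e′ = wire-cong (acc ++ [ a ]) s p q e e′
  wire-cong acc (var j i ∷ s) p q refl e′ = cong₂ _∷_ (cong (ed _ acc) (p (j ▹ i))) (wire-cong [] s p q (q
      (j ▹ i)) e′)

  wires-cong : ∀ {k} {inn inn′ out out′ : Var body → ℕ} {L L′ R R′ : Fin k → ℕ} ss → (∀ x → inn x ≡ inn′ x) →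
      (∀ x → out x ≡ out′ x) →
               (∀ i → L i ≡ L′ i) → (∀ i → R i ≡ R′ i) → wires inn out L R ss ≡ wires inn′ out′ L′ R′ ss
  wires-cong []       p q e e′ = refl
  wires-cong (s ∷ ss) p q e e′ = cong₂ _++_ (wire-cong [] s p q (e zero) (e′ zero)) (wires-cong ss p q (λ i → e
      (suc i)) (λ i → e′ (suc i)))

  mapV-wire : ∀ f {inn out} l acc s r → mapV f (wire inn out l acc s r) ≡ wire (f ∘ inn) (f ∘ out) (f l) acc s (f r)
  mapV-wire f l acc []            r = refl
  mapV-wire f l acc (term a ∷ s)  r = mapV-wire f l (acc ++ [ a ]) s r
  mapV-wire f l acc (var j i ∷ s) r = cong (_ ∷_) (mapV-wire f _ [] s r)

  mapV-wires : ∀ f {k inn out} (L R : Fin k → ℕ) ss → mapV f (wires inn out L R ss) ≡ wires (f ∘ inn) (f ∘ out)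
      (f ∘ L) (f ∘ R) ss
  mapV-wires f L R []       = refl
  mapV-wires f {inn = inn} {out} L R (s ∷ ss) = trans (List.map-++ _ (wire inn out (L zero) [] s (R zero)) _)
    (cong₂ _++_ (mapV-wire f (L zero) [] s (R zero)) (mapV-wires f _ _ ss))

  module _ (inn out : Var body → ℕ) where

    srcs-wire : ∀ l acc s r → srcs (wire inn out l acc s r) ≡ l ∷ map out (vars s)
    srcs-wire l acc []            r = refl
    srcs-wire l acc (term a ∷ s)  r = srcs-wire l (acc ++ [ a ]) s r
    srcs-wire l acc (var j i ∷ s) r = cong (l ∷_) (srcs-wire _ [] s r)

    tgts-wire : ∀ l acc s r → tgts (wire inn out l acc s r) ≡ map inn (vars s) ++ [ r ]
    tgts-wire l acc []            r = refl
    tgts-wire l acc (term a ∷ s)  r = tgts-wire l (acc ++ [ a ]) s r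
    tgts-wire l acc (var j i ∷ s) r = cong (_ ∷_) (tgts-wire _ [] s r)

    srcs-wires : ∀ {k} (L R : Fin k → ℕ) ss → srcs (wires inn out L R ss) ↭ overFin k (λ i → [ L i ]) ++ map out
        (vars (concat (toList ss)))
    srcs-wires L R []       = refl
    srcs-wires {suc k} L R (s ∷ ss) = ↭-trans (↭-reflexive (List.map-++ esrc (wire inn out (L zero) [] s
        (R zero)) _))
      (↭-trans (++⁺ (↭-reflexive (srcs-wire (L zero) [] s (R zero))) (srcs-wires _ _ ss))
        (↭-trans (prep _ (shifts (map out (vars s)) (overFin k _)))
          (prep _ (++⁺ˡ (overFin k _) (↭-reflexive (sym (trans (cong (map out) (vars-++ s _)) (List.map-++ out
              (vars s) _))))))))

    tgts-wires : ∀ {k} (L R : Fin k → ℕ) ss → tgts (wires inn out L R ss) ↭ overFin k (λ i → [ R i ]) ++ map inn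
        (vars (concat (toList ss)))
    tgts-wires L R []       = refl
    tgts-wires {suc k} L R (s ∷ ss) = ↭-trans (↭-reflexive (List.map-++ etgt (wire inn out (L zero) [] s
        (R zero)) _))
      (↭-trans (++⁺ (↭-reflexive (tgts-wire (L zero) [] s (R zero))) (tgts-wires _ _ ss))
        (↭-trans (solve 4 (λ a b c d → (a ⊕ b) ⊕ (c ⊕ d) ⊜ b ⊕ c ⊕ a ⊕ d) ↭-refl (map inn (vars s)) [ R zero ]
            (overFin k _) _)
          (prep _ (++⁺ˡ (overFin k _) (↭-reflexive (sym (trans (cong (map inn) (vars-++ s _)) (List.map-++ inn
              (vars s) _))))))))

    module _ (val : Var body → Word t) where
      bridge : Var body → Ed (Fin t)
      bridge x = ed (inn x) (val x) (out x)

      gap : Var body → List ℕ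
      gap x = inn x ∷ out x ∷ []

      -- The start `l` and the accumulator affect the first edge only, so a word merged in front of
      -- a wire can be moved into the accumulator.
      wire-head : ∀ s r → ∃₂ λ w x → ∃ λ E → ∀ acc l → wire inn out l acc s r ≡ ed l (acc ++ w) x ∷ E
      wire-head []            r = [] , r , [] , λ acc l → cong (λ z → [ ed l z r ]) (sym (List.++-identityʳ acc))
      wire-head (term a ∷ s)  r with w , x , E , h ← wire-head s r =
        a ∷ w , x , E , λ acc l → trans (h (acc ++ [ a ]) l) (cong (λ z → ed l z x ∷ E) (List.++-assoc acc [ a ] w))
      wire-head (var j i ∷ s) r = [] , _ , _ , λ acc l → cong (λ z → ed l z _ ∷ _) (sym (List.++-identityʳ acc))

      -- Each gap is closed by two merges, at `inn x` and `out x`. Afterwards the wire is the one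
      -- for the rest of `s` with `val x` appended to the accumulator.
      wire-elim : ∀ l acc s r → Elim (wire inn out l acc s r ++ map bridge (vars s)) (concatMap gap
          (vars s)) [ ed l (acc ++ fill val s) r ]
      wire-elim l acc []            r = done (↭-reflexive (cong (λ z → [ ed l z r ]) (sym (List.++-identityʳ acc))))
      wire-elim l acc (term a ∷ s)  r = subst (λ z → Elim (wire inn out l (acc ++ [ a ]) s r ++ map bridge
          (vars s)) (concatMap gap (vars s)) [ ed l z r ])
        (List.++-assoc acc [ a ] (fill val s)) (wire-elim l (acc ++ [ a ]) s r)
      wire-elim l acc (var j i ∷ s) r with w , x , E , h ← wire-head s r rewrite h [] (out (j ▹ i)) =
        merge (prep _ (shift (bridge (j ▹ i)) (ed (out (j ▹ i)) w x ∷ E) (map bridge (vars s))))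
          (merge refl (subst₂ (λ y z → Elim (y ++ map bridge (vars s)) (concatMap gap (vars s)) [ ed l z r ])
            (h (acc ++ val (j ▹ i)) l) (List.++-assoc acc _ (fill val s)) (wire-elim l (acc ++ val (j ▹ i)) s r)))

      wires-elim : ∀ {k} (L R : Fin k → ℕ) ss → Elim (wires inn out L R ss ++ map bridge (vars (concat
          (toList ss))))
                   (concatMap gap (vars (concat (toList ss)))) (comps L R (Vec.map (fill val) ss))
      wires-elim L R []       = done refl
      wires-elim {suc k} L R (s ∷ ss) = subst₂ (λ y z → Elim ((W ++ Ws) ++ y) z (comps L R (Vec.map (fill val)
          (s ∷ ss))))
          (sym (trans (cong (map bridge) (vars-++ s s′)) (List.map-++ bridge (vars s) (vars s′))))
          (sym (trans (cong (concatMap gap) (vars-++ s s′)) (List.concatMap-++ gap (vars s) (vars s′))))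
          (Elim-respˡ (solve 4 (λ a b c d → (a ⊕ b) ⊕ (c ⊕ d) ⊜ (a ⊕ c) ⊕ (b ⊕ d)) ↭-refl W Ws (map bridge
              (vars s)) (map bridge (vars s′)))
            (Elim-par (wire-elim (L zero) [] s (R zero)) (wires-elim (λ i → L (suc i)) (λ i → R (suc i)) ss)))
        where
        W = wire inn out (L zero) [] s (R zero)
        Ws = wires inn out (λ i → L (suc i)) (λ i → R (suc i)) ss
        s′ = concat (toList ss)

module Multicut {t : ℕ} (G : LLG t) where
  open LLG G
  open Interp bnd
  open Named G

  -- The syntactic counterpart of `Test`: derivations of the duals instead of covalues.
  Closed : Ctx → Soup (Fin t) → Set
  Closed []       F = F ↭ []
  Closed (b ∷ Bs) F = ∃₂ λ F₁ F₂ → F ↭ F₁ ++ F₂ × (∃ λ l → NDer [ nf (fm b ^⊥) (reverse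
      (nms b)) l ] F₁) × Closed Bs F₂

  Closed-ends : ∀ Bs {F} → Closed Bs F → ends F ↭ nm Bs
  Closed-ends []       p = ends-↭ p
  Closed-ends (b ∷ Bs) (F₁ , F₂ , p , (l , d) , c) = ↭-trans (ends-↭ p) (↭-trans (ends-++ F₁ F₂)
    (↭-trans (++⁺ (↭-trans (NDer⇒ends d) (↭-reverse (nms b))) (Closed-ends Bs c)) (++-comm (nms b) (nm Bs))))

  multicut : ∀ Bs {Θ E F H} → Unique (nm (Bs ++ Θ)) → NDer (Bs ++ Θ) E → Closed Bs F → Elim (E ++ F)
      (nm Bs) H → NDer Θ H
  multicut [] {E = E} u d c (done p) = nresp (↭-trans (↭-sym (↭-trans (++⁺ˡ E c) (++-identityʳ E))) p) d
  multicut (b ∷ Bs) {Θ} {E} {F} u d (F₁ , F₂ , p , (l , d′) , c) k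
    with H′ , k₁ , k₂ ← peel (E ++ F₁) F₂ (nms b) {nm Bs} {nm (Bs ++ Θ)} k
           (↭-trans (++⁺ˡ E p) (↭-sym (++-assoc E F₁ F₂))) (++-comm (nm Bs) (nms b))
           (Unique-resp-↭ (++-comm (nm (Bs ++ Θ)) (nms b)) u)
           (λ z∈ → ∈-resp-↭ (↭-sym (nm-++-↭ Bs Θ)) (∈-++⁺ˡ (∈-resp-↭ (Closed-ends Bs c) z∈))) =
    multicut Bs (Unique-++ˡ (nm (Bs ++ Θ)) u)
      (subst (λ Z → NDer Z H′) (List.++-identityʳ (Bs ++ Θ))
        (ncut d d′ (Unique-resp-↭ (↭-trans (++-comm (nm (Bs ++ Θ)) (nms b)) (++⁺ˡ (nms b) (↭-sym
            (++-identityʳ _)))) u) k₁)) c k₂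

nmL : List (List ℕ) → List ℕ
nmL []       = []
nmL (β ∷ βs) = nmL βs ++ β

nmL-length : ∀ βs γs → map length βs ≡ map length γs → length (nmL βs) ≡ length (nmL γs)
nmL-length []       []       p = refl
nmL-length (β ∷ βs) (γ ∷ γs) p with p₁ , p₂ ← List.∷-injective p =
  trans (List.length-++ (nmL βs)) (trans (cong₂ _+_ (nmL-length βs γs p₂) p₁) (sym (List.length-++ (nmL γs))))

-- The lengths of the blocks determine where the flattened list is cut.
nmL-blocks : ∀ (f : ℕ → ℕ) βs γs → map length βs ≡ map length γs → map f (nmL βs) ≡ nmL γs → map (map f) βs ≡ γs
nmL-blocks f []       []       p eq = refl
nmL-blocks f (β ∷ βs) (γ ∷ γs) p eq
  with p₁ , p₂ ← List.∷-injective p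
  with e₁ , e₂ ← ++-injective (map f (nmL βs)) (nmL γs) (trans (List.length-map f (nmL βs)) (nmL-length βs γs p₂))
      (trans (sym (List.map-++ f (nmL βs) β)) eq) =
  cong₂ _∷_ e₂ (nmL-blocks f βs γs p₂ e₁)

βat : List (List ℕ) → ∀ {m} → Fin m → List ℕ
βat []       _       = []
βat (β ∷ βs) zero    = β
βat (β ∷ βs) (suc j) = βat βs j

unname : ∀ {t} → Ed (Fin t) → Edge t
unname (ed u w v) = edge u w v

rn-unname : ∀ {t} ν (E : Soup (Fin t)) → rn ν (map unname E) ≡ mapV (nth ν) E
rn-unname ν []             = refl
rn-unname ν (ed u w v ∷ E) = cong (_ ∷_) (rn-unname ν E)

-- The grammar of an MCFG.

module FromMCFG {t : ℕ} (M : MCFG t) where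
  open MCFG M renaming (n to N)
  open Production
  open Vars arity
  open Wiring {t} arity

  bnd : Fin N → Boundary
  bnd A = blk (arity A)

  -- The block of a negative literal lists the vertices of its nonterminal backwards; reversing it
  -- restores the pairs, so a wire enters component i at its left endpoint and leaves at its right
  -- one.
  inn out : ∀ {body} → List (List ℕ) → Var body → ℕ
  inn βs (j ▹ i) = lft (reverse (βat βs j)) i
  out βs (j ▹ i) = rgt (reverse (βat βs j)) i

  lexSoup : (p : Production t N arity) → List ℕ → List (List ℕ) → Soup (Fin t)
  lexSoup p α βs = wires (inn βs) (out βs) (lft α) (rgt α) (rhs p)

  seqOf : Production t N arity → List (Formula N)
  seqOf p = pos (head p) ∷ map neg (body p)

  -- Building the lexicon requires named contexts, which themselves belong to a grammar. The circle
  -- is broken by naming over the grammar with empty lexicon, with the same boundaries.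
  withLex : List (Interp.Judgement bnd t) → LLG t
  withLex Lex = record { n = N ; bnd = bnd ; Lex = Lex ; S = S ; S-ok = inj₁ (cong blk S-unary) }

  module Ports (Lex : List (Interp.Judgement bnd t)) where
    open Interp bnd
    open Named (withLex Lex)

    len⊥ : ∀ {b} {β : List ℕ} → length β ≡ sz (neg b) → length (reverse β) ≡ length (blk (arity b))
    len⊥ {b} {β} l = trans (List.length-reverse β) (trans l (sz-⊥ (pos b)))

    outs : ∀ body Bs → fms Bs ≡ map neg body → overVars body (λ x → [ out (map nms Bs) x ]) ↭ csel true Bs
    outs []         []                eq = refl
    outs (b ∷ body) (nf _ β l ∷ Bs) eq with refl , eq′ ← List.∷-injective eq =
      ++⁺ (↭-trans (↭-reflexive (overFin-rgt (arity b) (reverse β) (len⊥ {b} {β} l))) (↭-sym (sel-⊥′ true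
          (pos b) β l))) (outs body Bs eq′)

    inns : ∀ body Bs → fms Bs ≡ map neg body → overVars body (λ x → [ inn (map nms Bs) x ]) ↭ csel false Bs
    inns []         []                eq = refl
    inns (b ∷ body) (nf _ β l ∷ Bs) eq with refl , eq′ ← List.∷-injective eq =
      ++⁺ (↭-trans (↭-reflexive (overFin-lft (arity b) (reverse β) (len⊥ {b} {β} l))) (↭-sym (sel-⊥′ false
          (pos b) β l))) (inns body Bs eq′)

    gaps : ∀ body Bs → fms Bs ≡ map neg body →
           overVars body (λ x → inn (map nms Bs) x ∷ out (map nms Bs) x ∷ []) ↭ nm Bs
    gaps []         []                eq = refl
    gaps (b ∷ body) (nf _ β l ∷ Bs) eq with refl , eq′ ← List.∷-injective eq =
      ↭-trans (++⁺ (↭-trans (↭-reflexive (overFin-both (arity b) (reverse β) (len⊥ {b} {β} l))) (↭-reverse β))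
          (gaps body Bs eq′))
        (++-comm β (nm Bs))

    lexSoup-match : ∀ p {a Bs} → fms (a ∷ Bs) ≡ seqOf p → MatchC (a ∷ Bs) (lexSoup p (nms a) (map nms Bs))
    lexSoup-match p {nf _ α l} {Bs} eq with refl , eq′ ← List.∷-injective eq =
        ↭-trans (srcs-wires _ _ (lft α) (rgt α) (rhs p)) (++⁺ (↭-reflexive (overFin-lft k α l))
          (↭-trans (map⁺ _ lin) (↭-trans (↭-reflexive (overVars-map _ (body p) [_])) (outs (body p) Bs eq′))))
      , ↭-trans (tgts-wires _ _ (lft α) (rgt α) (rhs p)) (++⁺ (↭-reflexive (overFin-rgt k α l))
          (↭-trans (map⁺ _ lin) (↭-trans (↭-reflexive (overVars-map _ (body p) [_])) (inns (body p) Bs eq′))))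
      where
      k = arity (head p)
      lin = linear⇒↭ (concat (toList (rhs p))) (linear p)

    nm-nmL : ∀ Γ → nm Γ ≡ nmL (map nms Γ)
    nm-nmL []      = refl
    nm-nmL (a ∷ Γ) = cong (_++ nms a) (nm-nmL Γ)

    lengths : ∀ Γ → map length (map nms Γ) ≡ map sz (fms Γ)
    lengths []      = refl
    lengths (a ∷ Γ) = cong₂ _∷_ (len a) (lengths Γ)

  open Interp bnd

  private
    module N₀ = Named (withLex [])
    module P₀ = Ports []

  canonical : (p : Production t N arity) →
    ∃ λ Γ → N₀.fms Γ ≡ seqOf p × N₀.nm Γ ≡ range 1 (szs (seqOf p))
  canonical p = N₀.nameCtx (seqOf p) (range 1 (szs (seqOf p))) (length-range 1 _)

  first : List (List ℕ) → List ℕ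
  first []      = []
  first (α ∷ _) = α

  others : List (List ℕ) → List (List ℕ)
  others []       = []
  others (_ ∷ βs) = βs

  -- Under the canonical names a name is a position, so the soup of wires is read directly as a
  -- numbered multiword.
  lexEdges : (p : Production t N arity) → List (Edge t)
  lexEdges p = let ns = map N₀.nms (proj₁ (canonical p)) in map unname (lexSoup p (first ns) (others ns))

  lexEdges-good : ∀ p → Good ⟦ seqOf p ⟧ˢ (lexEdges p)
  lexEdges-good p with canonical p
  ... | a ∷ Bs , eq , eq′ with m₁ , m₂ ← P₀.lexSoup-match p {a} {Bs} eq =
      ↭-trans (↭-reflexive (sym (List.map-∘ _))) (↭-trans (↭-reflexive (List.map-cong (λ { (ed _ _ _) → refl }) _))
          (↭-trans m₁ (conv true)))
    , ↭-trans (↭-reflexive (sym (List.map-∘ _))) (↭-trans (↭-reflexive (List.map-cong (λ { (ed _ _ _) → refl }) _))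
        (↭-trans m₂ (conv false)))
    where
    conv : ∀ b → N₀.csel b (a ∷ Bs) ↭ sel b ⟦ seqOf p ⟧ˢ (range 1 (szs (seqOf p)))
    conv b = ↭-trans (N₀.csel-sel b (a ∷ Bs)) (↭-reflexive (cong₂ (λ X ν → sel b ⟦ X ⟧ˢ ν) eq eq′))

  lexOf : Production t N arity → Judgement t
  lexOf p = record { seq = seqOf p ; word = mw (lexEdges p) [] ; isMW = Good⇒IsMultiword {X = ⟦ seqOf p ⟧ˢ} {mw
      (lexEdges p) []} (lexEdges-good p) }

  G : LLG t
  G = withLex (map lexOf prods)

  open Named G
  open Ports (map lexOf prods)

  -- Naming the entry is a renaming of the canonical soup; it commutes with `wires` and carries each
  -- canonical block to the corresponding block of the new names.
  lexEdges-named : ∀ p {a Bs} → fms (a ∷ Bs) ≡ seqOf p → rn (nm (a ∷ Bs)) (lexEdges p) ≡ lexSoup p (nms a)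
      (map nms Bs)
  lexEdges-named p {nf _ α l} {Bs} eq with canonical p
  ... | N₀.nf _ α₀ l₀ ∷ Bs₀ , eq₀ , eq₀′ with refl , eqB ← List.∷-injective eq | refl , eqB₀ ← List.∷-injective eq₀
      =
    trans (rn-unname ν (lexSoup p α₀ (map N₀.nms Bs₀))) (trans (mapV-wires (nth ν) (lft α₀) (rgt α₀) (rhs p))
      (wires-cong (rhs p) (λ x → in≡ x) (λ x → out≡ x)
        (λ i → trans (sym (lft-map (nth ν) k α₀ l₀ i)) (cong (λ z → lft z i) (proj₁ blocks)))
        (λ i → trans (sym (rgt-map (nth ν) k α₀ l₀ i)) (cong (λ z → rgt z i) (proj₁ blocks)))))
    where
    ν = nm Bs ++ α
    k = arity (head p)
    names : map (nth ν) (nmL (map N₀.nms Bs₀) ++ α₀) ≡ nmL (map nms Bs) ++ α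
    names = trans (cong (map (nth ν)) (trans (cong (_++ α₀) (sym (P₀.nm-nmL Bs₀))) eq₀′))
      (trans (cong (map (nth ν) ∘ range 1) (sym (trans (length-nm (nf (pos (head p)) α l ∷ Bs)) (cong szs eq))))
        (trans (map-nth-range ν) (cong (_++ α) (nm-nmL Bs))))
    blocks = List.∷-injective (nmL-blocks (nth ν) (α₀ ∷ map N₀.nms Bs₀) (α ∷ map nms Bs)
      (cong₂ _∷_ (trans l₀ (sym l)) (trans (P₀.lengths Bs₀) (trans (cong (map sz) (trans eqB₀ (sym eqB))) (sym
          (lengths Bs))))) names)
    port : ∀ (f : ℕ → ℕ) body Bs₀ Bs → N₀.fms Bs₀ ≡ map neg body → map (map f) (map N₀.nms Bs₀) ≡ map nms Bs →
        (x : Var body) →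
           f (inn (map N₀.nms Bs₀) x) ≡ inn (map nms Bs) x × f (out (map N₀.nms Bs₀) x) ≡ out (map nms Bs) x
    port f (b ∷ body) (N₀.nf _ β₀ l ∷ Bs₀) (nf _ β _ ∷ Bs) eq e
        (zero ▹ i) with refl , _ ← List.∷-injective eq | refl , _ ← List.∷-injective e =
        trans (sym (lft-map f (arity b) (reverse β₀) (P₀.len⊥ {b} {β₀} l) i)) (cong (λ z → lft z i)
            (List.reverse-map f β₀))
      , trans (sym (rgt-map f (arity b) (reverse β₀) (P₀.len⊥ {b} {β₀} l) i)) (cong (λ z → rgt z i)
          (List.reverse-map f β₀))
    port f (b ∷ body) (_ ∷ Bs₀) (_ ∷ Bs) eq e (suc j ▹ i) =
      port f body Bs₀ Bs (proj₂ (List.∷-injective eq)) (proj₂ (List.∷-injective e)) (j ▹ i)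
    in≡ : ∀ x → nth ν (inn (map N₀.nms Bs₀) x) ≡ inn (map nms Bs) x
    in≡ x = proj₁ (port (nth ν) (body p) Bs₀ Bs eqB₀ (proj₂ blocks) x)
    out≡ : ∀ x → nth ν (out (map N₀.nms Bs₀) x) ≡ out (map nms Bs) x
    out≡ x = proj₂ (port (nth ν) (body p) Bs₀ Bs eqB₀ (proj₂ blocks) x)

  valOf : ∀ {body : List (Fin N)} → ((j : Fin (length body)) → Vec (Word t) (arity
      (lookup body j))) → Var body → Word t
  valOf args (j ▹ i) = Vec.lookup (args j) i

  fill-subst : ∀ p args s → substSym M p args s ≡ fill (valOf args) s
  fill-subst p args []            = refl
  fill-subst p args (term a ∷ s)  = cong (a ∷_) (fill-subst p args s)
  fill-subst p args (var j i ∷ s) = cong (Vec.lookup (args j) i ++_) (fill-subst p args s)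

  bridges : ∀ (body : List (Fin N)) (βs : List (List ℕ)) → (Var body → Word t) → Soup (Fin t)
  bridges body βs val = overVars body λ x → [ bridge (inn βs) (out βs) val x ]

  lex-elim : ∀ p {a Bs} args → fms (a ∷ Bs) ≡ seqOf p →
    Elim (lexSoup p (nms a) (map nms Bs) ++ bridges (body p) (map nms Bs) (valOf args)) (nm Bs)
         (comps (lft (nms a)) (rgt (nms a)) (Vec.map (substSym M p args) (rhs p)))
  lex-elim p {nf _ α l} {Bs} args eq with refl , eqB ← List.∷-injective eq =
    subst (λ v → Elim (lexSoup p α βs ++ bridges (body p) βs (valOf args)) (nm Bs) (comps (lft α) (rgt α) v)) (sym
        (Vec.map-cong (fill-subst p args) (rhs p)))
      (Elim-respˡ (++⁺ˡ (lexSoup p α βs) (↭-sym (↭-trans (map⁺ _ lin) (↭-reflexive (overVars-map _ (body p) [_])))))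
        (Elim-perm (↭-trans (concatMap-↭ _ lin) (↭-trans (↭-reflexive (concatMap-allVars (body p) _)) (gaps
            (body p) Bs eqB)))
          (wires-elim (inn βs) (out βs) (valOf args) (lft α) (rgt α) (rhs p))))
    where
    βs = map nms Bs
    lin = linear⇒↭ (concat (toList (rhs p))) (linear p)

  -- There are no covalues: a root at a negative literal would need one as a test.
  D : Bool → Fin N → List ℕ → Soup (Fin t) → Set
  D true  A ν E = ∃ λ v → MDerivable M A v × length ν ≡ length (bnd A) × E ↭ comps (lft ν) (rgt ν) v
  D false A ν E = ⊥

  D-resp : ∀ {b P ν E F} → E ↭ F → D b P ν E → D b P ν F
  D-resp {true} p (v , d , l , q) = v , d , l , ↭-trans (↭-sym p) q

  D-ends : ∀ {b P ν E} → D b P ν E → ends E ↭ ν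
  D-ends {true} {P} {ν} (v , _ , l , q) = ↭-trans (ends-↭ q) (comps-ends (arity P) ν v l)

  D-rename : ∀ {b P ν E} f → D b P ν E → D b P (map f ν) (mapV f E)
  D-rename {true} {P} {ν} f (v , d , l , q) = v , d , trans (List.length-map f ν) l ,
    ↭-trans (map⁺ _ q) (↭-reflexive (trans (mapV-comps f (lft ν) (rgt ν) v)
      (comps-cong v (λ i → sym (lft-map f (arity P) ν l i)) (λ i → sym (rgt-map f (arity P) ν l i)))))

  open Semantics G D (λ {b} {P} → D-resp {b} {P}) (λ {b} {P} → D-ends {b} {P}) (λ {b} {P} → D-rename {b} {P})

  Args : List (Fin N) → Set
  Args body = (j : Fin (length body)) → Vec (Word t) (arity (lookup body j))

  consArgs : ∀ {b body} → Vec (Word t) (arity b) → Args body → Args (b ∷ body)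
  consArgs v args zero    = v
  consArgs v args (suc j) = args j

  tests⇒args : ∀ body Bs {F} → fms Bs ≡ map neg body → Test Bs F →
    ∃ λ (args : Args body) → (∀ j → MDerivable M (lookup body j) (args j)) × F ↭ bridges body (map nms Bs)
        (valOf args)
  tests⇒args [] [] eq t = (λ ()) , (λ ()) , t
  tests⇒args (b ∷ body) (nf _ β _ ∷ Bs) eq (F₁ , F₂ , p , c , t) with refl , eq′ ← List.∷-injective eq
    with v , d , l , q ← c with args , ds , r ← tests⇒args body Bs eq′ t =
    consArgs v args , (λ { zero → d ; (suc j) → ds j }) ,
    ↭-trans p (++⁺ (↭-trans q (↭-reflexive (comps-overFin (lft (reverse β)) (rgt (reverse β)) v))) r)

  lex-valid : ∀ {j Γ} → j ∈ map lexOf prods → cyc (Judgement.word j) ≡ [] → fms Γ ≡ Judgement.seq j → Unique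
      (nm Γ) →
              Valid Γ (rn (nm Γ) (reg (Judgement.word j)))
  lex-valid {Γ = []} j∈ _ eq u with _ , _ , refl ← ∈-map⁻ lexOf j∈ with () ← eq
  lex-valid {Γ = nf _ α l ∷ Bs} j∈ _ eq u {b} {Θ} {F} {H} q t k with p , p∈ , refl ← ∈-map⁻ lexOf j∈
    with refl , eqB ← List.∷-injective eq with ∷-↭-inv q
  -- If the output is not the head, then the head is tested, by a member of the empty `D false`.
  ... | inj₂ (zs , _ , r) with _ , _ , _ , () , _ ← Test-↭ r t
  -- The tests are derivable tuples. The given elimination and `lex-elim` start from the same soup,
  -- so by determinism the result is the tuple produced by the rule.
  ... | inj₁ (refl , r) with args , ds , f ← tests⇒args (body p) Bs eqB (Test-↭ (↭-sym r) t) =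
    _ , rule p p∈ args ds , l , Elim-deterministic usrc utgt k′ el
    where
    a = nf (pos (head p)) α l
    el = lex-elim p {a} {Bs} args eq
    k′ : Elim (lexSoup p α (map nms Bs) ++ bridges (body p) (map nms Bs) (valOf args)) (nm Bs) H
    k′ = Elim-respˡ (↭-trans (++⁺ʳ _ (↭-reflexive (sym (lexEdges-named p {a} {Bs} eq)))) (++⁺ˡ (rn (nm Bs ++ α)
        (lexEdges p)) (↭-sym f)))
           (Elim-perm (nm-↭ (↭-sym r)) k)
    v′ = Vec.map (substSym M p args) (rhs p)
    ce = comps-ends (arity (head p)) α v′ l
    cs : ∀ {xs} → (∀ {z} → z ∈ xs → z ∈ ends (comps (lft α) (rgt α) v′)) → Unique xs → Unique (nm Bs ++ xs)
    cs f ux = Uniq.++⁺ (Unique-++ˡ (nm Bs) u) ux λ { (x∈ , y∈) → Unique-disjoint (nm Bs) u x∈ (∈-resp-↭ ce (f y∈)) }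
    uc : Unique (ends (comps (lft α) (rgt α) v′))
    uc = Unique-resp-↭ (↭-sym ce) (Unique-++ʳ (nm Bs) u)
    usrc = Unique-resp-↭ (↭-sym (Elim-srcs el)) (cs ∈-++⁺ˡ (Unique-++ˡ _ uc))
    utgt = Unique-resp-↭ (↭-sym (Elim-tgts el)) (cs (∈-++⁺ʳ (srcs (comps (lft α) (rgt α) v′))) (Unique-++ʳ (srcs
        (comps (lft α) (rgt α) v′)) uc))

  lenS : ∀ (ν : List ℕ) → length ν ≡ 2 → length ν ≡ sz (pos S)
  lenS ν l = trans l (cong (length ∘ blk) (sym S-unary))

  LLG⊆MCFG : ∀ w → LLG-L G w → MCFG-L M w
  LLG⊆MCFG w (σ , d , c , i , j , eq)
    with v , m , l , q ← sound lex-valid (⊩⇒NDer d c {[ nf (pos S) (1 ∷ 2 ∷ []) (lenS (1 ∷ 2 ∷ []) refl) ]} refl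
        (range-unique 1 2)) (range-unique 1 2)
                           {Θ = []} {[]} refl refl (done (++-identityʳ _)) =
    v , m , single (arity S) v S-unary (subst (λ r → rn (1 ∷ 2 ∷ []) r ↭ comps (lft (1 ∷ 2 ∷ [])) (rgt
        (1 ∷ 2 ∷ [])) v) eq q)
    where
    single : ∀ k (v : Vec (Word t) k) → k ≡ 1 → rn (1 ∷ 2 ∷ []) [ edge i w j ] ↭ comps (lft (1 ∷ 2 ∷ [])) (rgt
        (1 ∷ 2 ∷ [])) v → toList v ≡ [ w ]
    single _ (w′ ∷ []) refl p = cong [_] (sym (cong elbl (proj₁ (List.∷-injective (↭-singleton-inv p)))))

  open Multicut G
  open Complete G using (NDer⇒Der)

  closed-args : ∀ body Bs (args : Args body) → fms Bs ≡ map neg body → Unique (nm Bs) →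
    (∀ j ν l → Unique ν → NDer [ nf (pos (lookup body j)) ν l ] (comps (lft ν) (rgt ν) (args j))) →
    Closed Bs (bridges body (map nms Bs) (valOf args))
  closed-args [] [] args eq u h = refl
  closed-args (b ∷ body) (nf _ β l ∷ Bs) args eq u h with refl , eq′ ← List.∷-injective eq =
    _ , _ , refl , (len⊥ {b} {β} l , nresp (↭-reflexive (comps-overFin (lft (reverse β)) (rgt (reverse β))
        (args zero)))
      (h zero (reverse β) (len⊥ {b} {β} l) (Unique-resp-↭ (↭-sym (↭-reverse β)) (Unique-++ʳ (nm Bs) u)))) ,
    closed-args body Bs (λ j → args (suc j)) eq′ (Unique-++ˡ (nm Bs) u) (λ j → h (suc j))

  -- All names are allowed because the derivation of a premise must be placed on the reversed block
  -- of the negative literal it is cut against.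
  derive : ∀ {A v} → MDerivable M A v → ∀ ν l → Unique ν → NDer [ nf (pos A) ν l ] (comps (lft ν) (rgt ν) v)
  derive (rule p p∈ args ds) ν l u with ξ , lξ , uξ ← fresh ν (szs (map neg (body p))) u
    with Bs , eqB , refl ← nameCtx (map neg (body p)) ξ lξ =
    multicut Bs (Unique-resp-↭ (nm-↭ (++-comm [ a ] Bs)) uξ)
      (nperm (++-comm [ a ] Bs) (subst (NDer (a ∷ Bs)) (lexEdges-named p {a} {Bs} eq) (nlex
          (∈-map⁺ lexOf p∈) refl eq)))
      (closed-args (body p) Bs args eqB (Unique-++ˡ (nm Bs) uξ) (λ j → derive (ds j)))
      (lex-elim p {a} {Bs} args eq)
    where
    a = nf (pos (head p)) ν l
    eq : fms (a ∷ Bs) ≡ seqOf p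
    eq = cong (_ ∷_) eqB

  MCFG⊆LLG : ∀ w → MCFG-L M w → LLG-L G w
  MCFG⊆LLG w (v , d , eq) with σ , d′ , c , q ← NDer⇒Der (derive d (1 ∷ 2 ∷ []) (lenS (1 ∷ 2 ∷ []) refl)
      (range-unique 1 2)) =
    σ , d′ , c , single (arity S) v (reg σ) eq q
    where
    single : ∀ k (v : Vec (Word t) k) es → toList v ≡ [ w ] → rn (1 ∷ 2 ∷ []) es ↭ comps (lft (1 ∷ 2 ∷ [])) (rgt
        (1 ∷ 2 ∷ [])) v →
             ∃₂ λ i j → es ≡ [ edge i w j ]
    single _ (.w ∷ []) es refl p with es | ↭-singleton-inv p
    ... | edge i _ j ∷ [] | r = i , j , cong (λ l → [ edge i l j ]) (cong elbl (proj₁ (List.∷-injective r)))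

  lex-⊗-free : ⊗-freeLex G
  lex-⊗-free = All.tabulate λ j∈ → free j∈
    where
    negs : ∀ Bs → All ⊗-free (map (neg {N}) Bs)
    negs []       = []
    negs (B ∷ Bs) = _ ∷ negs Bs
    free : ∀ {j} → j ∈ map lexOf prods → All ⊗-free (Judgement.seq j)
    free j∈ with p , _ , refl ← ∈-map⁻ lexOf j∈ = _ ∷ negs (body p)

-- From LLG to MCFG

filterE : ∀ {A : Set} {P : A → Set} → (∀ a → Dec (P a)) → List A → List (Σ A P)
filterE P? []       = []
filterE P? (x ∷ xs) with P? x
... | yes p = (x , p) ∷ filterE P? xs
... | no _  = filterE P? xs

∈-filterE : ∀ {A : Set} {P : A → Set} (P? : ∀ a → Dec (P a)) {xs x} → x ∈ xs → P x → ∃ λ p → (x , p) ∈ filterE P? xs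
∈-filterE P? {x ∷ xs} (here refl) px with P? x
... | yes p = p , here refl
... | no ¬p = ⊥-elim (¬p px)
∈-filterE P? {y ∷ xs} (there x∈) px with P? y | ∈-filterE P? x∈ px
... | yes _ | p , q = p , there q
... | no _  | r     = r

∈-bind : ∀ {A B : Set} (f : A → List B) {xs x y} → x ∈ xs → y ∈ f x → y ∈ concatMap f xs
∈-bind f x∈ y∈ = ∈-concatMap⁺ f (lose x∈ y∈)

picksE : ∀ {A : Set} (xs : List A) → List (Σ A λ a → Σ (List A) λ ys → xs ↭ a ∷ ys)
picksE []       = []
picksE (x ∷ xs) = (x , xs , refl) ∷ map (λ { (a , ys , p) → a , x ∷ ys , ↭-trans (prep x p) (swap x a refl) })
    (picksE xs)

∈-picksE′ : ∀ {A : Set} {a : A} xs → a ∈ xs → ∃₂ λ zs q → (a , zs , q) ∈ picksE xs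
∈-picksE′ (x ∷ xs) (here refl) = xs , refl , here refl
∈-picksE′ (x ∷ xs) (there a∈) with zs , q , r ← ∈-picksE′ xs a∈ = x ∷ zs , _ , there (∈-map⁺ _ r)

∈-picksE : ∀ {A : Set} {xs : List A} {a ys} → xs ↭ a ∷ ys → ∃₂ λ zs p → (a , zs , p) ∈ picksE xs × ys ↭ zs
∈-picksE {xs = xs} p with zs , q , r ← ∈-picksE′ xs (∈-resp-↭ (↭-sym p) (here refl)) =
  zs , q , r , drop-∷ (↭-trans (↭-sym p) q)

module _ {C : Set} where
  meets : ∀ {x xs} {E : Soup C} → (∀ E′ → List (Σ (Soup C) (Elim E′ xs))) → ∀ e₁ e₂ {R} → E ↭ e₁ ∷ e₂ ∷ R →
          Dec (etgt e₁ ≡ x) → Dec (esrc e₂ ≡ x) → List (Σ (Soup C) (Elim E (x ∷ xs)))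
  meets rec (ed u w _) (ed _ w′ v) {R} p (yes refl) (yes refl) = map (λ { (H , k) → H , merge p k }) (rec (ed u
      (w ++ w′) v ∷ R))
  meets rec _          _               p _          _          = []

  ∈-meets : ∀ {x xs} {E : Soup C} (rec : ∀ E′ → List (Σ (Soup C) (Elim E′ xs))) {u w w′ v R}
            (p : E ↭ ed u w x ∷ ed x w′ v ∷ R) d₁ d₂ {H k} → (H , k) ∈ rec (ed u (w ++ w′) v ∷ R) →
            (H , merge p k) ∈ meets rec (ed u w x) (ed x w′ v) p d₁ d₂
  ∈-meets rec p (yes refl) (yes refl) m = ∈-map⁺ _ m
  ∈-meets rec p (no ne)    _          m = ⊥-elim (ne refl)
  ∈-meets rec p (yes _)    (no ne)    m = ⊥-elim (ne refl)

  -- Tries all choices of two edges at each vertex. The remaining edges come in one fixed order, so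
  -- completeness holds up to permutation of the result.
  elimE : ∀ xs (E : Soup C) → List (Σ (Soup C) (Elim E xs))
  elimE []       E = [ E , done refl ]
  elimE (x ∷ xs) E = concatMap (λ { (e₁ , R₁ , p) → concatMap (λ { (e₂ , R₂ , q) →
    meets (elimE xs) e₁ e₂ (↭-trans p (prep e₁ q)) (etgt e₁ ≟ x) (esrc e₂ ≟ x) }) (picksE R₁) }) (picksE E)

  ∈-elimE : ∀ xs (E : Soup C) {H} → Elim E xs H → ∃₂ λ H′ k → (H′ , k) ∈ elimE xs E × H ↭ H′
  ∈-elimE []       E (done p) = E , done refl , here refl , ↭-sym p
  ∈-elimE (x ∷ xs) E (merge {u = u} {w} {_} {w′} {v} {R} p k)
    with R₁ , p₁ , m₁ , q₁ ← ∈-picksE p with R₂ , p₂ , m₂ , q₂ ← ∈-picksE (↭-sym q₁)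
    with H′ , k′ , m , r ← ∈-elimE xs (ed u (w ++ w′) v ∷ R₂) (Elim-respˡ (prep _ (↭-sym q₂)) k) =
    H′ , merge (↭-trans p₁ (prep _ p₂)) k′ ,
    ∈-bind _ m₁ (∈-bind _ m₂ (∈-meets (elimE xs) (↭-trans p₁ (prep _ p₂)) (x ≟ x) (x ≟ x) m)) , r

listsOf : ∀ {A : Set} → List A → ℕ → List (List A)
listsOf xs zero    = [ [] ]
listsOf xs (suc h) = concatMap (λ x → map (x ∷_) (listsOf xs h)) xs

∈-listsOf : ∀ {A : Set} {xs : List A} → (∀ a → a ∈ xs) → ∀ as → as ∈ listsOf xs (length as)
∈-listsOf all []       = here refl
∈-listsOf all (a ∷ as) = ∈-bind _ (all a) (∈-map⁺ (a ∷_) (∈-listsOf all as))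

-- Matchings of a block as patterns.

nthF : ∀ {m} → List ℕ → Fin m → ℕ
nthF []      _       = 0
nthF (x ∷ ν) zero    = x
nthF (x ∷ ν) (suc i) = nthF ν i

nthF-map : ∀ {m} f ν → length ν ≡ m → (i : Fin m) → nthF (map f ν) i ≡ f (nthF ν i)
nthF-map f (x ∷ ν) refl zero    = refl
nthF-map f (x ∷ ν) refl (suc i) = nthF-map f ν refl i

∈-nthF : ∀ {m} ν → length ν ≡ m → ∀ {x} → x ∈ ν → ∃ λ (i : Fin m) → nthF ν i ≡ x
∈-nthF (x ∷ ν) refl (here refl) = zero , refl
∈-nthF (x ∷ ν) refl (there x∈) with i , eq ← ∈-nthF ν refl x∈ = suc i , eq

-- The edges of a soup by positions in a block, without labels. The labels become the components of
-- a tuple, in the order of the list.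
Pattern : ℕ → Set
Pattern m = List (Fin m × Fin m)

module _ {m : ℕ} where
  pat : ∀ {C} → List ℕ → (p : Pattern m) → (Fin (length p) → List C) → Soup C
  pat ν []            lab = []
  pat ν ((u , v) ∷ p) lab = ed (nthF ν u) (lab zero) (nthF ν v) ∷ pat ν p (λ i → lab (suc i))

  pat-cong : ∀ {C} ν (p : Pattern m) {lab lab′ : Fin (length p) → List C} →
      (∀ i → lab i ≡ lab′ i) → pat ν p lab ≡ pat ν p lab′
  pat-cong ν []      h = refl
  pat-cong ν (_ ∷ p) h = cong₂ _∷_ (cong (λ l → ed _ l _) (h zero)) (pat-cong ν p (λ i → h (suc i)))

  mapL-pat : ∀ {C C′} (φ : C → List C′) ν (p : Pattern m) lab → mapL φ (pat ν p lab) ≡ pat ν p (concatMap φ ∘ lab)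
  mapL-pat φ ν []            lab = refl
  mapL-pat φ ν ((u , v) ∷ p) lab = cong (ed (nthF ν u) (concatMap φ (lab zero)) (nthF ν v) ∷_) (mapL-pat φ ν p
      (λ i → lab (suc i)))

  mapV-pat : ∀ {C} f ν (p : Pattern m) (lab : Fin (length p) → List C) → length ν ≡ m → mapV f (pat ν p lab) ≡ pat
      (map f ν) p lab
  mapV-pat f ν []            lab l = refl
  mapV-pat f ν ((u , v) ∷ p) lab l = cong₂ _∷_ (cong₂ (λ x y → ed x (lab zero) y) (sym (nthF-map f ν l u)) (sym
      (nthF-map f ν l v)))
    (mapV-pat f ν p _ l)

  labels-pat : ∀ {C} ν (p : Pattern m) (lab : Fin (length p) → List C) → concatMap elbl (pat ν p lab) ≡ overFin
      (length p) lab
  labels-pat ν []      lab = refl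
  labels-pat ν (_ ∷ p) lab = cong (lab zero ++_) (labels-pat ν p _)

  length-pat : ∀ {C} ν (p : Pattern m) (lab : Fin (length p) → List C) → length (pat ν p lab) ≡ length p
  length-pat ν []      lab = refl
  length-pat ν (_ ∷ p) lab = cong suc (length-pat ν p _)

labelAt : ∀ {C m} → Soup C → Fin m → List C
labelAt []      _       = []
labelAt (e ∷ H) zero    = elbl e
labelAt (e ∷ H) (suc i) = labelAt H i

Shaped : ∀ {C m} → List ℕ → Pattern m → Soup C → Set
Shaped ν p H = map (λ e → esrc e , etgt e) H ≡ map (λ { (u , v) → nthF ν u , nthF ν v }) p

shaped? : ∀ {C m} ν (p : Pattern m) (H : Soup C) → Dec (Shaped ν p H)
shaped? ν p H = List.≡-dec (λ { (a , b) (c , d) → map′ (λ { (refl , refl) → refl }) (λ { refl → refl , refl })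
    ((a ≟ c) ×-dec (b ≟ d)) }) _ _

shaped⇒pat : ∀ {C m} ν (p : Pattern m) (H : Soup C) → Shaped ν p H → H ≡ pat ν p (labelAt H)
shaped⇒pat ν []            []             eq = refl
shaped⇒pat ν ((u , v) ∷ p) (ed x w y ∷ H) eq with refl , eq′ ← List.∷-injective eq = cong (_ ∷_)
    (shaped⇒pat ν p H eq′)

labels-tabulate : ∀ {C m} ν (p : Pattern m) (H : Soup C) → Shaped ν p H → concat (toList
    (Vec.tabulate {n = length p} (labelAt H))) ≡ concatMap elbl H
labels-tabulate ν []      []      eq = refl
labels-tabulate ν (_ ∷ p) (e ∷ H) eq = cong (elbl e ++_) (labels-tabulate ν p H (proj₂ (List.∷-injective eq)))

-- The order of the edges in `H` is kept, so that components of the tuple and edges correspond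
-- without a permutation.
find-pattern : ∀ {C m} ν (H : Soup C) → length ν ≡ m → (∀ {z} → z ∈ ends H → z ∈ ν) → ∃ λ
    (p : Pattern m) → Shaped ν p H × length p ≡ length H
find-pattern ν []             l f = [] , refl , refl
find-pattern ν (ed x w y ∷ H) l f
  with u , refl ← ∈-nthF ν l (f (here refl)) | v , refl ← ∈-nthF ν l (f (∈-++⁺ʳ (x ∷ srcs H) (here refl)))
  with p , s , e ← find-pattern ν H l (λ z∈ → f (∈-resp-↭ (↭-sym (prep x (shift y (srcs H) (tgts H)))) (there
      (there z∈)))) =
  (u , v) ∷ p , cong (_ ∷_) s , cong suc e

length-ends : ∀ {C} (H : Soup C) → length (ends H) ≡ length H + length H
length-ends H = trans (List.length-++ (srcs H)) (cong₂ _+_ (List.length-map esrc H) (List.length-map etgt H))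

-- The MCFG of an LLG.

module FromLLG {t : ℕ} (G : LLG t) where
  open LLG G
  open Interp bnd
  open Named G
  open Complete G
  open Multicut G

  Lit : Set
  Lit = Bool × Fin n

  litF : Lit → Formula n
  litF (true  , P) = pos P
  litF (false , P) = neg P

  _≟ˡ_ : ∀ ℓ A → Dec (litF ℓ ≡ A)
  (true , P)  ≟ˡ pos Q   = map′ (cong pos) (λ { refl → refl }) (P Data.Fin.≟ Q)
  (true , P)  ≟ˡ neg Q   = no λ ()
  (true , P)  ≟ˡ (A ⊗ B) = no λ ()
  (true , P)  ≟ˡ (A ⅋ B) = no λ ()
  (false , P) ≟ˡ neg Q   = map′ (cong neg) (λ { refl → refl }) (P Data.Fin.≟ Q)
  (false , P) ≟ˡ pos Q   = no λ ()
  (false , P) ≟ˡ (A ⊗ B) = no λ ()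
  (false , P) ≟ˡ (A ⅋ B) = no λ ()

  size : Lit → ℕ
  size ℓ = sz (litF ℓ)

  NT : Set
  NT = Σ Lit λ ℓ → Pattern (size ℓ)

  patterns : ∀ m → List (Pattern m)
  -- The lengths are 0, ..., m; a matching on m vertices cannot have more than m edges.
  patterns m = concatMap (listsOf (cartesianProduct (allFin m) (allFin m))) (upTo (suc m))

  abstract
    nts : List NT
    nts = concatMap (λ ℓ → map (ℓ ,_) (patterns (size ℓ))) (cartesianProduct (true ∷ false ∷ []) (allFin n))

    ∈-nts : ∀ ℓ p → length p ≤ size ℓ → (ℓ , p) ∈ nts
    ∈-nts ℓ@(b , P) p le = ∈-bind (λ ℓ → map (ℓ ,_) (patterns (size ℓ))) (∈-cartesianProduct⁺ (bool b)
        (∈-allFin P)) (∈-map⁺ (ℓ ,_)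
      (∈-bind (listsOf (cartesianProduct (allFin (size ℓ)) (allFin (size ℓ)))) {upTo (suc (size ℓ))} (∈-upTo⁺
          (s≤s le))
        (∈-listsOf (λ { (u , v) → ∈-cartesianProduct⁺ (∈-allFin u) (∈-allFin v) }) p)))
      where
      bool : ∀ b → b ∈ true ∷ false ∷ []
      bool true  = here refl
      bool false = there (here refl)

  K : ℕ
  K = length nts

  nt : Fin K → NT
  nt = lookup nts

  lit : Fin K → Lit
  lit k = proj₁ (nt k)

  pt : (k : Fin K) → Pattern (size (lit k))
  pt k = proj₂ (nt k)

  find-nt : ∀ ℓ p → length p ≤ size ℓ → ∃ λ k → nt k ≡ (ℓ , p)
  find-nt ℓ p le = Any.index (∈-nts ℓ p le) , sym (Any.lookup-index (∈-nts ℓ p le))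

  -- zero is a new start symbol; component 0 of the other nonterminals is always empty and makes their arity positive.
  ar : Fin (suc K) → ℕ
  ar zero    = 1
  ar (suc k) = suc (length (pt k))

  open Vars ar

  symb : ∀ {body} → Var body → Sym t ar body
  symb (j ▹ i) = var j i

  up : ∀ {b body} → Var body → Var (b ∷ body)
  up (j ▹ i) = suc j ▹ i

  -- What is glued to the formulas of a context. The blocks are reversed as for tests, and `suc i`
  -- skips the empty component 0.
  patSoup : ∀ {C} (ks : List (Fin K)) → Ctx → (Var (map suc ks) → List C) → Soup C
  patSoup []       _       lab = []
  patSoup (k ∷ ks) []      lab = []
  patSoup (k ∷ ks) (b ∷ Θ) lab = pat (reverse (nms b)) (pt k) (λ i → lab (zero ▹ suc i)) ++ patSoup ks Θ (lab ∘ up)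

  -- The variables for the empty components must occur somewhere in a linear production; they are
  -- gathered in component 0 of the head, which thereby stays empty.
  dums : ∀ {C : Set} (ks : List (Fin K)) → (Var (map suc ks) → List C) → List C
  dums []       lab = []
  dums (k ∷ ks) lab = lab (zero ▹ zero) ++ dums ks (lab ∘ up)

  Fits : List (Fin K) → Ctx → Set
  Fits = Pointwise λ k b → litF (lit k) ≡ fm b ^⊥

  fitsE : ∀ Θ → List (∃ λ ks → Fits ks Θ)
  fitsE []      = [ [] , [] ]
  fitsE (b ∷ Θ) = concatMap (λ { (k , e) → map (λ { (ks , f) → k ∷ ks , e ∷ f }) (fitsE Θ) }) (filterE
      (λ k → lit k ≟ˡ (fm b ^⊥)) (allFin K))

  ∈-fitsE : ∀ {ks Θ} → Fits ks Θ → ∃ λ f → (ks , f) ∈ fitsE Θ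
  ∈-fitsE []                     = [] , here refl
  ∈-fitsE {k ∷ ks} {b ∷ Θ} (e ∷ f) with f′ , m ← ∈-fitsE f | e′ , m′ ← ∈-filterE (λ k → lit k ≟ˡ (fm b ^⊥))
      (∈-allFin k) e =
    e′ ∷ f′ , ∈-bind _ m′ (∈-map⁺ _ m)

  patSoup-cong : ∀ {C} ks Θ {lab lab′ : Var (map suc ks) → List C} →
      (∀ x → lab x ≡ lab′ x) → patSoup ks Θ lab ≡ patSoup ks Θ lab′
  patSoup-cong []       Θ       h = refl
  patSoup-cong (k ∷ ks) []      h = refl
  patSoup-cong (k ∷ ks) (b ∷ Θ) h = cong₂ _++_ (pat-cong _ (pt k) (λ i → h (zero ▹ suc i))) (patSoup-cong ks Θ
      (λ x → h (up x)))

  mapL-patSoup : ∀ {C C′} (φ : C → List C′) ks Θ lab → mapL φ (patSoup ks Θ lab) ≡ patSoup ks Θ (concatMap φ ∘ lab)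
  mapL-patSoup φ []       Θ       lab = refl
  mapL-patSoup φ (k ∷ ks) []      lab = refl
  mapL-patSoup φ (k ∷ ks) (b ∷ Θ) lab = trans (List.map-++ (mapLᵉ φ) (pat (reverse (nms b)) (pt k) (λ i → lab
      (zero ▹ suc i))) _)
    (cong₂ _++_ (mapL-pat φ (reverse (nms b)) (pt k) _) (mapL-patSoup φ ks Θ (lab ∘ up)))

  labels-patSoup : ∀ {C : Set} {ks Θ} → Fits ks Θ → (lab : Var (map suc ks) → List C) →
                   dums ks lab ++ concatMap elbl (patSoup ks Θ lab) ↭ overVars (map suc ks) lab
  labels-patSoup []                          lab = refl
  labels-patSoup {ks = k ∷ ks} {b ∷ Θ} (_ ∷ f) lab = ↭-trans
    (++⁺ˡ (dums (k ∷ ks) lab) (↭-reflexive (trans (List.concatMap-++ elbl (pat (reverse (nms b)) (pt k) _) _)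
      (cong (_++ concatMap elbl (patSoup ks Θ (lab ∘ up))) (labels-pat (reverse (nms b)) (pt k) (λ i → lab
          (zero ▹ suc i)))))))
    (↭-trans (solve 4 (λ x y z w → (x ⊕ y) ⊕ (z ⊕ w) ⊜ (x ⊕ z) ⊕ (y ⊕ w)) ↭-refl
        (lab (zero ▹ zero)) (dums ks (lab ∘ up)) (overFin (length (pt k)) (λ i → lab (zero ▹ suc i)))
            (concatMap elbl (patSoup ks Θ (lab ∘ up))))
      (++⁺ˡ (lab (zero ▹ zero) ++ overFin (length (pt k)) (λ i → lab (zero ▹ suc i))) (labels-patSoup f
          (lab ∘ up))))

  vars-↭ : ∀ {body} {s s′ : List (Sym t ar body)} → s ↭ s′ → vars s ↭ vars s′
  vars-↭ refl                        = refl
  vars-↭ (prep (term a) p)           = vars-↭ p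
  vars-↭ (prep (var j i) p)          = prep _ (vars-↭ p)
  vars-↭ (swap (term a) (term b) p)  = vars-↭ p
  vars-↭ (swap (term a) (var j i) p) = prep _ (vars-↭ p)
  vars-↭ (swap (var j i) (term a) p) = prep _ (vars-↭ p)
  vars-↭ (swap (var j i) (var _ _) p) = swap _ _ (vars-↭ p)
  vars-↭ (_↭_.trans p q)             = ↭-trans (vars-↭ p) (vars-↭ q)

  vars-symb : ∀ {body} (xs : List (Var body)) → vars (map symb xs) ≡ xs
  vars-symb []       = refl
  vars-symb (x ∷ xs) = cong (x ∷_) (vars-symb xs)

  vars-overVars : ∀ body → vars (overVars body (λ x → [ symb x ])) ≡ allVars body
  vars-overVars body = trans (cong vars (sym (overVars-map symb body [_]))) (vars-symb (allVars body))

  vars-term : ∀ {body} (w : Word t) → vars {body = body} (concatMap (λ c → [ term c ]) w) ≡ []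
  vars-term []      = refl
  vars-term (c ∷ w) = vars-term w

  terms : ∀ {body} → Soup (Fin t) → Soup (Sym t ar body)
  terms = mapL λ c → [ term c ]

  vars-terms : ∀ {body} (E : Soup (Fin t)) → vars {body = body} (concatMap elbl (terms E)) ≡ []
  vars-terms []             = refl
  vars-terms (ed u w v ∷ E) = trans (vars-++ (concatMap (λ c → [ term c ]) w) _) (cong₂ _++_ (vars-term w)
      (vars-terms E))

  entry : Fin (length Lex) → Judgement t
  entry i = lookup Lex i

  word : Fin (length Lex) → MW t
  word i = Judgement.word (entry i)

  seq : Fin (length Lex) → List (Formula n)
  seq i = Judgement.seq (entry i)

  Γ₀ : Fin (length Lex) → Ctx
  Γ₀ i = proj₁ (nameCtx (seq i) (range 1 (szs (seq i))) (length-range 1 _))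

  fms-Γ₀ : ∀ i → fms (Γ₀ i) ≡ seq i
  fms-Γ₀ i = proj₁ (proj₂ (nameCtx (seq i) (range 1 (szs (seq i))) (length-range 1 _)))

  nm-Γ₀ : ∀ i → nm (Γ₀ i) ≡ range 1 (szs (seq i))
  nm-Γ₀ i = proj₂ (proj₂ (nameCtx (seq i) (range 1 (szs (seq i))) (length-range 1 _)))

  unique-Γ₀ : ∀ i → Unique (nm (Γ₀ i))
  unique-Γ₀ i = subst Unique (sym (nm-Γ₀ i)) (range-unique 1 _)

  Λ : Fin (length Lex) → Ctx
  Λ i = flatC (Γ₀ i)

  unique-Λ : ∀ i → Unique (nm (Λ i))
  unique-Λ i = subst Unique (sym (nm-flatC (Γ₀ i))) (unique-Γ₀ i)

  E₀ : Fin (length Lex) → Soup (Fin t)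
  E₀ i = rn (nm (Γ₀ i)) (reg (word i))

  -- The variables label the glued edges, so a single elimination computes the result for all
  -- arguments at once.
  Esym : ∀ i ks → Ctx → Soup (Sym t ar (map suc ks))
  Esym i ks Θ = terms (E₀ i) ++ patSoup ks Θ (λ x → [ symb x ])

  -- The lexicon entry i with the matchings ks glued to all its literals but a, which leaves the matching k₀ on a.
  record Cfg : Set where
    constructor cfg
    field
      i     : Fin (length Lex)
      reg-i : cyc (word i) ≡ []
      a     : NF
      Θ     : Ctx
      perm  : Λ i ↭ a ∷ Θ
      ks    : List (Fin K)
      fits  : Fits ks Θ
      H     : Soup (Sym t ar (map suc ks))
      el    : Elim (Esym i ks Θ) (nm Θ) H
      k₀    : Fin K
      isLit : litF (lit k₀) ≡ fm a
      shape : Shaped (nms a) (pt k₀) H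

  toProd : Cfg → Production t (suc K) ar
  toProd c = record
    { head = suc k₀ ; body = map suc ks ; rhs = dums ks (λ x → [ symb x ]) ∷ Vec.tabulate (labelAt H)
    -- Elimination conserves labels, so `H` contains exactly the variables of `patSoup`; `D₀` adds
    -- those of the empty components, and together they are all variables, once each.
    ; linear = ↭⇒linear (D₀ ++ concat (toList (Vec.tabulate {n = length (pt k₀)} (labelAt H)))) (↭-trans (vars-↭
        (++⁺ˡ D₀ (↭-trans (↭-reflexive (labels-tabulate (nms a) (pt k₀) H shape))
        (↭-trans (↭-sym (Elim-labels el)) (↭-reflexive (List.concatMap-++ elbl (terms (E₀ i)) _))))))
        (↭-trans (↭-reflexive (trans (vars-++ D₀ _) (cong (vars D₀ ++_) (trans (vars-++ (concatMap elbl (terms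
            (E₀ i))) _)
            (cong (_++ vars (concatMap elbl (patSoup ks Θ (λ x → [ symb x ])))) (vars-terms (E₀ i)))))))
          (↭-trans (↭-reflexive (sym (vars-++ D₀ _))) (↭-trans (vars-↭ (labels-patSoup fits (λ x → [ symb x ])))
            (↭-reflexive (vars-overVars (map suc ks))))))) }
    where
    open Cfg c
    D₀ = dums ks (λ x → [ symb x ])

  empty? : ∀ {A : Set} (xs : List A) → Dec (xs ≡ [])
  empty? []      = yes refl
  empty? (_ ∷ _) = no λ ()

  rootOK? : ∀ {ks} a (H : Soup (Sym t ar (map suc ks))) k → Dec (litF (lit k) ≡ fm a × Shaped (nms a) (pt k) H)
  rootOK? a H k = (lit k ≟ˡ fm a) ×-dec shaped? (nms a) (pt k) H

  rootCfgs : ∀ i → cyc (word i) ≡ [] → ∀ a Θ → Λ i ↭ a ∷ Θ → ∀ ks → Fits ks Θ →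
             ∀ H → Elim (Esym i ks Θ) (nm Θ) H → List Cfg
  rootCfgs i c a Θ p ks f H el = map (λ { (k , l , s) → cfg i c a Θ p ks f H el k l s }) (filterE (rootOK? a H)
      (allFin K))

  elimCfgs : ∀ i → cyc (word i) ≡ [] → ∀ a Θ → Λ i ↭ a ∷ Θ → ∀ ks → Fits ks Θ → List Cfg
  elimCfgs i c a Θ p ks f = concatMap (λ { (H , el) → rootCfgs i c a Θ p ks f H el }) (elimE (nm Θ) (Esym i ks Θ))

  pickCfgs : ∀ i → cyc (word i) ≡ [] → ∀ a Θ → Λ i ↭ a ∷ Θ → List Cfg
  pickCfgs i c a Θ p = concatMap (λ { (ks , f) → elimCfgs i c a Θ p ks f }) (fitsE Θ)

  entryCfgs : ∀ i → cyc (word i) ≡ [] → List Cfg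
  entryCfgs i c = concatMap (λ { (a , Θ , p) → pickCfgs i c a Θ p }) (picksE (Λ i))

  abstract
    cfgs : List Cfg
    cfgs = concatMap (λ { (i , c) → entryCfgs i c }) (filterE (λ i → empty? (cyc (word i))) (allFin (length Lex)))

    cfgs-complete : ∀ i → cyc (word i) ≡ [] → ∀ {a Θ p} → (a , Θ , p) ∈ picksE (Λ i) →
      ∀ {ks} → Fits ks Θ → ∀ {H el} → (H , el) ∈ elimE (nm Θ) (Esym i ks Θ) → ∀ k → litF (lit k) ≡ fm a × Shaped
          (nms a) (pt k) H →
      ∃₂ λ c f → ∃₂ λ l s → cfg i c a Θ p ks f H el k l s ∈ cfgs
    cfgs-complete i c {a} {Θ} {p} m₁ {ks} f {H} {el} m₂ k ok =
      let c′ , m = ∈-filterE (λ i → empty? (cyc (word i))) (∈-allFin i) c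
          f′ , m₃ = ∈-fitsE f
          (l , s) , m₄ = ∈-filterE (rootOK? a H) (∈-allFin k) ok
      in c′ , f′ , l , s ,
         ∈-bind (λ { (i , c) → entryCfgs i c }) m (∈-bind (λ { (a , Θ , p) → pickCfgs i c′ a Θ p }) m₁
           (∈-bind (λ { (ks , f) → elimCfgs i c′ a Θ p ks f }) m₃ (∈-bind (λ {
               (H , el) → rootCfgs i c′ a Θ p ks f′ H el }) m₂
             (∈-map⁺ (λ { (k , l , s) → cfg i c′ a Θ p ks f′ H el k l s }) m₄))))

  -- Concatenates all components. For a matching of `bnd S` these are the empty component 0 and the
  -- label of the only edge.
  startProd : Fin K → Production t (suc K) ar
  startProd k = record
    { head = zero ; body = [ suc k ] ; rhs = map symb (allVars [ suc k ]) ∷ []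
    ; linear = ↭⇒linear (map symb (allVars [ suc k ]) ++ []) (↭-reflexive (trans (cong vars (List.++-identityʳ
        (map symb (allVars [ suc k ])))) (vars-symb (allVars [ suc k ])))) }

  starts : List (Σ (Fin K) λ k → litF (lit k) ≡ pos S)
  starts = filterE (λ k → lit k ≟ˡ pos S) (allFin K)

  M : MCFG t
  M = record { n = suc K ; arity = ar ; arity-pos = λ { zero → s≤s z≤n ;
      (suc k) → s≤s z≤n } ; S = zero ; S-unary = refl
             ; prods = map (startProd ∘ proj₁) starts ++ map toProd cfgs }

  Args : List (Fin (suc K)) → Set
  Args body = (j : Fin (length body)) → Vec (Word t) (ar (lookup body j))

  valOf : ∀ body → Args body → Var body → Word t
  valOf body args (j ▹ i) = Vec.lookup (args j) i

  φ : ∀ body → Args body → Sym t ar body → Word t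
  φ body args (term c)  = [ c ]
  φ body args (var j i) = Vec.lookup (args j) i

  subst-φ : ∀ p args s → substSym M p args s ≡ concatMap (φ (Production.body p) args) s
  subst-φ p args []            = refl
  subst-φ p args (term a ∷ s)  = cong (a ∷_) (subst-φ p args s)
  subst-φ p args (var j i ∷ s) = cong (Vec.lookup (args j) i ++_) (subst-φ p args s)

  mapL-terms : ∀ body (args : Args body) E → mapL (φ body args) (terms E) ≡ E
  mapL-terms body args []             = refl
  mapL-terms body args (ed u w v ∷ E) = cong₂ _∷_ (cong (λ l → ed u l v) (go w)) (mapL-terms body args E)
    where
    go : ∀ w → concatMap (φ body args) (concatMap (λ c → [ term c ]) w) ≡ w
    go []      = refl
    go (c ∷ w) = cong (c ∷_) (go w)

  mapL-Esym : ∀ i ks Θ (args : Args (map suc ks)) → mapL (φ (map suc ks) args) (Esym i ks Θ) ≡ E₀ i ++ patSoup ks Θ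
      (valOf (map suc ks) args)
  mapL-Esym i ks Θ args = trans (List.map-++ (mapLᵉ (φ (map suc ks) args)) (terms (E₀ i)) _) (cong₂ _++_
      (mapL-terms (map suc ks) args (E₀ i))
    (trans (mapL-patSoup (φ (map suc ks) args) ks Θ _) (patSoup-cong ks Θ (λ x → List.++-identityʳ (valOf
        (map suc ks) args x)))))

  root-soup : ∀ c (args : Args (map suc (Cfg.ks c))) →
    mapL (φ (map suc (Cfg.ks c)) args) (Cfg.H c) ≡ pat (nms (Cfg.a c)) (pt (Cfg.k₀ c)) (λ i → Vec.lookup (Vec.map
        (substSym M (toProd c) args) (Production.rhs (toProd c))) (suc i))
  root-soup c args = trans (cong (mapL (φ (map suc ks) args)) (shaped⇒pat (nms a) (pt k₀) H shape))
    (trans (mapL-pat (φ (map suc ks) args) (nms a) (pt k₀) (labelAt H)) (pat-cong (nms a) (pt k₀) λ i → sym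
      (trans (Vec.lookup-map i (substSym M (toProd c) args) (Vec.tabulate (labelAt H)))
        (trans (cong (substSym M (toProd c) args) (Vec.lookup∘tabulate (labelAt H) i)) (subst-φ (toProd c) args
            (labelAt H i))))))
    where open Cfg c

  -- `relabel` needs the old and the new names to be disjoint, so the renaming passes through fresh
  -- names `ζ`.
  nrename : ∀ {A μ ν l l′ E} → Unique μ → Unique ν → NDer [ nf A μ l ] E → ∃ λ f → map f μ ≡ ν × NDer [ nf A ν l′ ]
      (mapV f E)
  nrename {A} {μ} {ν} {l} {l′} {E} uμ uν d with ζ , lζ , uζ , ζ∉ ← fresh-for (μ ++ ν) (sz A) =
    sub ζ ν ∘ sub μ ζ ,
    trans (List.map-∘ μ) (trans (cong (map (sub ζ ν)) (map-sub μ ζ uμ (trans lζ (sym l)))) (map-sub ζ ν uζ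
        (trans l′ (sym lζ)))) ,
    nresp (↭-reflexive (mapV-∘ (sub μ ζ) (sub ζ ν) E))
      (via ν l′ (via ζ lζ d (Uniq.++⁺ uζ uμ λ { (p , q) → ζ∉ p (∈-++⁺ˡ q) })) (Uniq.++⁺ uν uζ λ { (p , q) → ζ∉ q
          (∈-++⁺ʳ μ p) }))
    where
    via : ∀ {ξ E} {l : length ξ ≡ sz A} α (la : length α ≡ sz A) → NDer [ nf A ξ l ] E → Unique
        (α ++ ξ) → NDer [ nf A α la ] (mapV (sub ξ α) E)
    via {ξ} {l = l} α la d u = relabel {Γ = []} α d
      (nid A α (reverse ξ) {la} {trans (List.length-reverse ξ) (trans l (sym (sz-⊥ A)))})
      (↭-reflexive (cong (links ⟦ A ⟧ α) (List.reverse-involutive ξ))) la refl (subst (λ z → Unique (α ++ z)) (sym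
          (List.++-identityʳ ξ)) u)

  NDerivable : (k : Fin K) → Vec (Word t) (ar (suc k)) → Set
  NDerivable k v = ∀ ν l → Unique ν → NDer [ nf (litF (lit k)) ν l ] (pat ν (pt k) (λ i → Vec.lookup v (suc i)))

  -- The induction hypothesis for derivable tuples; the emptiness of component 0 is part of it
  -- because the start production concatenates all components.
  Inv : ∀ X → Vec (Word t) (ar X) → Set
  Inv zero    v = ∀ w → toList v ≡ [ w ] → LLG-L G w
  Inv (suc k) v = Vec.lookup v zero ≡ [] × NDerivable k v

  closed-args : ∀ {ks Θ} → Fits ks Θ → (args : Args (map suc ks)) → (∀ j → Inv (lookup (map suc ks) j)
      (args j)) → Unique (nm Θ) →
                Closed Θ (patSoup ks Θ (valOf (map suc ks) args))
  closed-args [] args inv u = refl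
  closed-args {k ∷ ks} {b ∷ Θ} (e ∷ f) args inv u = F₁ , _ , refl ,
    (l⊥ , subst (λ A → (l : length (reverse (nms b)) ≡ sz A) → NDer [ nf A (reverse (nms b)) l ] F₁) e
        (λ l → proj₂ (inv zero) (reverse (nms b)) l (Unique-resp-↭ (↭-sym (↭-reverse (nms b))) (Unique-++ʳ
            (nm Θ) u))) l⊥) ,
    closed-args f (λ j → args (suc j)) (λ j → inv (suc j)) (Unique-++ˡ (nm Θ) u)
    where
    F₁ = pat (reverse (nms b)) (pt k) (λ i → Vec.lookup (args zero) (suc i))
    l⊥ : length (reverse (nms b)) ≡ sz (fm b ^⊥)
    l⊥ = trans (List.length-reverse (nms b)) (trans (len b) (sym (sz-⊥ (fm b))))

  dums-empty : ∀ ks (args : Args (map suc ks)) → (∀ j → Inv (lookup (map suc ks) j) (args j)) →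
               concatMap (φ (map suc ks) args) (dums ks (λ x → [ symb x ])) ≡ []
  dums-empty ks args inv = trans (go ks symb (φ (map suc ks) args)) (empty ks args inv)
    where
    go : ∀ {C C′ : Set} ks (lab : Var (map suc ks) → C) (ψ : C → List C′) →
         concatMap ψ (dums ks (λ x → [ lab x ])) ≡ dums ks (λ x → ψ (lab x))
    go []       lab ψ = refl
    go (k ∷ ks) lab ψ = cong (ψ (lab (zero ▹ zero)) ++_) (go ks (lab ∘ up) ψ)
    empty : ∀ ks (args : Args (map suc ks)) → (∀ j → Inv (lookup (map suc ks) j) (args j)) →
            dums ks (λ x → φ (map suc ks) args (symb x)) ≡ []
    empty []       args inv = refl
    empty (k ∷ ks) args inv = cong₂ _++_ (proj₁ (inv zero)) (empty ks (λ j → args (suc j)) (λ j → inv (suc j)))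

  Λ-derivable : ∀ i → cyc (word i) ≡ [] → NDer (Λ i) (E₀ i)
  Λ-derivable i c = subst (λ Z → NDer Z (E₀ i)) (List.++-identityʳ (Λ i))
    (flatC-der (Γ₀ i) [] (subst (λ Z → Unique (nm Z)) (sym (List.++-identityʳ (Γ₀ i))) (unique-Γ₀ i))
      (subst (λ Z → NDer Z (E₀ i)) (sym (List.++-identityʳ (Γ₀ i))) (nlex (∈-lookup i) c (fms-Γ₀ i))))

  -- A soup has twice as many ends as edges, so two ends leave exactly one edge, and its label is
  -- the only component that may be nonempty.
  single-edge : ∀ {m} (p : Pattern m) (v : Vec (Word t) (suc (length p))) {w} (es : List (Edge t)) {ν μ} → ends
      (pat ν p (λ i → Vec.lookup v (suc i))) ↭ 1 ∷ 2 ∷ [] →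
                Vec.lookup v zero ≡ [] → concat (toList v) ≡ w →
                rn μ es ↭ pat ν p (λ i → Vec.lookup v (suc i)) → ∃₂ λ i j → es ≡ [ edge i w j ]
  single-edge [] v es e _ _ _ with () ← ↭-length e
  single-edge (_ ∷ []) ([] ∷ w ∷ []) es e refl refl p with es | ↭-singleton-inv p
  ... | edge i _ j ∷ [] | r = i , j , cong (λ l → [ edge i l j ]) (trans (cong elbl (proj₁ (List.∷-injective r)))
      (sym (List.++-identityʳ w)))
  single-edge (x ∷ y ∷ p) v es {ν} e _ _ _ = ⊥-elim (two (trans (sym (length-ends (pat ν (x ∷ y ∷ p)
      (λ i → Vec.lookup v (suc i))))) (↭-length e)))
    where
    two : ∀ {m} → suc (suc m) + suc (suc m) ≡ 2 → ⊥
    two {m} eq with () ← trans (sym (ℕ.+-suc m (suc m))) (ℕ.suc-injective (ℕ.suc-injective eq))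

  lenS : length (1 ∷ 2 ∷ []) ≡ sz (pos S)
  lenS with S-ok
  ... | inj₁ eq = sym (cong length eq)
  ... | inj₂ eq = sym (cong length eq)

  start-word : ∀ k (args : Args [ suc k ]) → concatMap (φ [ suc k ] args) (map symb (allVars [ suc k ])) ≡ concat
      (toList (args zero))
  start-word k args = trans (cong (concatMap (φ [ suc k ] args)) (overVars-map symb [ suc k ] [_]))
    (trans (overVars-concatMap (φ [ suc k ] args) [ suc k ] (λ x → [ symb x ])) (trans (List.++-identityʳ (overFin
        (ar (suc k)) (λ i → Vec.lookup (args zero) i ++ [])))
      (trans (overFin-cong (ar (suc k)) (λ i → List.++-identityʳ (Vec.lookup (args zero) i))) (go (args zero)))))
    where
    go : ∀ {m} (v : Vec (Word t) m) → overFin m (Vec.lookup v) ≡ concat (toList v)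
    go []      = refl
    go (w ∷ v) = cong (w ++_) (go v)

  start-inv : ∀ k → litF (lit k) ≡ pos S → (args : Args [ suc k ]) → Inv (suc k) (args zero) →
              LLG-L G (concat (toList (args zero)))
  start-inv k eq args (e₀ , h) =
    let σ , d , c , q = NDer⇒Der (h (1 ∷ 2 ∷ []) l (range-unique 1 2))
        i , j , r = single-edge (pt k) (args zero) (reg σ) {1 ∷ 2 ∷ []} {1 ∷ 2 ∷ []} (NDer⇒ends (h (1 ∷ 2 ∷ []) l
            (range-unique 1 2))) e₀ refl q
    in σ , subst (λ A → _⊩_ G σ [ A ]) eq d , c , i , j , r
    where
    l : length (1 ∷ 2 ∷ []) ≡ sz (litF (lit k))
    l = trans lenS (cong sz (sym eq))

  cfg-inv : ∀ c (args : Args (map suc (Cfg.ks c))) → (∀ j → Inv (lookup (map suc (Cfg.ks c)) j) (args j)) →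
            Inv (suc (Cfg.k₀ c)) (Vec.map (substSym M (toProd c) args) (Production.rhs (toProd c)))
  cfg-inv c args inv = trans (subst-φ (toProd c) args (dums ks (λ x → [ symb x ])))
      (dums-empty ks args inv) , derivable
    where
    open Cfg c
    u : Unique (nm (Θ ++ [ a ]))
    u = Unique-resp-↭ (nm-↭ (↭-trans perm (++-comm [ a ] Θ))) (unique-Λ i)
    at-a : NDer [ a ] (mapL (φ (map suc ks) args) H)
    at-a = multicut Θ u (nperm (↭-trans perm (++-comm [ a ] Θ)) (Λ-derivable i reg-i))
      (closed-args fits args inv (Unique-++ˡ (nm Θ) (Unique-resp-↭ (nm-++-↭ Θ [ a ]) u)))
      (subst (λ Z → Elim Z (nm Θ) (mapL (φ (map suc ks) args) H)) (mapL-Esym i ks Θ args) (Elim-mapL (φ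
          (map suc ks) args) el))
    v = Vec.map (substSym M (toProd c) args) (Production.rhs (toProd c))
    derivable : NDerivable k₀ v
    derivable ν l uν =
      let f , eq , d = nrename {l = len a} {l′ = trans l (cong sz isLit)} (Unique-++ʳ (nm Θ) (Unique-resp-↭ (nm-↭ perm) (unique-Λ i))) uν at-a
      in subst (λ A → (l : length ν ≡ sz A) → NDer [ nf A ν l ] (pat ν (pt k₀) (λ i → Vec.lookup v (suc i))))
          (sym isLit)
           (λ l → subst₂ (λ x y → NDer [ x ] y) (nf-cong refl)
             (trans (cong (mapV f) (root-soup c args)) (trans (mapV-pat f (nms a) (pt k₀) (λ i → Vec.lookup v
                 (suc i)) (trans (len a) (cong sz (sym isLit)))) (cong (λ z → pat z (pt k₀) (λ i → Vec.lookup v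
                 (suc i))) eq)))
             d) l

  derivable⇒Inv : ∀ {X v} → MDerivable M X v → Inv X v
  derivable⇒Inv (rule p p∈ args ds) with ∈-++⁻ (map (startProd ∘ proj₁) starts) p∈
  ... | inj₁ q with (k , eq) , _ , refl ← ∈-map⁻ (startProd ∘ proj₁) q = λ w e →
    subst (LLG-L G) (trans (sym (trans (subst-φ (startProd k) args (map symb (allVars [ suc k ])))
        (start-word k args))) (proj₁ (List.∷-injective e)))
      (start-inv k eq args (derivable⇒Inv (ds zero)))
  ... | inj₂ q with c , _ , refl ← ∈-map⁻ toProd q = cfg-inv c args (λ j → derivable⇒Inv (ds j))

  MCFG⊆LLG : ∀ w → MCFG-L M w → LLG-L G w
  MCFG⊆LLG w (v , d , eq) = derivable⇒Inv d w eq

  -- The soups that the MCFG derives for the literal with sign `b`. Both signs are inhabited this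
  -- way, since every literal of a lexicon entry can be output or input; closure under the lexicon
  -- is closure under the productions `toProd`.
  D : Bool → Fin n → List ℕ → Soup (Fin t) → Set
  D b P ν E = length ν ≡ size (b , P) × ends E ↭ ν ×
    ∃₂ λ k v → lit k ≡ (b , P) × MDerivable M (suc k) v × E ↭ pat ν (pt k) (λ i → Vec.lookup v (suc i))

  D-resp : ∀ {b P ν E F} → E ↭ F → D b P ν E → D b P ν F
  D-resp p (l , e , k , v , eq , d , q) = l , ↭-trans (↭-sym (ends-↭ p)) e , k , v , eq , d , ↭-trans (↭-sym p) q

  D-ends : ∀ {b P ν E} → D b P ν E → ends E ↭ ν
  D-ends (_ , e , _) = e

  D-rename : ∀ {b P ν E} f → D b P ν E → D b P (map f ν) (mapV f E)
  D-rename {ν = ν} {E} f (l , e , k , v , eq , d , q) = trans (List.length-map f ν) l ,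
    ↭-trans (↭-reflexive (ends-mapV f E)) (map⁺ f e) , k , v , eq , d ,
    ↭-trans (map⁺ _ q) (↭-reflexive (mapV-pat f ν (pt k) _ (trans l (cong size (sym eq)))))

  open Semantics G D (λ {b} {P} → D-resp {b} {P}) (λ {b} {P} → D-ends {b} {P}) (λ {b} {P} → D-rename {b} {P})

  Literal : NF → Set
  Literal a = ∃ λ ℓ → fm a ≡ litF ℓ

  flat-literal : ∀ A ν l → ⊗-free A → All Literal (flat A ν l)
  flat-literal (pos P) ν l _ = ((true , P) , refl) ∷ []
  flat-literal (neg P) ν l _ = ((false , P) , refl) ∷ []
  flat-literal (A ⅋ B) ν l (fA , fB) = All.++⁺ (flat-literal A _ _ fA) (flat-literal B _ _ fB)

  -- The point where ⊗-freeness is used: the tests of a flattened lexicon sequent are covalues of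
  -- literals, that is, derivable tuples.
  flatC-literal : ∀ Γ → All ⊗-free (fms Γ) → All Literal (flatC Γ)
  flatC-literal []      []       = []
  flatC-literal (a ∷ Γ) (f ∷ fs) = All.++⁺ (flat-literal (fm a) (nms a) (len a) f) (flatC-literal Γ fs)

  covalue : ∀ ℓ {ν E} → C (litF ℓ) ν E → ∃₂ λ k v → litF (lit k) ≡ litF ℓ ^⊥ × MDerivable M (suc k) v × E ↭ pat ν
      (pt k) (λ i → Vec.lookup v (suc i))
  covalue (true  , P) (_ , _ , k , v , eq , d , r) = k , v , cong litF eq , d , r
  covalue (false , P) (_ , _ , k , v , eq , d , r) = k , v , cong litF eq , d , r

  tests⇒args : ∀ Θ {F} → All Literal Θ → Test Θ F → ∃ λ ks → Fits ks Θ × ∃ λ (args : Args (map suc ks)) →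
    (∀ j → MDerivable M (lookup (map suc ks) j) (args j)) × F ↭ patSoup ks Θ (valOf (map suc ks) args)
  tests⇒args [] [] t = [] , [] , (λ ()) , (λ ()) , t
  tests⇒args (nf _ β l ∷ Θ) {F} ((ℓ , refl) ∷ ls) (F₁ , F₂ , p , c , t)
    with ks , f , args , ds , q ← tests⇒args Θ ls t
    with k , v , e , d , r ← covalue ℓ c =
    k ∷ ks , e ∷ f , args′ , ds′ , ↭-trans p (++⁺ r q)
    where
    args′ : Args (map suc (k ∷ ks))
    args′ zero    = v
    args′ (suc j) = args j
    ds′ : ∀ j → MDerivable M (lookup (map suc (k ∷ ks)) j) (args′ j)
    ds′ zero    = d
    ds′ (suc j) = ds j

  value : ∀ ℓ {ν E} → length ν ≡ size ℓ → ends E ↭ ν →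
          (∃₂ λ k v → lit k ≡ ℓ × MDerivable M (suc k) v × E ↭ pat ν (pt k) (λ i → Vec.lookup v (suc i))) → V
              (litF ℓ) ν E
  value (true  , P) l e x = l , e , x
  value (false , P) l e x = l , e , x

  entry-ends : ∀ i {Γ} → fms Γ ≡ seq i → ends (rn (nm Γ) (reg (word i))) ↭ nm Γ
  entry-ends i {Γ} eq = Match⇒ends {X = ⟦ fms Γ ⟧ˢ} (length-nm Γ) (Good⇒Match {X = ⟦ fms Γ ⟧ˢ} {nm Γ} (length-nm Γ)
    (IsMultiword⇒Good {X = ⟦ fms Γ ⟧ˢ} {word i}
      (subst (λ Z → IsMultiword ⟦ Z ⟧ˢ (word i)) (sym eq) (Judgement.isMW (entry i)))))

  srcs-mapL : ∀ {C C′ : Set} (ψ : C → List C′) E → srcs (mapL ψ E) ≡ srcs E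
  srcs-mapL ψ []             = refl
  srcs-mapL ψ (ed u w v ∷ E) = cong (u ∷_) (srcs-mapL ψ E)

  tgts-mapL : ∀ {C C′ : Set} (ψ : C → List C′) E → tgts (mapL ψ E) ≡ tgts E
  tgts-mapL ψ []             = refl
  tgts-mapL ψ (ed u w v ∷ E) = cong (v ∷_) (tgts-mapL ψ E)

  cfg-value : ∀ c → c ∈ cfgs → ∀ ℓ → fm (Cfg.a c) ≡ litF ℓ → lit (Cfg.k₀ c) ≡ ℓ →
    (args : Args (map suc (Cfg.ks c))) → (∀ j → MDerivable M (lookup (map suc (Cfg.ks c)) j) (args j)) →
    ∀ {H} → mapL (φ (map suc (Cfg.ks c)) args) (Cfg.H c) ↭ H → ends H ↭ nms (Cfg.a c) → V (fm (Cfg.a c)) (nms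
        (Cfg.a c)) H
  cfg-value c c∈ ℓ eqℓ eqk args ds {R} R↭ eR = subst (λ A → V A (nms a) R) (sym eqℓ)
    (value ℓ (trans (len a) (cong sz eqℓ)) eR (k₀ , Vec.map (substSym M (toProd c) args) (Production.rhs
        (toProd c)) , eqk ,
      rule (toProd c) (∈-++⁺ʳ (map (startProd ∘ proj₁) starts) (∈-map⁺ toProd c∈)) args ds ,
      ↭-trans (↭-sym R↭) (↭-reflexive (root-soup c args))))
    where open Cfg c

  root-value : ∀ i → cyc (word i) ≡ [] → ∀ {a Θ perm} → (a , Θ , perm) ∈ picksE (Λ i) → ∀ ℓ → fm a ≡ litF ℓ →
    ∀ {ks} → Fits ks Θ → (args : Args (map suc ks)) → (∀ j → MDerivable M (lookup (map suc ks) j) (args j)) →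
    ∀ {H′ el H} → (H′ , el) ∈ elimE (nm Θ) (Esym i ks Θ) → mapL (φ (map suc ks) args) H′ ↭ H → ends H ↭ nms a → V
        (fm a) (nms a) H
  root-value i c {a} {Θ} {perm} mΘ ℓ eqℓ {ks} fits args ds {H′} {el} {H} mH H↭ eH = conclude (find-pattern
      (nms a) H′ la (∈-resp-↭ eH′))
    where
    la : length (nms a) ≡ size ℓ
    la = trans (len a) (cong sz eqℓ)
    eH′ : ends H′ ↭ nms a
    eH′ = ↭-trans (↭-reflexive (sym (cong₂ _++_ (srcs-mapL (φ (map suc ks) args) H′) (tgts-mapL (φ
        (map suc ks) args) H′)))) (↭-trans (ends-↭ H↭) eH)
    at-root : ∀ p → Shaped (nms a) p H′ → (∃ λ k → nt k ≡ (ℓ , p)) → V (fm a) (nms a) H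
    at-root p shape (k₀ , eqk) = found (cfgs-complete i c {a} {Θ} {perm} mΘ fits mH k₀
        (trans (cong litF (cong proj₁ eqk)) (sym eqℓ) , subst (λ x → Shaped (nms a) (proj₂ x) H′) (sym eqk) shape))
      where
      found : (∃₂ λ c f → ∃₂ λ l s → cfg i c a Θ perm ks f H′ el k₀ l s ∈ cfgs) → V (fm a) (nms a) H
      found (c′ , f′ , l′ , s′ , m) = cfg-value (cfg i c′ a Θ perm ks f′ H′ el k₀ l′ s′) m ℓ eqℓ
          (cong proj₁ eqk) args ds H↭ eH
    conclude : (∃ λ (p : Pattern (size ℓ)) → Shaped (nms a) p H′ × length p ≡ length H′) → V (fm a) (nms a) H
    -- Twice the number of edges is the size of the block, so the pattern is short enough to be
    -- among the nonterminals.
    conclude (p , shape , lp) = at-root p shape (find-nt ℓ p (ℕ.≤-trans (ℕ.m≤m+n (length p) (length p))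
        (ℕ.≤-reflexive
      (trans (cong (λ z → z + z) lp) (trans (sym (length-ends H′)) (trans (↭-length eH′) la))))))

  -- The tests select nonterminals and arguments. The elimination on words lifts to one on symbols
  -- by `Elim-mapL⁻`, which up to permutation is enumerated by `elimE`; the corresponding production
  -- then derives the output.
  Λ-valid : ∀ i → cyc (word i) ≡ [] → All ⊗-free (seq i) → Valid (Λ i) (E₀ i)
  Λ-valid i c free {a} {Θ₁} {F} {H} perm₁ t₁ k₁ = picked (∈-picksE perm₁)
    where
    picked : (∃₂ λ Θ perm → (a , Θ , perm) ∈ picksE (Λ i) × Θ₁ ↭ Θ) → V (fm a) (nms a) H
    picked (Θ , perm , mΘ , q) = tested (tests⇒args Θ (All.tail ls) t₂)
      where
      t₂ = Test-↭ q t₁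
      k = Elim-perm (nm-↭ q) k₁
      ls = All-resp-↭ perm (flatC-literal (Γ₀ i) (subst (All ⊗-free) (sym (fms-Γ₀ i)) free))
      eE : ends (E₀ i) ↭ nms a ++ nm Θ
      eE = ↭-trans (entry-ends i {Γ₀ i} (fms-Γ₀ i)) (↭-trans (↭-reflexive (sym (nm-flatC (Γ₀ i)))) (↭-trans
          (nm-↭ perm) (++-comm (nm Θ) (nms a))))
      tested : (∃ λ ks → Fits ks Θ × ∃ λ (args : Args (map suc ks)) →
        (∀ j → MDerivable M (lookup (map suc ks) j) (args j)) × F ↭ patSoup ks Θ (valOf (map suc ks) args)) → V
            (fm a) (nms a) H
      tested (ks , fits , args , ds , F↭) = eliminated (Elim-mapL⁻ {E = Esym i ks Θ} (φ (map suc ks) args)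
          (Elim-respˡ (↭-trans (↭-reflexive (mapL-Esym i ks Θ args)) (++⁺ˡ (E₀ i) (↭-sym F↭))) k))
        where
        found : ∀ {H₀} → mapL (φ (map suc ks) args) H₀ ↭ H →
                (∃₂ λ H′ el → (H′ , el) ∈ elimE (nm Θ) (Esym i ks Θ) × H₀ ↭ H′) → V (fm a) (nms a) H
        found H↭ (H′ , el , mH , H₀↭) = root-value i c mΘ (proj₁ (All.head ls)) (proj₂
            (All.head ls)) fits args ds mH
          (↭-trans (map⁺ (mapLᵉ (φ (map suc ks) args)) (↭-sym H₀↭)) H↭) (Elim-ends-cut {E = E₀ i} {F} eE
              (Test-ends Θ t₂) refl k)
        eliminated : (∃ λ H₀ → Elim (Esym i ks Θ) (nm Θ) H₀ × mapL (φ (map suc ks) args) H₀ ↭ H) → V (fm a)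
            (nms a) H
        eliminated (H₀ , el₀ , H↭) = found H↭ (∈-elimE (nm Θ) (Esym i ks Θ) el₀)

  ren : (ℕ → ℕ) → NF → NF
  ren g (nf A ν l) = nf A (map g ν) (trans (List.length-map g ν) l)

  nm-ren : ∀ g Γ → nm (map (ren g) Γ) ≡ map g (nm Γ)
  nm-ren g []      = refl
  nm-ren g (a ∷ Γ) = trans (cong (_++ map g (nms a)) (nm-ren g Γ)) (sym (List.map-++ g (nm Γ) (nms a)))

  fms-ren : ∀ g Γ → fms (map (ren g) Γ) ≡ fms Γ
  fms-ren g []      = refl
  fms-ren g (a ∷ Γ) = cong (fm a ∷_) (fms-ren g Γ)

  ctx-≡ : ∀ Γ Δ → fms Γ ≡ fms Δ → nm Γ ≡ nm Δ → Γ ≡ Δ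
  ctx-≡ []              []               _ _ = refl
  ctx-≡ (nf A ν l ∷ Γ) (nf B μ l′ ∷ Δ) p q with refl , p′ ← List.∷-injective p
    with q₁ , q₂ ← ++-injective (nm Γ) (nm Δ) (trans (length-nm Γ) (trans (cong szs p′) (sym (length-nm Δ)))) q =
    cong₂ _∷_ (nf-cong q₂) (ctx-≡ Γ Δ p′ q₁)

  Test-ren : ∀ (f g : ℕ → ℕ) Θ {F} → (∀ {z} → z ∈ nm Θ → f (g z) ≡ z) → Test Θ F → Test (map (ren g) Θ) (mapV g F)
  Test-ren f g []      inv t = map⁺ _ t
  Test-ren f g (a ∷ Θ) inv (F₁ , F₂ , p , c , t) = mapV g F₁ , mapV g F₂ , ↭-trans (map⁺ _ p) (↭-reflexive
      (List.map-++ _ F₁ F₂)) ,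
    subst (λ z → C (fm a) z (mapV g F₁)) (List.reverse-map g (nms a))
      (C-rename (fm a) g f (λ z∈ → inv (∈-++⁺ʳ (nm Θ) (∈-resp-↭ (↭-reverse (nms a)) z∈))) c) ,
    Test-ren f g Θ (λ z∈ → inv (∈-++⁺ˡ z∈)) t

  -- The productions know each lexicon sequent under its canonical names only. Tests are carried
  -- there by `g` and the resulting value is brought back by `f`.
  valid-ren : ∀ (f g : ℕ → ℕ) {Γ E} → (∀ {z} → z ∈ nm Γ → f (g z) ≡ z) → ends E ↭ nm Γ → Valid (map (ren g) Γ)
      (mapV g E) → Valid Γ E
  valid-ren f g {Γ} {E} inv e v {a} {Θ} {F} {H} p t k = subst₂ (V (fm a)) (map-inverse (nms a) inva)
      (trans (mapV-∘ g f H) (mapV-fix H (λ z∈ → inva (∈-resp-↭ eH z∈))))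
      (V-rename (fm a) f g invb (v (map⁺ (ren g) p) (Test-ren f g Θ (λ z∈ → inv (∈-resp-↭ (nm-↭ (↭-sym p))
          (∈-++⁺ˡ z∈))) t)
        (subst₂ (λ x y → Elim x y (mapV g H)) (List.map-++ _ E F) (sym (nm-ren g Θ)) (Elim-mapV g k))))
    where
    inva : ∀ {z} → z ∈ nms a → f (g z) ≡ z
    inva z∈ = inv (∈-resp-↭ (nm-↭ (↭-sym p)) (∈-++⁺ʳ (nm Θ) z∈))
    invb : ∀ {z} → z ∈ map g (nms a) → g (f z) ≡ z
    invb z∈ with y , y∈ , refl ← ∈-map⁻ g z∈ = cong g (inva y∈)
    eH : ends H ↭ nms a
    eH = Elim-ends-cut {E = E} {F} (↭-trans e (↭-trans (nm-↭ p) (++-comm (nm Θ) (nms a)))) (Test-ends Θ t) refl k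

  module _ (free : ⊗-freeLex G) where

    lex-valid : ∀ {j Γ} → j ∈ Lex → cyc (Judgement.word j) ≡ [] → fms Γ ≡ Judgement.seq j → Unique (nm Γ) →
                Valid Γ (rn (nm Γ) (reg (Judgement.word j)))
    lex-valid {j} {Γ} j∈ c eq u with Any.index j∈ | Any.lookup-index j∈
    ... | i | refl = valid-ren (sub ρ (nm Γ)) (sub (nm Γ) ρ)
        (map-fix (nm Γ) (trans (List.map-∘ (nm Γ)) (trans (cong (map (sub ρ (nm Γ))) g-nm) (map-sub ρ (nm Γ)
            (range-unique 1 m) (sym lρ)))))
        (entry-ends i {Γ} eq)
        (subst₂ Valid (sym ctx) (sym soup) (subst (λ Z → Valid Z (E₀ i)) (List.++-identityʳ (Γ₀ i))
          (valid-flatC (Γ₀ i) [] (subst (λ Z → ends (E₀ i) ↭ nm Z) (sym (List.++-identityʳ (Γ₀ i)))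
              (entry-ends i {Γ₀ i} (fms-Γ₀ i)))
            (subst (λ Z → Valid Z (E₀ i)) (sym (List.++-identityʳ (Λ i))) (Λ-valid i c (All.lookup free j∈))))))
      where
      m = szs (seq i)
      ρ = range 1 m
      lρ : length ρ ≡ length (nm Γ)
      lρ = trans (length-range 1 m) (trans (cong szs (sym eq)) (sym (length-nm Γ)))
      g-nm : map (sub (nm Γ) ρ) (nm Γ) ≡ ρ
      g-nm = map-sub (nm Γ) ρ u lρ
      ctx : map (ren (sub (nm Γ) ρ)) Γ ≡ Γ₀ i
      ctx = ctx-≡ _ (Γ₀ i) (trans (fms-ren _ Γ) (trans eq (sym (fms-Γ₀ i)))) (trans (nm-ren _ Γ) (trans g-nm (sym
          (nm-Γ₀ i))))
      es = reg (word i)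
      nth-map : ∀ (g : ℕ → ℕ) ν {v} → 1 ≤ v → v ≤ length ν → nth (map g ν) v ≡ g (nth ν v)
      nth-map g (x ∷ ν) {suc zero}    p q = refl
      nth-map g (x ∷ ν) {suc (suc v)} p (s≤s q) = nth-map g ν (s≤s z≤n) q
      mapV-rn : ∀ g (es : List (Edge t)) → mapV g (rn (nm Γ) es) ≡ map (named (g ∘ nth (nm Γ))) es
      mapV-rn g []              = refl
      mapV-rn g (edge _ _ _ ∷ es) = cong (_ ∷_) (mapV-rn g es)
      inRange : InRange m es
      inRange = Good⇒InRange {X = ⟦ seq i ⟧ˢ} (IsMultiword⇒Good {X = ⟦ seq i ⟧ˢ} {word i} (Judgement.isMW
          (entry i)))
      soup : mapV (sub (nm Γ) ρ) (rn (nm Γ) es) ≡ E₀ i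
      soup = trans (mapV-rn _ es) (trans (named-cong es λ v∈ → let p , q = inRange v∈ in
               sym (nth-map (sub (nm Γ) ρ) (nm Γ) p (ℕ.≤-trans q (ℕ.≤-reflexive (trans (cong szs (sym eq)) (sym
                   (length-nm Γ)))))))
             (cong (λ ν → rn ν es) (trans g-nm (sym (nm-Γ₀ i)))))

    LLG⊆MCFG : ∀ w → LLG-L G w → MCFG-L M w
    LLG⊆MCFG w (σ , d , c , i , j , eq)
      with _ , e , k , v , eqk , dv , q ← sound lex-valid (⊩⇒NDer d c {[ nf (pos S) (1 ∷ 2 ∷ []) lenS ]} refl
          (range-unique 1 2)) (range-unique 1 2)
                                 {Θ = []} {[]} refl refl (done (++-identityʳ _)) =
      _ , rule (startProd k) (∈-++⁺ˡ (∈-map⁺ (startProd ∘ proj₁) (proj₂ start∈))) args (λ { zero → dv }) ,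
      cong [_] (trans (subst-φ (startProd k) args (map symb (allVars [ suc k ]))) (trans (start-word k args) eqw))
      where
      start∈ = ∈-filterE (λ k → lit k ≟ˡ pos S) (∈-allFin k) (cong litF eqk)
      args : Args [ suc k ]
      args zero = v
      -- By the opposite inclusion, `derivable⇒Inv`, component 0 of the derived tuple is empty, so
      -- the concatenation is the label of the one edge.
      eqw : concat (toList v) ≡ w
      eqw with single-edge (pt k) v (reg σ) {1 ∷ 2 ∷ []} {1 ∷ 2 ∷ []} (↭-trans (↭-sym (ends-↭ q)) e) (proj₁
          (derivable⇒Inv dv)) refl q
      ... | _ , _ , r = cong lbl (proj₁ (List.∷-injective (trans (sym r) eq)))

mainTheorem1 : (t : ℕ) (L : Word t → Set) →
    (Σ (MCFG t) λ G → ∀ w → L w ⇔ MCFG-L G w) ⇔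
    (Σ (LLG t) λ G′ → ⊗-freeLex G′ × (∀ w → L w ⇔ LLG-L G′ w))
mainTheorem1 t L = mk⇔
  (λ { (M , h) → let open FromMCFG M in G , lex-⊗-free , λ w →
       mk⇔ (MCFG⊆LLG w ∘ h w .Equivalence.to) (h w .Equivalence.from ∘ LLG⊆MCFG w) })
  (λ { (G , free , h) → let open FromLLG G in M , λ w →
       mk⇔ (LLG⊆MCFG free w ∘ h w .Equivalence.to) (h w .Equivalence.from ∘ MCFG⊆LLG w) })
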